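{- Given positive integers $n,s$, one can construct a set $\widetilde{\mathcal{H}}_1\subseteq\mathbb{M}_{d'}(K)^n$ of size $(ns)^{O(\log ns)}$, where $d'\le\mathrm{poly}(n,s)$ and $K=\mathbb{Q}(\omega,z)$ with $z$ a commuting indeterminate and $\omega$ a primitive $\ell$-th root of unity for some $\ell\le\mathrm{poly}(n,s)$, which is a strong hitting set for the class of noncommutative rational formulas in $\mathbb{Q}$ over $x_1,\ldots,x_n$ of size $s$ and inversion height one: for every such formula $r$ that is nonzero in the free skew field, there is $\underline{u}\in\widetilde{\mathcal{H}}_1$ at which $r$ is defined and $r(\underline{u})$ is an invertible matrix.
   Context: A noncommutative rational formula over $\mathbb{Q}$ in noncommuting variables $x_1,\ldots,x_n$ is a rooted tree whose leaves are labelled by variables or rational constants and whose internal gates are addition, (ordered) multiplication and unary inverse gates; its size is the number of gates; its inversion height is the maximum number of inverse gates on a leaf-to-output path. It is evaluated at a tuple of square matrices over a field (here over $K$) by interpreting gates as matrix operations, and is defined there if every inverse gate receives an invertible matrix. It is zero in the free skew field iff it evaluates to zero at every matrix tuple (of every dimension) in its domain of definition. -}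

module Defs where

open import Level using (0ℓ)
open import Algebra.Bundles using (CommutativeRing)
open import Data.Nat as ℕ using (ℕ; zero; suc; _⊔_)
open import Data.Fin using (Fin)
open import Data.List using (List; []; _∷_; map; foldr)
open import Data.List.Relation.Unary.All using (All)
open import Data.Product using (Σ; ∃; _×_; _,_)
open import Data.Rational as ℚ using (ℚ)
import Data.Rational.Properties as ℚP
open import Relation.Nullary using (¬_)
open import Relation.Binary using (Decidable)

data Formula (n : ℕ) : Set where
  con  : ℚ → Formula n
  var  : Fin n → Formula n
  _⊕_  : Formula n → Formula n → Formula n
  _⊗_  : Formula n → Formula n → Formula n
  inv  : Formula n → Formula n

size : ∀ {n} → Formula n → ℕ
size (con _)  = 0
size (var _)  = 0
size (f ⊕ g)  = suc (size f ℕ.+ size g)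
size (f ⊗ g)  = suc (size f ℕ.+ size g)
size (inv f)  = suc (size f)

invHeight : ∀ {n} → Formula n → ℕ
invHeight (con _)  = 0
invHeight (var _)  = 0
invHeight (f ⊕ g)  = invHeight f ⊔ invHeight g
invHeight (f ⊗ g)  = invHeight f ⊔ invHeight g
invHeight (inv f)  = suc (invHeight f)

module MatrixEval (R : CommutativeRing 0ℓ 0ℓ) (c : ℚ → CommutativeRing.Carrier R) where
  open CommutativeRing R

  Mat : ℕ → Set
  Mat d = Fin d → Fin d → Carrier

  sumFin : ∀ d → (Fin d → Carrier) → Carrier
  sumFin zero    f = 0#
  sumFin (suc d) f = f Fin.zero + sumFin d (λ i → f (Fin.suc i))

  _≈M_ : ∀ {d} → Mat d → Mat d → Set
  A ≈M B = ∀ i j → A i j ≈ B i j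

  zeroM : ∀ {d} → Mat d
  zeroM i j = 0#

  scalarM : ∀ {d} → Carrier → Mat d
  scalarM {d} a i j with i Data.Fin.≟ j
  ... | Relation.Nullary.yes _ = a
  ... | Relation.Nullary.no  _ = 0#

  idM : ∀ {d} → Mat d
  idM = scalarM 1#

  _+M_ : ∀ {d} → Mat d → Mat d → Mat d
  (A +M B) i j = A i j + B i j

  _*M_ : ∀ {d} → Mat d → Mat d → Mat d
  _*M_ {d} A B i j = sumFin d (λ k → A i k * B k j)

  Invertible : ∀ {d} → Mat d → Set
  Invertible A = ∃ λ B → (A *M B) ≈M idM × (B *M A) ≈M idM

  data Eval {n d : ℕ} (u : Fin n → Mat d) : Formula n → Mat d → Set where
    e-con : ∀ q → Eval u (con q) (scalarM (c q))
    e-var : ∀ i → Eval u (var i) (u i)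
    e-add : ∀ {f g A B} → Eval u f A → Eval u g B → Eval u (f ⊕ g) (A +M B)
    e-mul : ∀ {f g A B} → Eval u f A → Eval u g B → Eval u (f ⊗ g) (A *M B)
    e-inv : ∀ {f A B} → Eval u f A → (A *M B) ≈M idM → (B *M A) ≈M idM
          → Eval u (inv f) B

  DefinedInvertibleAt : ∀ {n d} → Formula n → (Fin n → Mat d) → Set
  DefinedInvertibleAt r u = ∃ λ M → Eval u r M × Invertible M

-- Zero in the free skew field: evaluates to zero at every tuple of
-- square rational matrices, of every dimension, where it is defined.

module ℚMat = MatrixEval ℚP.+-*-commutativeRing (λ q → q)

IsZeroFSF : ∀ {n} → Formula n → Set
IsZeroFSF {n} r = ∀ d (u : Fin n → ℚMat.Mat d) M → ℚMat.Eval u r M → ℚMat._≈M_ M ℚMat.zeroM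

record QField : Set₁ where
  field
    cring : CommutativeRing 0ℓ 0ℓ
  open CommutativeRing cring public
  field
    _≟_      : Decidable _≈_
    1≉0      : ¬ (1# ≈ 0#)
    inverse  : ∀ x → ¬ (x ≈ 0#) → ∃ λ y → x * y ≈ 1#
    fromℚ    : ℚ → Carrier
    fromℚ-0  : fromℚ ℚ.0ℚ ≈ 0#
    fromℚ-1  : fromℚ ℚ.1ℚ ≈ 1#
    fromℚ-+  : ∀ p q → fromℚ (p ℚ.+ q) ≈ fromℚ p + fromℚ q
    fromℚ-*  : ∀ p q → fromℚ (p ℚ.* q) ≈ fromℚ p * fromℚ q

  horner : Carrier → List Carrier → Carrier
  horner x = foldr (λ a acc → a + x * acc) 0#

  _^_ : Carrier → ℕ → Carrier
  x ^ zero  = 1#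
  x ^ suc k = x * (x ^ k)

-- K ≅ ℚ(ω, z): ω a primitive ℓ-th root of unity, z transcendental over
-- ℚ(ω) = ℚ[ω], and K generated as a field by ℚ, ω, z (i.e. K is the
-- fraction field of ℚ[ω][z]).  This determines K up to isomorphism.

record IsℚωzField (K : QField) (ℓ : ℕ) : Set where
  open QField K
  field
    ω : Carrier
    z : Carrier
  evalω : List ℚ → Carrier
  evalω cs = horner ω (map fromℚ cs)
  evalωz : List (List ℚ) → Carrier
  evalωz ps = horner z (map evalω ps)
  field
    ω-root       : (ω ^ ℓ) ≈ 1#
    ω-primitive  : ∀ k → 1 ℕ.≤ k → k ℕ.< ℓ → ¬ ((ω ^ k) ≈ 1#)
    z-transc     : ∀ (ps : List (List ℚ)) → evalωz ps ≈ 0# → All (λ p → evalω p ≈ 0#) ps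
    generated    : ∀ (a : Carrier) → ∃ λ (p : List (List ℚ)) → ∃ λ (q : List (List ℚ)) →
                     ¬ (evalωz q ≈ 0#) × (a * evalωz q ≈ evalωz p)

module KMat (K : QField) = MatrixEval (QField.cring K) (QField.fromℚ K)

{-# OPTIONS --safe #-}

-- One point suffices.  Substituting sufficiently sparse powers z^(B^i) for the entries of n generic
-- matrices loses no polynomial identity of bounded degree (Kronecker substitution), so the
-- resulting tuple U of matrices over ℚ(z) behaves like a generic one for all formulas of size s.
--
-- Nonzero implies invertible.  The entries below the diagonal of the generic matrices carry an
-- extra factor y.  A cyclic permutation σ of the remaining variables then conjugates the matrices
-- by the cyclic shift P with P^d = y, and so also the value of any formula r.  Hence, in an
-- expansion of r(U) in powers of P, all entries of the lowest diagonal are nonzero, and a vector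
-- in the kernel of r(U) is impossible by comparing lowest terms: this is the proof that twisted
-- Laurent series form a skew field.
--
-- Nonzero on small matrices.  Suppose that r is defined at u₀ (of dimension m) and expand r around
-- u₀ with noncommuting increments.  The coefficients are realised by block bidiagonal matrices with
-- diagonal blocks u₀, and they are computed by an automaton with m · (number of leaves) states;
-- if all coefficients of smaller order vanish, then a pumping argument shows that all do.  A Krylov
-- argument on the segment from u₀ to v then gives r(v) = 0 at every v where r is defined.
--
-- For an inverse-free formula take u₀ = 0 in dimension 1; this yields a generic tuple at which all
-- inverted subformulas of a formula of inversion height one are invertible, and this tuple is the
-- u₀ of a second application.
module Submission where

open import Defs
open import Level using (0ℓ)
open import Algebra.Bundles using (CommutativeRing; RawRing)
import Algebra.Construct.Pointwise as Pointwise
open import Algebra.Solver.Ring.AlmostCommutativeRing using (fromCommutativeRing; _-Raw-AlmostCommutative⟶_)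
open import Data.Bool using (true; false; if_then_else_)
open import Data.Empty using (⊥; ⊥-elim)
open import Data.Fin as Fin using (Fin; zero; suc; toℕ; fromℕ; fromℕ<; inject₁; punchIn; punchOut; combine; remQuot)
open import Data.Fin.Induction using (<-weakInduction; >-weakInduction)
import Data.Fin.Properties as FinP
open import Data.Fin.Relation.Unary.Top using (View; view; view-fromℕ; view-inject₁; ‵fromℕ; ‵inject₁)
open import Data.List using (List; []; _∷_; map; foldr; length; _++_)
open import Data.List.Membership.Propositional using (_∈_)
import Data.List.Properties as ListP
open import Data.List.Relation.Unary.All as All using (All; []; _∷_)
import Data.List.Relation.Unary.All.Properties as AllP
open import Data.List.Relation.Unary.Any using (here)
open import Data.Maybe using (Maybe; just; nothing)
open import Data.Nat as ℕ using (ℕ; zero; suc; _≤_; _<_)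
open import Data.Nat.DivMod using (_/_; _%_; [m+kn]%n≡m%n; m<n⇒m%n≡m; +-distrib-/-∣ʳ; m<n⇒m/n≡0; m*n/n≡m)
open import Data.Nat.Divisibility using (divides)
import Data.Nat.Induction as ℕI
open import Data.Nat.Logarithm using (⌊log₂_⌋)
import Data.Nat.Properties as ℕP
open import Data.Nat.Solver using (module +-*-Solver)
open import Data.Product using (∃; _×_; _,_; proj₁; proj₂)
open import Data.Rational as ℚ using (ℚ)
import Data.Rational.Properties as ℚP
open import Data.Sum using (_⊎_; inj₁; inj₂; [_,_])
open import Data.Unit using (⊤; tt)
open import Function using (_∘_; id)
open import Relation.Binary using (tri<; tri≈; tri>)
open import Relation.Binary.PropositionalEquality as ≡ using (_≡_; _≢_)
open import Relation.Nullary using (¬_; Dec; yes; no; ¬?; contradiction)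
open import Relation.Nullary.Decidable using (decidable-stable)

-- Degrees may be huge, dimensions may not. Clearing denominators at inverse gates makes the degrees
-- grow far beyond any polynomial bound, but they enter only into the exponents of z; the dimension
-- depends on the number of states of the automaton alone, hence stays polynomial. Power series are
-- avoided. A run of a formula is a finite linear system attached to its variable leaves, and a
-- change of the tuple becomes a perturbation at these leaves. Projection to a block, conjugation by
-- the shift and the passage from u₀ to v are all instances of one lemma, `transfer`, in which an
-- inverse gate is handled by uniqueness of solutions. Polynomials are handled as functions with a
-- certified degree, so that an identity can be tested at the single point U and then used
-- everywhere, including at points with y = 0. Arguments by contradiction are constructive because
-- it is decidable over K whether a formula is defined and invertible at a given tuple.

-- Integer coefficients for the ring solver, as formal differences of naturals.
differences : RawRing 0ℓ 0ℓ
differences = record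
  { Carrier = ℕ × ℕ
  ; _≈_ = _≡_
  ; _+_ = λ (a , b) (c , d) → a ℕ.+ c , b ℕ.+ d
  ; _*_ = λ (a , b) (c , d) → a ℕ.* c ℕ.+ b ℕ.* d , a ℕ.* d ℕ.+ b ℕ.* c
  ; -_ = λ (a , b) → b , a
  ; 0# = 0 , 0
  ; 1# = 1 , 0
  }

module RingSolver (R : CommutativeRing 0ℓ 0ℓ) where
  open CommutativeRing R
  open import Algebra.Properties.Semiring.Mult semiring using (×1-homo-*; ×-homo-+; ×-homo-1) renaming (_×_ to _·_)
  open import Algebra.Properties.Ring ring using (-‿distribˡ-*; -‿distribʳ-*; -‿involutive; -0#≈0#)
  open import Algebra.Properties.AbelianGroup +-abelianGroup using () renaming (⁻¹-∙-comm to -‿+-comm)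
  open import Algebra.Properties.CommutativeSemigroup +-commutativeSemigroup using (interchange)
  open import Relation.Binary.Reasoning.Setoid setoid

  private
    diff : ℕ × ℕ → Carrier
    diff (a , b) = a · 1# - b · 1#

    -- 0 and 1 are special-cased so that the solver constants reduce to 0# and 1#.
    ⟦_⟧ᵈ : ℕ × ℕ → Carrier
    ⟦ 0 , 0 ⟧ᵈ = 0#
    ⟦ 1 , 0 ⟧ᵈ = 1#
    ⟦ p ⟧ᵈ     = diff p

    ⟦⟧≈diff : ∀ p → ⟦ p ⟧ᵈ ≈ diff p
    ⟦⟧≈diff (0 , 0)           = sym (-‿inverseʳ 0#)
    ⟦⟧≈diff (0 , suc _)       = refl
    ⟦⟧≈diff (1 , 0)           = sym (trans (+-cong (×-homo-1 1#) -0#≈0#) (+-identityʳ 1#))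
    ⟦⟧≈diff (1 , suc _)       = refl
    ⟦⟧≈diff (suc (suc _) , _) = refl

    sub-mul : ∀ a b c d → (a - b) * (c - d) ≈ (a * c + b * d) - (a * d + b * c)
    sub-mul a b c d = begin
      (a - b) * (c - d)                          ≈⟨ distribʳ _ _ _ ⟩
      a * (c - d) + - b * (c - d)                ≈⟨ +-cong (distribˡ _ _ _) (distribˡ _ _ _) ⟩
      (a * c + a * - d) + (- b * c + - b * - d)  ≈⟨ +-congˡ (+-comm _ _) ⟩
      (a * c + a * - d) + (- b * - d + - b * c)  ≈⟨ interchange _ _ _ _ ⟩
      (a * c + - b * - d) + (a * - d + - b * c)  ≈⟨ +-cong (+-congˡ lem) (+-cong (sym (-‿distribʳ-* _ _)) (sym (-‿distribˡ-* _ _))) ⟩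
      (a * c + b * d) + (- (a * d) + - (b * c))  ≈⟨ +-congˡ (-‿+-comm _ _) ⟩
      (a * c + b * d) - (a * d + b * c)          ∎
      where
      lem : - b * - d ≈ b * d
      lem = trans (sym (-‿distribˡ-* _ _)) (trans (-‿cong (sym (-‿distribʳ-* _ _))) (-‿involutive _))

    sub-add : ∀ a b c d → (a + c) - (b + d) ≈ (a - b) + (c - d)
    sub-add a b c d = trans (+-congˡ (sym (-‿+-comm _ _))) (interchange _ _ _ _)

    hom : differences -Raw-AlmostCommutative⟶ fromCommutativeRing R
    hom = record
      { ⟦_⟧ = ⟦_⟧ᵈ
      ; +-homo = λ p@(a , b) q@(c , d) → trans (⟦⟧≈diff (a ℕ.+ c , b ℕ.+ d)) (trans
          (trans (+-cong (×-homo-+ 1# a c) (-‿cong (×-homo-+ 1# b d))) (sub-add _ _ _ _))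
          (sym (+-cong (⟦⟧≈diff p) (⟦⟧≈diff q))))
      ; *-homo = λ p@(a , b) q@(c , d) → trans (⟦⟧≈diff (a ℕ.* c ℕ.+ b ℕ.* d , a ℕ.* d ℕ.+ b ℕ.* c)) (trans
          (trans
            (+-cong (trans (×-homo-+ 1# (a ℕ.* c) _) (+-cong (×1-homo-* a c) (×1-homo-* b d)))
                    (-‿cong (trans (×-homo-+ 1# (a ℕ.* d) _) (+-cong (×1-homo-* a d) (×1-homo-* b c)))))
            (sym (sub-mul _ _ _ _)))
          (sym (*-cong (⟦⟧≈diff p) (⟦⟧≈diff q))))
      ; -‿homo = λ p@(a , b) → trans (⟦⟧≈diff (b , a)) (trans
          (trans (+-comm _ _) (trans (+-congˡ (sym (-‿involutive _))) (-‿+-comm _ _)))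
          (sym (-‿cong (⟦⟧≈diff p))))
      ; 0-homo = refl
      ; 1-homo = refl
      }

    _≟ᵈ_ : ∀ p q → Maybe (⟦ p ⟧ᵈ ≈ ⟦ q ⟧ᵈ)
    p@(a , b) ≟ᵈ q@(c , d) with a ℕ.+ d ℕ.≟ c ℕ.+ b
    ... | no _ = nothing
    ... | yes eq = just (trans (⟦⟧≈diff p) (trans (begin
      a′ - b′                  ≈⟨ cancel a′ d′ b′ ⟨
      (a′ + d′) - (b′ + d′)    ≈⟨ +-congʳ (trans (sym (×-homo-+ 1# a d)) (trans (reflexive (≡.cong (_· 1#) eq)) (×-homo-+ 1# c b))) ⟩
      (c′ + b′) - (b′ + d′)    ≈⟨ +-congˡ (-‿cong (+-comm _ _)) ⟩
      (c′ + b′) - (d′ + b′)    ≈⟨ cancel c′ b′ d′ ⟩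
      c′ - d′                  ∎) (sym (⟦⟧≈diff q))))
      where
      a′ = a · 1#
      b′ = b · 1#
      c′ = c · 1#
      d′ = d · 1#
      cancel : ∀ x y w → (x + y) - (w + y) ≈ x - w
      cancel x y w = trans (sub-add x w y y) (trans (+-congˡ (-‿inverseʳ y)) (+-identityʳ _))

  open import Algebra.Solver.Ring differences (fromCommutativeRing R) hom _≟ᵈ_ public
    using (solve; _:=_; _:+_; _:*_; :-_; _:-_; con)

-- Linear algebra

module Sums (R : CommutativeRing 0ℓ 0ℓ) (c : ℚ → CommutativeRing.Carrier R) where
  open CommutativeRing R hiding (zero)
  open MatrixEval R c
  open RingSolver R
  open import Algebra.Properties.CommutativeSemigroup +-commutativeSemigroup using (interchange)
  open import Relation.Binary.Reasoning.Setoid setoid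

  sum-cong : ∀ d {f g : Fin d → Carrier} → (∀ i → f i ≈ g i) → sumFin d f ≈ sumFin d g
  sum-cong zero    _ = refl
  sum-cong (suc d) h = +-cong (h zero) (sum-cong d (h ∘ suc))

  sum-+ : ∀ d (f g : Fin d → Carrier) → sumFin d (λ i → f i + g i) ≈ sumFin d f + sumFin d g
  sum-+ zero    f g = sym (+-identityˡ 0#)
  sum-+ (suc d) f g = trans (+-congˡ (sum-+ d (f ∘ suc) (g ∘ suc))) (interchange _ _ _ _)

  sum-*ˡ : ∀ d x (f : Fin d → Carrier) → x * sumFin d f ≈ sumFin d (λ i → x * f i)
  sum-*ˡ zero    x f = zeroʳ x
  sum-*ˡ (suc d) x f = trans (distribˡ _ _ _) (+-congˡ (sum-*ˡ d x (f ∘ suc)))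

  sum-*ʳ : ∀ d x (f : Fin d → Carrier) → sumFin d f * x ≈ sumFin d (λ i → f i * x)
  sum-*ʳ d x f = trans (*-comm _ _) (trans (sum-*ˡ d x f) (sum-cong d (λ i → *-comm _ _)))

  sum-0 : ∀ d {f : Fin d → Carrier} → (∀ i → f i ≈ 0#) → sumFin d f ≈ 0#
  sum-0 zero    h = refl
  sum-0 (suc d) h = trans (+-cong (h zero) (sum-0 d (h ∘ suc))) (+-identityˡ 0#)

  sum-swap : ∀ d e (f : Fin d → Fin e → Carrier) →
             sumFin d (λ i → sumFin e (f i)) ≈ sumFin e (λ j → sumFin d (λ i → f i j))
  sum-swap zero    e f = sym (sum-0 e (λ _ → refl))
  sum-swap (suc d) e f = trans (+-congˡ (sum-swap d e (f ∘ suc))) (sym (sum-+ e _ _))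

  sum-single : ∀ d {f : Fin d → Carrier} i → (∀ j → j ≢ i → f j ≈ 0#) → sumFin d f ≈ f i
  sum-single (suc d) zero    h = trans (+-congˡ (sum-0 d (λ i → h (suc i) (λ ())))) (+-identityʳ _)
  sum-single (suc d) (suc i) h =
    trans (+-cong (h zero (λ ())) (sum-single d i (λ j j≢i → h (suc j) (j≢i ∘ FinP.suc-injective)))) (+-identityˡ _)

  infix 7 _·_
  _·_ : ∀ {d} → (Fin d → Carrier) → (Fin d → Carrier) → Carrier
  _·_ {d} f g = sumFin d (λ i → f i * g i)

  ·-comm : ∀ {d} (f g : Fin d → Carrier) → f · g ≈ g · f
  ·-comm {d} f g = sum-cong d (λ i → *-comm _ _)

  ·-cong : ∀ {d} {f f′ g g′ : Fin d → Carrier} → (∀ i → f i ≈ f′ i) → (∀ i → g i ≈ g′ i) → f · g ≈ f′ · g′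
  ·-cong {d} h h′ = sum-cong d (λ i → *-cong (h i) (h′ i))

  ·-linear : ∀ {d} a b (f g h : Fin d → Carrier) → f · (λ i → a * g i + b * h i) ≈ a * (f · g) + b * (f · h)
  ·-linear {d} a b f g h = begin
    f · (λ i → a * g i + b * h i)                      ≈⟨ sum-cong d (λ i → solve 5 (λ a b f g h → f :* (a :* g :+ b :* h) := a :* (f :* g) :+ b :* (f :* h)) refl a b (f i) (g i) (h i)) ⟩
    sumFin d (λ i → a * (f i * g i) + b * (f i * h i)) ≈⟨ sum-+ d _ _ ⟩
    _                                                  ≈⟨ +-cong (sum-*ˡ d a _) (sum-*ˡ d b _) ⟨
    a * (f · g) + b * (f · h)                          ∎

-- Fraction-free Gaussian elimination.  Pivots are chosen outside Z, which stands for a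
-- decidable prime ideal, and P k is a filtration, multiplication raising the level by one.
record Filtered (R : CommutativeRing 0ℓ 0ℓ) : Set₁ where
  open CommutativeRing R hiding (zero)
  field
    Z       : Carrier → Set
    Z?      : ∀ a → Dec (Z a)
    Z-resp  : ∀ {a b} → a ≈ b → Z a → Z b
    Z-0     : Z 0#
    Z-1     : ¬ Z 1#
    Z-prime : ∀ {a b} → ¬ Z a → ¬ Z b → ¬ Z (a * b)
    P       : ℕ → Carrier → Set
    P-0     : P 0 0#
    P-1     : P 0 1#
    P-+     : ∀ {k a b} → P k a → P k b → P k (a + b)
    P-neg   : ∀ {k a} → P k a → P k (- a)
    P-*     : ∀ {k a b} → P k a → P k b → P (suc k) (a * b)
    P-suc   : ∀ {k a} → P k a → P (suc k) a

  P-≤ : ∀ {j k a} → j ≤ k → P j a → P k a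
  P-≤ {j} {k} j≤k p = go (ℕP.≤⇒≤′ j≤k) p
    where
    go : ∀ {k a} → j ℕ.≤′ k → P j a → P k a
    go ℕ.≤′-refl     p = p
    go (ℕ.≤′-step q) p = P-suc (go q p)

-- Each pivot costs two levels: the Schur complement consists of products of entries, and back
-- substitution multiplies the solution by entries once more.
elimLevel : ℕ → ℕ → ℕ
elimLevel zero    k = k
elimLevel (suc d) k = suc (elimLevel d (suc k))

elimLevel-≥ : ∀ d k → k ≤ elimLevel d k
elimLevel-≥ zero    k = ℕP.≤-refl
elimLevel-≥ (suc d) k = ℕP.≤-trans (ℕP.n≤1+n k) (ℕP.≤-trans (elimLevel-≥ d (suc k)) (ℕP.n≤1+n _))

module Elimination (R : CommutativeRing 0ℓ 0ℓ) (c : ℚ → CommutativeRing.Carrier R) (𝓕 : Filtered R) where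
  open CommutativeRing R hiding (zero)
  open MatrixEval R c
  open RingSolver R
  open Sums R c
  open Filtered 𝓕
  open import Relation.Binary.Reasoning.Setoid setoid

  P-sum : ∀ {k d} {f : Fin d → Carrier} → (∀ i → P k (f i)) → P k (sumFin d f)
  P-sum {d = zero}  h = P-≤ ℕ.z≤n P-0
  P-sum {d = suc d} h = P-+ (h zero) (P-sum (h ∘ suc))

  -- The vector is annihilated only modulo Z, whereas `Solvable` provides exact identities in the
  -- ring. With Z the functions vanishing at a point, the alternatives are a kernel at that point
  -- and an inverse valid as functions.
  Kernel : ∀ {d} → ℕ → Mat d → Set
  Kernel {d} k A = ∃ λ (ξ : Fin d → Carrier) →
    (∀ j → P k (ξ j)) × (∃ λ j → ¬ Z (ξ j)) × (∀ i → Z (A i · ξ))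

  -- The denominator q is the product of the pivots; one q serves all right-hand sides, so the
  -- columns of an inverse share it.
  Solvable : ∀ {d} → ℕ → ℕ → Mat d → Set
  Solvable {d} k l A = ∃ λ q → P l q × ¬ Z q ×
    (∀ (g : Fin d → Carrier) → (∀ i → P k (g i)) →
      ∃ λ (x : Fin d → Carrier) → (∀ j → P l (x j)) × (∀ i → A i · x ≈ q * g i))

  eliminate : ∀ {d} k (A : Mat d) → (∀ i j → P k (A i j)) →
              Kernel (elimLevel d k) A ⊎ Solvable k (elimLevel d k) A
  eliminate {zero}  k A PA = inj₂ (1# , P-≤ ℕ.z≤n P-1 , Z-1 , λ g _ → (λ ()) , (λ ()) , (λ ()))
  eliminate {suc d} k A PA with FinP.any? (λ i → ¬? (Z? (A i zero)))
  -- Without a pivot the whole first column lies in Z, so the first unit vector is a kernel vector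
  -- modulo Z.
  ... | no all-Z = inj₁ (e₀ , Pe₀ , (zero , Z-1) , λ i → Z-resp (sym (row i)) (decidable-stable (Z? _) (λ nz → all-Z (i , nz))))
    where
    e₀ : Fin (suc d) → Carrier
    e₀ zero    = 1#
    e₀ (suc _) = 0#
    Pe₀ : ∀ j → P (elimLevel (suc d) k) (e₀ j)
    Pe₀ zero    = P-≤ ℕ.z≤n P-1
    Pe₀ (suc _) = P-≤ ℕ.z≤n P-0
    row : ∀ i → A i · e₀ ≈ A i zero
    row i = trans (+-cong (*-identityʳ _) (sum-0 d (λ j → zeroʳ _))) (+-identityʳ _)
  ... | yes (i₀ , nz) = result (eliminate {d} (suc k) S PS)
    where
    p = A i₀ zero
    r : Fin d → Carrier
    r j = A i₀ (suc j)
    col : Fin d → Carrier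
    col i = A (punchIn i₀ i) zero
    A′ : Mat d
    A′ i j = A (punchIn i₀ i) (suc j)
    -- Schur complement of the pivot, multiplied by the pivot to avoid division.
    S : Mat d
    S i j = p * A′ i j + - col i * r j
    PS : ∀ i j → P (suc k) (S i j)
    PS i j = P-+ (P-* (PA _ _) (PA _ _)) (P-* (P-neg (PA _ _)) (PA _ _))
    L = elimLevel d (suc k)
    k≤L : k ≤ L
    k≤L = ℕP.≤-trans (ℕP.n≤1+n k) (elimLevel-≥ d (suc k))

    S· : ∀ i x → S i · x ≈ p * (A′ i · x) + - col i * (r · x)
    S· i x = begin
      S i · x                                  ≈⟨ ·-comm (S i) x ⟩
      x · S i                                  ≈⟨ ·-linear p (- col i) x (A′ i) r ⟩
      p * (x · A′ i) + - col i * (x · r)       ≈⟨ +-cong (*-congˡ (·-comm x (A′ i))) (*-congˡ (·-comm x r)) ⟩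
      p * (A′ i · x) + - col i * (r · x)       ∎

    rows : ∀ (Q : Fin (suc d) → Set) → Q i₀ → (∀ i → Q (punchIn i₀ i)) → ∀ i → Q i
    rows Q q₀ qs i with i₀ FinP.≟ i
    ... | yes ≡.refl = q₀
    ... | no i₀≢i = ≡.subst Q (FinP.punchIn-punchOut i₀≢i) (qs (punchOut i₀≢i))

    cons : Carrier → (Fin d → Carrier) → Fin (suc d) → Carrier
    cons a x zero    = a
    cons a x (suc j) = x j

    P-cons : ∀ {l a x} → P l a → (∀ j → P l (x j)) → ∀ j → P l (cons a x j)
    P-cons Pa Px zero    = Pa
    P-cons Pa Px (suc j) = Px j

    ·-scale : ∀ (f x : Fin d → Carrier) → f · (λ j → p * x j) ≈ p * (f · x)
    ·-scale f x = trans (sum-cong d (λ j → solve 3 (λ p f x → f :* (p :* x) := p :* (f :* x)) refl p (f j) (x j))) (sym (sum-*ˡ d p _))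

    result : Kernel L S ⊎ Solvable (suc k) L S → Kernel (suc L) A ⊎ Solvable k (suc L) A
    result (inj₁ (ξ , Pξ , (j , nzj) , Sξ)) = inj₁
      (cons (- (r · ξ)) (λ j → p * ξ j)
      , P-cons (P-neg (P-sum (λ j → P-* (P-≤ k≤L (PA _ _)) (Pξ j)))) (λ j → P-* (P-≤ k≤L (PA _ _)) (Pξ j))
      , (suc j , Z-prime nz nzj)
      , rows _ (Z-resp (sym top) Z-0) (λ i → Z-resp (sym (rest i)) (Sξ i)))
      where
      top : p * - (r · ξ) + r · (λ j → p * ξ j) ≈ 0#
      top = trans (+-congˡ (·-scale r ξ)) (solve 2 (λ p x → p :* :- x :+ p :* x := con (0 , 0)) refl p _)
      rest : ∀ i → col i * - (r · ξ) + A′ i · (λ j → p * ξ j) ≈ S i · ξ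
      rest i = trans (+-congˡ (·-scale (A′ i) ξ))
        (trans (solve 4 (λ c x p a → c :* :- x :+ p :* a := p :* a :+ :- c :* x) refl (col i) _ p _) (sym (S· i ξ)))
    result (inj₂ (q , Pq , nzq , sol)) = inj₂
      (p * q , P-* (P-≤ k≤L (PA _ _)) Pq , Z-prime nz nzq , λ g Pg → solution g Pg)
      where
      solution : ∀ (g : Fin (suc d) → Carrier) → (∀ i → P k (g i)) →
                 ∃ λ (x : Fin (suc d) → Carrier) → (∀ j → P (suc L) (x j)) × (∀ i → A i · x ≈ p * q * g i)
      solution g Pg with sol (λ i → p * g (punchIn i₀ i) + - col i * g i₀)
                             (λ i → P-+ (P-* (PA _ _) (Pg _)) (P-* (P-neg (PA _ _)) (Pg _)))
      ... | x , Px , Sx =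
        cons (q * g i₀ - r · x) (λ j → p * x j)
        , P-cons (P-+ (P-* Pq (P-≤ k≤L (Pg _))) (P-neg (P-sum (λ j → P-* (P-≤ k≤L (PA _ _)) (Px j)))))
                 (λ j → P-* (P-≤ k≤L (PA _ _)) (Px j))
        , rows _ top rest
        where
        top : p * (q * g i₀ - r · x) + r · (λ j → p * x j) ≈ p * q * g i₀
        top = trans (+-congˡ (·-scale r x)) (solve 4 (λ p q g y → p :* (q :* g :- y) :+ p :* y := p :* q :* g) refl p q (g i₀) _)
        rest : ∀ i → col i * (q * g i₀ - r · x) + A′ i · (λ j → p * x j) ≈ p * q * g (punchIn i₀ i)
        rest i = begin
          col i * (q * g i₀ - r · x) + A′ i · (λ j → p * x j)
            ≈⟨ +-congˡ (·-scale (A′ i) x) ⟩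
          col i * (q * g i₀ - r · x) + p * (A′ i · x)
            ≈⟨ solve 6 (λ c q g y p a → c :* (q :* g :- y) :+ p :* a := c :* (q :* g) :+ (p :* a :+ :- c :* y)) refl (col i) q (g i₀) _ p _ ⟩
          col i * (q * g i₀) + (p * (A′ i · x) + - col i * (r · x))
            ≈⟨ +-congˡ (trans (sym (S· i x)) (Sx i)) ⟩
          col i * (q * g i₀) + q * (p * g (punchIn i₀ i) + - col i * g i₀)
            ≈⟨ solve 5 (λ c q g p h → c :* (q :* g) :+ q :* (p :* h :+ :- c :* g) := p :* q :* h) refl (col i) q (g i₀) p (g (punchIn i₀ i)) ⟩
          p * q * g (punchIn i₀ i) ∎

-- Linear algebra over a field

module FieldLinear (K : QField) where
  open QField K hiding (zero)
  open KMat K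
  open RingSolver cring
  open Sums cring fromℚ
  open import Relation.Binary.Reasoning.Setoid setoid

  *-nonzero : ∀ {a b} → ¬ a ≈ 0# → ¬ b ≈ 0# → ¬ a * b ≈ 0#
  *-nonzero {a} {b} a≉0 b≉0 ab≈0 with inverse a a≉0
  ... | a⁻¹ , aa⁻¹≈1 = b≉0 (begin
    b               ≈⟨ *-identityˡ b ⟨
    1# * b          ≈⟨ *-congʳ aa⁻¹≈1 ⟨
    a * a⁻¹ * b     ≈⟨ solve 3 (λ a i b → a :* i :* b := i :* (a :* b)) refl a a⁻¹ b ⟩
    a⁻¹ * (a * b)   ≈⟨ *-congˡ ab≈0 ⟩
    a⁻¹ * 0#        ≈⟨ zeroʳ _ ⟩
    0#              ∎)

  *-zero-cancelˡ : ∀ {a b} → ¬ a ≈ 0# → a * b ≈ 0# → b ≈ 0#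
  *-zero-cancelˡ {a} {b} a≉0 ab≈0 = decidable-stable (b ≟ 0#) (λ b≉0 → *-nonzero a≉0 b≉0 ab≈0)

  ^-+ : ∀ a i j → a ^ (i ℕ.+ j) ≈ a ^ i * a ^ j
  ^-+ a zero    j = sym (*-identityˡ _)
  ^-+ a (suc i) j = trans (*-congˡ (^-+ a i j)) (sym (*-assoc _ _ _))

  ^-nonzero : ∀ {a} m → ¬ a ≈ 0# → ¬ a ^ m ≈ 0#
  ^-nonzero zero    a≉0 = 1≉0
  ^-nonzero (suc m) a≉0 = *-nonzero a≉0 (^-nonzero m a≉0)

  fieldFiltered : Filtered cring
  fieldFiltered = record
    { Z = _≈ 0# ; Z? = _≟ 0# ; Z-resp = λ a≈b a≈0 → trans (sym a≈b) a≈0 ; Z-0 = refl ; Z-1 = 1≉0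
    ; Z-prime = *-nonzero
    ; P = λ _ _ → ⊤ ; P-0 = tt ; P-1 = tt ; P-+ = λ _ _ → tt ; P-neg = λ _ → tt ; P-* = λ _ _ → tt ; P-suc = λ _ → tt
    }

  scalarM-diag : ∀ {d} a (i : Fin d) → scalarM a i i ≈ a
  scalarM-diag a i with i Fin.≟ i
  ... | yes _ = refl
  ... | no i≢i = contradiction ≡.refl i≢i

  scalarM-off : ∀ {d} a {i j : Fin d} → i ≢ j → scalarM a i j ≈ 0#
  scalarM-off a {i} {j} i≢j with i Fin.≟ j
  ... | yes i≡j = contradiction i≡j i≢j
  ... | no _ = refl

  scalarM-· : ∀ {d} a (i : Fin d) ξ → scalarM a i · ξ ≈ a * ξ i
  scalarM-· {d} a i ξ = trans
    (sum-single d i (λ j j≢i → trans (*-congʳ (scalarM-off a (j≢i ∘ ≡.sym))) (zeroˡ _)))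
    (*-congʳ (scalarM-diag a i))

  ·-scalarM : ∀ {d} a (j : Fin d) ξ → ξ · (λ i → scalarM a i j) ≈ ξ j * a
  ·-scalarM {d} a j ξ = trans
    (sum-single d j (λ i i≢j → trans (*-congˡ (scalarM-off a i≢j)) (zeroʳ _)))
    (*-congˡ (scalarM-diag a j))

  *M-· : ∀ {d} (A B : Mat d) ξ i → (A *M B) i · ξ ≈ A i · (λ j → B j · ξ)
  *M-· {d} A B ξ i = begin
    sumFin d (λ j → sumFin d (λ k → A i k * B k j) * ξ j)    ≈⟨ sum-cong d (λ j → sum-*ʳ d (ξ j) _) ⟩
    sumFin d (λ j → sumFin d (λ k → A i k * B k j * ξ j))    ≈⟨ sum-swap d d _ ⟩
    sumFin d (λ k → sumFin d (λ j → A i k * B k j * ξ j))    ≈⟨ sum-cong d (λ k → trans (sum-cong d (λ j → *-assoc _ _ _)) (sym (sum-*ˡ d (A i k) _))) ⟩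
    sumFin d (λ k → A i k * sumFin d (λ j → B k j * ξ j))    ∎

  idM-act : ∀ {d} {A : Mat d} → A ≈M idM → ∀ ξ i → A i · ξ ≈ ξ i
  idM-act {d} A≈1 ξ i = trans (·-cong {f′ = scalarM 1# i} {g = ξ} (A≈1 i) (λ _ → refl)) (trans (scalarM-· 1# i ξ) (*-identityˡ _))

  Singular : ∀ {d} → Mat d → Set
  Singular {d} A = ∃ λ (ξ : Fin d → Carrier) → (∃ λ j → ¬ ξ j ≈ 0#) × (∀ i → A i · ξ ≈ 0#)

  open Elimination cring fromℚ fieldFiltered using (eliminate)

  singular-or-rightInvertible : ∀ {d} (A : Mat d) → Singular A ⊎ (∃ λ B → (A *M B) ≈M idM)
  singular-or-rightInvertible A with eliminate 0 A (λ _ _ → tt)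
  ... | inj₁ (ξ , _ , ξ≉0 , Aξ) = inj₁ (ξ , ξ≉0 , Aξ)
  ... | inj₂ (q , _ , q≉0 , sol) = inj₂ ((λ j k → q⁻¹ * x k j) , right)
    where
    q⁻¹ = proj₁ (inverse q q≉0)
    x : ∀ k → _
    x k = proj₁ (sol (λ i → idM i k) (λ _ → tt))
    right : (A *M (λ j k → q⁻¹ * x k j)) ≈M idM
    right i k = begin
      A i · (λ j → q⁻¹ * x k j)   ≈⟨ sum-cong _ (λ j → solve 3 (λ a q x → a :* (q :* x) := q :* (a :* x)) refl (A i j) q⁻¹ (x k j)) ⟩
      _                           ≈⟨ sum-*ˡ _ q⁻¹ (λ j → A i j * x k j) ⟨
      q⁻¹ * (A i · x k)           ≈⟨ *-congˡ (proj₂ (proj₂ (sol (λ i → idM i k) (λ _ → tt))) i) ⟩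
      q⁻¹ * (q * idM i k)         ≈⟨ solve 3 (λ i q x → i :* (q :* x) := q :* i :* x) refl q⁻¹ q (idM i k) ⟩
      q * q⁻¹ * idM i k           ≈⟨ *-congʳ (proj₂ (inverse q q≉0)) ⟩
      1# * idM i k                ≈⟨ *-identityˡ _ ⟩
      idM i k                     ∎

  ·-zeroʳ : ∀ {d} (f : Fin d → Carrier) {ξ} → (∀ i → ξ i ≈ 0#) → f · ξ ≈ 0#
  ·-zeroʳ {d} f h = sum-0 d (λ i → trans (*-congˡ (h i)) (zeroʳ _))

  ≈M-fromAct : ∀ {d} {A B : Mat d} → (∀ ξ i → A i · ξ ≈ B i · ξ) → A ≈M B
  ≈M-fromAct {d} {A} {B} h i j = begin
    A i j                         ≈⟨ col A ⟨
    A i · (λ k → idM k j)         ≈⟨ h (λ k → idM k j) i ⟩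
    B i · (λ k → idM k j)         ≈⟨ col B ⟩
    B i j                         ∎
    where
    col : ∀ C → C i · (λ k → idM k j) ≈ C i j
    col C = trans (·-scalarM 1# j (C i)) (*-identityʳ _)

  ¬singular-right : ∀ {d} {A B : Mat d} → (A *M B) ≈M idM → ¬ Singular B
  ¬singular-right {A = A} {B} AB (ξ , (j , ξj≉0) , Bξ) = ξj≉0 (begin
    ξ j                    ≈⟨ idM-act AB ξ j ⟨
    (A *M B) j · ξ         ≈⟨ *M-· A B ξ j ⟩
    A j · (λ k → B k · ξ)  ≈⟨ ·-zeroʳ (A j) Bξ ⟩
    0#                     ∎)

  -- AB = 1 makes the kernel of B trivial, so elimination gives B a right inverse C, and A = ABC =
  -- C.
  rightInverse⇒leftInverse : ∀ {d} {A B : Mat d} → (A *M B) ≈M idM → (B *M A) ≈M idM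
  rightInverse⇒leftInverse {d} {A} {B} AB with singular-or-rightInvertible B
  ... | inj₁ sing = contradiction sing (¬singular-right {A = A} AB)
  ... | inj₂ (C , BC) = λ i j → trans (BA i j) refl
    where
    A≈C : A ≈M C
    A≈C = ≈M-fromAct (λ ξ i → begin
      A i · ξ                                    ≈⟨ ·-cong {f = A i} (λ _ → refl) (λ j → idM-act BC ξ j) ⟨
      A i · (λ j → (B *M C) j · ξ)               ≈⟨ ·-cong {f = A i} (λ _ → refl) (λ j → *M-· B C ξ j) ⟩
      A i · (λ j → B j · (λ k → C k · ξ))        ≈⟨ *M-· A B _ i ⟨
      (A *M B) i · (λ k → C k · ξ)               ≈⟨ idM-act AB _ i ⟩
      C i · ξ                                    ∎)
    BA : (B *M A) ≈M idM
    BA i j = trans (·-cong {f = B i} (λ _ → refl) (λ k → A≈C k j)) (BC i j)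

  singular-or-invertible : ∀ {d} (A : Mat d) → Singular A ⊎ Invertible A
  singular-or-invertible A with singular-or-rightInvertible A
  ... | inj₁ sing     = inj₁ sing
  ... | inj₂ (B , AB) = inj₂ (B , AB , rightInverse⇒leftInverse {A = A} AB)

  private module Pad {d k} (d<k : d < k) (a : Fin k → Fin d → Carrier) where
    M : Mat k
    M j i with toℕ j ℕ.<? d
    ... | yes j<d = a i (fromℕ< j<d)
    ... | no _    = 0#
    row : ∀ j i → M (Fin.inject≤ j (ℕP.<⇒≤ d<k)) i ≈ a i j
    row j i with toℕ (Fin.inject≤ j (ℕP.<⇒≤ d<k)) ℕ.<? d
    ... | yes j<d = reflexive (≡.cong (a i) (FinP.toℕ-injective (≡.trans (FinP.toℕ-fromℕ< j<d) (FinP.toℕ-inject≤ j _))))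
    ... | no j≮d = contradiction (≡.subst (_< d) (≡.sym (FinP.toℕ-inject≤ j _)) (FinP.toℕ<n j)) j≮d
    last : ∀ i → M (fromℕ< d<k) i ≈ 0#
    last i with toℕ (fromℕ< d<k) ℕ.<? d
    ... | yes d<d = contradiction (≡.subst (_< d) (FinP.toℕ-fromℕ< d<k) d<d) (ℕP.<-irrefl ≡.refl)
    ... | no _ = refl

  -- The k vectors become the columns of a square matrix padded by zero rows; a zero row rules out a
  -- right inverse, so the matrix is singular.
  dependent : ∀ {d k} → d < k → (a : Fin k → Fin d → Carrier) →
              ∃ λ (c : Fin k → Carrier) → (∃ λ i → ¬ c i ≈ 0#) × (∀ j → c · (λ i → a i j) ≈ 0#)
  dependent {d} {k} d<k a with singular-or-rightInvertible (Pad.M d<k a)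
  ... | inj₁ (c , c≉0 , Mc) = c , c≉0 , λ j → trans (·-comm c (λ i → a i j))
          (trans (·-cong {g = c} (λ i → sym (Pad.row d<k a j i)) (λ _ → refl)) (Mc _))
  ... | inj₂ (B , MB) = contradiction (begin
    1#                                      ≈⟨ scalarM-diag 1# (fromℕ< d<k) ⟨
    idM (fromℕ< d<k) (fromℕ< d<k)           ≈⟨ MB _ _ ⟨
    Pad.M d<k a (fromℕ< d<k) · (λ j → B j _) ≈⟨ sum-0 k (λ i → trans (*-congʳ (Pad.last d<k a i)) (zeroˡ _)) ⟩
    0#                                      ∎) 1≉0

  leading : ∀ {k} (c : Fin k → Carrier) → (∃ λ i → ¬ c i ≈ 0#) →
            ∃ λ i → ¬ c i ≈ 0# × (∀ j → j Fin.< i → c j ≈ 0#)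
  leading {suc k} c (i , ci≉0) with c zero ≟ 0#
  ... | no c₀≉0 = zero , c₀≉0 , λ _ ()
  leading {suc k} c (zero , ci≉0) | yes c₀≈0 = contradiction c₀≈0 ci≉0
  leading {suc k} c (suc i , ci≉0) | yes c₀≈0 with leading (c ∘ suc) (i , ci≉0)
  ... | j , cj≉0 , below = suc j , cj≉0 , λ { zero _ → c₀≈0 ; (suc l) (ℕ.s≤s l<j) → below l l<j }

-- Runs of a formula

-- Occurrences of variables only: constants act in the same way over every tuple, so a change of the
-- tuple is felt at these leaves alone.
Leaf : ∀ {n} → Formula n → Set
Leaf (con _) = ⊥
Leaf (var _) = ⊤
Leaf (f ⊕ g) = Leaf f ⊎ Leaf g
Leaf (f ⊗ g) = Leaf f ⊎ Leaf g
Leaf (inv f) = Leaf f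

label : ∀ {n} (r : Formula n) → Leaf r → Fin n
label (var i) tt = i
label (f ⊕ g) = [ label f , label g ]
label (f ⊗ g) = [ label f , label g ]
label (inv f) = label f

module Operators (K : QField) where
  open QField K hiding (zero; _^_)
  open KMat K
  open RingSolver cring
  open Sums cring fromℚ
  open FieldLinear K
  open import Relation.Binary.Reasoning.Setoid setoid
  open import Algebra.Properties.Ring ring using (x+x≈x⇒x≈0)

  Vc : Set → Set
  Vc I = I → Carrier

  infix 4 _≋_
  _≋_ : ∀ {I} → Vc I → Vc I → Set
  ξ ≋ η = ∀ i → ξ i ≈ η i

  𝟎 : ∀ {I} → Vc I
  𝟎 _ = 0#

  infixl 6 _+v_ _-v_
  infixr 7 _*v_
  _+v_ _-v_ : ∀ {I} → Vc I → Vc I → Vc I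
  (ξ +v η) i = ξ i + η i
  (ξ -v η) i = ξ i - η i

  _*v_ : ∀ {I} → Carrier → Vc I → Vc I
  (a *v ξ) i = a * ξ i

  -- Maps instead of matrices: index sets such as `Leaf r × I` then have to be enumerated only where
  -- a dimension is counted.
  record Lin (I J : Set) : Set where
    field
      fn   : Vc I → Vc J
      cong : ∀ {ξ η} → ξ ≋ η → fn ξ ≋ fn η
      lin  : ∀ a ξ η → fn (a *v ξ +v η) ≋ a *v fn ξ +v fn η

    fn-+ : ∀ ξ η → fn (ξ +v η) ≋ fn ξ +v fn η
    fn-+ ξ η j = trans (cong (λ i → +-congʳ (sym (*-identityˡ _))) j)
      (trans (lin 1# ξ η j) (+-congʳ (*-identityˡ _)))

    fn-0 : fn 𝟎 ≋ 𝟎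
    fn-0 j = x+x≈x⇒x≈0 _ (trans (sym (fn-+ 𝟎 𝟎 j)) (cong (λ _ → +-identityˡ 0#) j))

    fn-≋0 : ∀ {ξ} → ξ ≋ 𝟎 → fn ξ ≋ 𝟎
    fn-≋0 h j = trans (cong h j) (fn-0 j)

    fn-* : ∀ a ξ → fn (a *v ξ) ≋ a *v fn ξ
    fn-* a ξ j = begin
      fn (a *v ξ) j            ≈⟨ cong (λ _ → sym (+-identityʳ _)) j ⟩
      fn (a *v ξ +v 𝟎) j       ≈⟨ lin a ξ 𝟎 j ⟩
      a * fn ξ j + fn 𝟎 j      ≈⟨ +-congˡ (fn-0 j) ⟩
      a * fn ξ j + 0#          ≈⟨ +-identityʳ _ ⟩
      a * fn ξ j               ∎

  open Lin public using (fn)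

  idL : ∀ {I} → Lin I I
  idL = record { fn = id ; cong = id ; lin = λ _ _ _ _ → refl }

  scaleL : ∀ {I} → Carrier → Lin I I
  scaleL c = record
    { fn = c *v_ ; cong = λ h i → *-congˡ (h i)
    ; lin = λ a ξ η i → solve 4 (λ c a x y → c :* (a :* x :+ y) := a :* (c :* x) :+ c :* y) refl c a (ξ i) (η i) }

  addL : ∀ {I J} → Lin I J → Lin I J → Lin I J
  addL A B = record
    { fn = λ ξ → fn A ξ +v fn B ξ ; cong = λ h i → +-cong (Lin.cong A h i) (Lin.cong B h i)
    ; lin = λ a ξ η i → trans (+-cong (Lin.lin A a ξ η i) (Lin.lin B a ξ η i))
        (solve 5 (λ a p q s t → (a :* p :+ q) :+ (a :* s :+ t) := a :* (p :+ s) :+ (q :+ t)) refl a _ _ _ _) }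

  compL : ∀ {I J L} → Lin J L → Lin I J → Lin I L
  compL A B = record
    { fn = fn A ∘ fn B ; cong = Lin.cong A ∘ Lin.cong B
    ; lin = λ a ξ η i → trans (Lin.cong A (Lin.lin B a ξ η) i) (Lin.lin A a _ _ i) }

  act : ∀ {d} → Mat d → Lin (Fin d) (Fin d)
  act A = record
    { fn = λ ξ i → A i · ξ
    ; cong = λ h i → ·-cong {f = A i} (λ _ → refl) h
    ; lin = λ a ξ η i → begin
        A i · (a *v ξ +v η)              ≈⟨ ·-cong {f = A i} (λ _ → refl) (λ j → +-congˡ (*-identityˡ _)) ⟨
        A i · (λ j → a * ξ j + 1# * η j) ≈⟨ ·-linear a 1# (A i) ξ η ⟩
        a * (A i · ξ) + 1# * (A i · η)   ≈⟨ +-congˡ (*-identityˡ _) ⟩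
        a * (A i · ξ) + A i · η          ∎ }

  -- The operator counterpart of Eval, on K^I for an arbitrary index set I.
  data Def {n I} (u : Fin n → Lin I I) : Formula n → Set
  ⟦_⟧ : ∀ {n I} {u : Fin n → Lin I I} {r} → Def u r → Lin I I

  data Def {n} {I} u where
    d-con : ∀ q → Def u (con q)
    d-var : ∀ i → Def u (var i)
    d-add : ∀ {f g} → Def u f → Def u g → Def u (f ⊕ g)
    d-mul : ∀ {f g} → Def u f → Def u g → Def u (f ⊗ g)
    d-inv : ∀ {f} (E : Def u f) (B : Lin I I) → (∀ ξ → fn ⟦ E ⟧ (fn B ξ) ≋ ξ) → (∀ ξ → fn B (fn ⟦ E ⟧ ξ) ≋ ξ) → Def u (inv f)

  ⟦ d-con q ⟧ = scaleL (fromℚ q)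
  ⟦_⟧ {u = u} (d-var i) = u i
  ⟦ d-add E F ⟧ = addL ⟦ E ⟧ ⟦ F ⟧
  ⟦ d-mul E F ⟧ = compL ⟦ E ⟧ ⟦ F ⟧
  ⟦ d-inv E B _ _ ⟧ = B

  fromEval : ∀ {n d} {u : Fin n → Mat d} {r M} → Eval u r M → Def (act ∘ u) r
  fromEval-act : ∀ {n d} {u : Fin n → Mat d} {r M} (E : Eval u r M) ξ → fn ⟦ fromEval E ⟧ ξ ≋ fn (act M) ξ
  fromEval (e-con q) = d-con q
  fromEval (e-var i) = d-var i
  fromEval (e-add E F) = d-add (fromEval E) (fromEval F)
  fromEval (e-mul E F) = d-mul (fromEval E) (fromEval F)
  fromEval (e-inv {A = A} {B} E AB BA) = d-inv (fromEval E) (act B)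
    (λ ξ i → trans (fromEval-act E _ i) (trans (sym (*M-· A B ξ i)) (idM-act AB ξ i)))
    (λ ξ i → trans (Lin.cong (act B) (fromEval-act E ξ) i) (trans (sym (*M-· B A ξ i)) (idM-act BA ξ i)))
  fromEval-act (e-con q) ξ i = sym (scalarM-· (fromℚ q) i ξ)
  fromEval-act (e-var i) ξ j = refl
  fromEval-act {d = d} (e-add {A = A} {B} E F) ξ i = trans (+-cong (fromEval-act E ξ i) (fromEval-act F ξ i))
    (trans (sym (sum-+ d _ _)) (sum-cong d (λ j → sym (distribʳ _ _ _))))
  fromEval-act (e-mul {A = A} {B} E F) ξ i =
    trans (fromEval-act E _ i) (trans (Lin.cong (act A) (fromEval-act F ξ) i) (sym (*M-· A B ξ i)))
  fromEval-act (e-inv E AB BA) ξ i = refl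

  -- A run of r on the input η: every variable leaf l returns u(w l) + δ l, where w l is the
  -- vector it is applied to.  out is the resulting output, args the family w.
  out  : ∀ {n I} {u : Fin n → Lin I I} {r} → Def u r → Vc I → (Leaf r → Vc I) → Vc I
  out (d-con q) η δ = fromℚ q *v η
  out {u = u} (d-var i) η δ = fn (u i) η +v δ tt
  out (d-add E F) η δ = out E η (δ ∘ inj₁) +v out F η (δ ∘ inj₂)
  out (d-mul E F) η δ = out E (out F η (δ ∘ inj₂)) (δ ∘ inj₁)
  -- The output ρ of an inverse gate must satisfy `out E ρ δ ≋ η`. By linearity the left side is the
  -- value of E on ρ plus `out E 𝟎 δ`, which gives this formula.
  out (d-inv E B _ _) η δ = fn B (η -v out E 𝟎 δ)

  args : ∀ {n I} {u : Fin n → Lin I I} {r} → Def u r → Vc I → (Leaf r → Vc I) → (Leaf r → Vc I)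
  args (d-var i) η δ tt = η
  args (d-add E F) η δ = [ args E η (δ ∘ inj₁) , args F η (δ ∘ inj₂) ]
  args (d-mul E F) η δ = [ args E (out F η (δ ∘ inj₂)) (δ ∘ inj₁) , args F η (δ ∘ inj₂) ]
  args (d-inv E B _ _) η δ = args E (fn B (η -v out E 𝟎 δ)) δ

  module _ {n} {I} {u : Fin n → Lin I I} where
    out-cong : ∀ {r} (E : Def u r) {η η′ δ δ′} → η ≋ η′ → (∀ l → δ l ≋ δ′ l) → out E η δ ≋ out E η′ δ′
    out-cong (d-con q) h k i = *-congˡ (h i)
    out-cong (d-var j) h k i = +-cong (Lin.cong (u j) h i) (k tt i)
    out-cong (d-add E F) h k i = +-cong (out-cong E h (k ∘ inj₁) i) (out-cong F h (k ∘ inj₂) i)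
    out-cong (d-mul E F) h k = out-cong E (out-cong F h (k ∘ inj₂)) (k ∘ inj₁)
    out-cong (d-inv E B _ _) h k = Lin.cong B (λ i → +-cong (h i) (-‿cong (out-cong E (λ _ → refl) k i)))

    args-cong : ∀ {r} (E : Def u r) {η η′ δ δ′} → η ≋ η′ → (∀ l → δ l ≋ δ′ l) → ∀ l → args E η δ l ≋ args E η′ δ′ l
    args-cong (d-var j) h k tt = h
    args-cong (d-add E F) h k (inj₁ l) = args-cong E h (k ∘ inj₁) l
    args-cong (d-add E F) h k (inj₂ l) = args-cong F h (k ∘ inj₂) l
    args-cong (d-mul E F) h k (inj₁ l) = args-cong E (out-cong F h (k ∘ inj₂)) (k ∘ inj₁) l
    args-cong (d-mul E F) h k (inj₂ l) = args-cong F h (k ∘ inj₂) l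
    args-cong (d-inv E B _ _) h k = args-cong E (Lin.cong B (λ i → +-cong (h i) (-‿cong (out-cong E (λ _ → refl) k i)))) k

    private
      lin-𝟎 : ∀ a → 𝟎 {I} ≋ a *v 𝟎 +v 𝟎
      lin-𝟎 a i = solve 1 (λ a → con (0 , 0) := a :* con (0 , 0) :+ con (0 , 0)) refl a

    out-lin : ∀ {r} (E : Def u r) a η η′ δ δ′ →
      out E (a *v η +v η′) (λ l → a *v δ l +v δ′ l) ≋ a *v out E η δ +v out E η′ δ′
    inv-lin : ∀ {f} (E : Def u f) (B : Lin I I) a η η′ δ δ′ →
      fn B ((a *v η +v η′) -v out E 𝟎 (λ l → a *v δ l +v δ′ l)) ≋ a *v fn B (η -v out E 𝟎 δ) +v fn B (η′ -v out E 𝟎 δ′)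
    out-lin (d-con q) a η η′ δ δ′ i = solve 4 (λ c a x y → c :* (a :* x :+ y) := a :* (c :* x) :+ c :* y) refl _ a (η i) (η′ i)
    out-lin (d-var j) a η η′ δ δ′ i = trans (+-congʳ (Lin.lin (u j) a η η′ i))
      (solve 5 (λ a p q s t → (a :* p :+ q) :+ (a :* s :+ t) := a :* (p :+ s) :+ (q :+ t)) refl a _ _ _ _)
    out-lin (d-add E F) a η η′ δ δ′ i = trans (+-cong (out-lin E a η η′ _ _ i) (out-lin F a η η′ _ _ i))
      (solve 5 (λ a p q s t → (a :* p :+ q) :+ (a :* s :+ t) := a :* (p :+ s) :+ (q :+ t)) refl a _ _ _ _)
    out-lin (d-mul E F) a η η′ δ δ′ i =
      trans (out-cong E (out-lin F a η η′ _ _) (λ _ _ → refl) i) (out-lin E a _ _ _ _ i)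
    out-lin (d-inv E B _ _) = inv-lin E B
    inv-lin E B a η η′ δ δ′ i = trans
      (Lin.cong B (λ j → trans (+-congˡ (-‿cong (trans (out-cong E (lin-𝟎 a) (λ _ _ → refl) j) (out-lin E a 𝟎 𝟎 δ δ′ j))))
        (solve 5 (λ a x y p q → (a :* x :+ y) :- (a :* p :+ q) := a :* (x :- p) :+ (y :- q)) refl a (η j) (η′ j) _ _)) i)
      (Lin.lin B a _ _ i)

    args-lin : ∀ {r} (E : Def u r) a η η′ δ δ′ l →
      args E (a *v η +v η′) (λ l → a *v δ l +v δ′ l) l ≋ a *v args E η δ l +v args E η′ δ′ l
    args-lin (d-var j) a η η′ δ δ′ tt i = refl
    args-lin (d-add E F) a η η′ δ δ′ (inj₁ l) = args-lin E a η η′ _ _ l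
    args-lin (d-add E F) a η η′ δ δ′ (inj₂ l) = args-lin F a η η′ _ _ l
    args-lin (d-mul E F) a η η′ δ δ′ (inj₁ l) i =
      trans (args-cong E (out-lin F a η η′ _ _) (λ _ _ → refl) l i) (args-lin E a _ _ _ _ l i)
    args-lin (d-mul E F) a η η′ δ δ′ (inj₂ l) = args-lin F a η η′ _ _ l
    args-lin (d-inv E B _ _) a η η′ δ δ′ l i =
      trans (args-cong E (inv-lin E B a η η′ δ δ′) (λ _ _ → refl) l i) (args-lin E a _ _ _ _ l i)

    module _ {r} (E : Def u r) where
      private
        outL : Lin (I ⊎ Leaf r × I) I
        outL = record
          { fn = λ ξ → out E (ξ ∘ inj₁) (λ l i → ξ (inj₂ (l , i)))
          ; cong = λ h → out-cong E (h ∘ inj₁) (λ l i → h (inj₂ (l , i)))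
          ; lin = λ a ξ η → out-lin E a _ _ _ _ }
        argsL : Lin (I ⊎ Leaf r × I) (Leaf r × I)
        argsL = record
          { fn = λ ξ (l , i) → args E (ξ ∘ inj₁) (λ l i → ξ (inj₂ (l , i))) l i
          ; cong = λ h (l , i) → args-cong E (h ∘ inj₁) (λ l i → h (inj₂ (l , i))) l i
          ; lin = λ a ξ η (l , i) → args-lin E a _ _ _ _ l i }
        pair : Vc I → (Leaf r → Vc I) → Vc (I ⊎ Leaf r × I)
        pair η δ (inj₁ i) = η i
        pair η δ (inj₂ (l , i)) = δ l i
        pair-0 : ∀ {η δ} → η ≋ 𝟎 → (∀ l → δ l ≋ 𝟎) → pair η δ ≋ 𝟎
        pair-0 h k (inj₁ i) = h i
        pair-0 h k (inj₂ (l , i)) = k l i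

      out-0 : ∀ {η δ} → η ≋ 𝟎 → (∀ l → δ l ≋ 𝟎) → out E η δ ≋ 𝟎
      out-0 {η} {δ} h k = Lin.fn-≋0 outL (pair-0 {η} {δ} h k)

      args-0 : ∀ {η δ} → η ≋ 𝟎 → (∀ l → δ l ≋ 𝟎) → ∀ l → args E η δ l ≋ 𝟎
      args-0 {η} {δ} h k l i = Lin.fn-≋0 argsL (pair-0 {η} {δ} h k) (l , i)

      out-+ : ∀ η η′ δ δ′ → out E (η +v η′) (λ l → δ l +v δ′ l) ≋ out E η δ +v out E η′ δ′
      out-+ η η′ δ δ′ = Lin.fn-+ outL (pair η δ) (pair η′ δ′)

      args-+ : ∀ η η′ δ δ′ l → args E (η +v η′) (λ l → δ l +v δ′ l) l ≋ args E η δ l +v args E η′ δ′ l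
      args-+ η η′ δ δ′ l i = Lin.fn-+ argsL (pair η δ) (pair η′ δ′) (l , i)

    out-act : ∀ {r} (E : Def u r) η → out E η (λ _ → 𝟎) ≋ fn ⟦ E ⟧ η
    out-act (d-con q) η i = refl
    out-act (d-var j) η i = +-identityʳ _
    out-act (d-add E F) η i = +-cong (out-act E η i) (out-act F η i)
    out-act (d-mul E F) η i = trans (out-act E _ i) (Lin.cong ⟦ E ⟧ (out-act F η) i)
    out-act (d-inv E B _ _) η = Lin.cong B (λ i →
      trans (+-congˡ (-‿cong (out-0 E (λ _ → refl) (λ _ _ → refl) i))) (solve 1 (λ x → x :- con (0 , 0) := x) refl (η i)))

    out-split : ∀ {r} (E : Def u r) η δ → out E η δ ≋ fn ⟦ E ⟧ η +v out E 𝟎 δ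
    out-split E η δ i = trans
      (out-cong E (λ i → sym (+-identityʳ _)) (λ l i → sym (+-identityˡ _)) i)
      (trans (out-+ E η 𝟎 (λ _ → 𝟎) δ i) (+-congʳ (out-act E η i)))

  -- A linear map π carries runs over u′ to runs over u, the failure of π to intertwine the
  -- two tuples being absorbed into the perturbation δ.
  transfer : ∀ {n I J} {u : Fin n → Lin I I} {u′ : Fin n → Lin J J} {r} (E : Def u r) (E′ : Def u′ r) (π : Lin J I)
    η δ′ δ → (∀ l → fn (u (label r l)) (fn π (args E′ η δ′ l)) +v δ l ≋ fn π (fn (u′ (label r l)) (args E′ η δ′ l) +v δ′ l)) →
    (∀ l → args E (fn π η) δ l ≋ fn π (args E′ η δ′ l)) × (out E (fn π η) δ ≋ fn π (out E′ η δ′))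
  transfer (d-con q) (d-con .q) π η δ′ δ h = (λ ()) , λ i → sym (Lin.fn-* π (fromℚ q) η i)
  transfer (d-var i) (d-var .i) π η δ′ δ h = (λ _ _ → refl) , h tt
  transfer (d-add E F) (d-add E′ F′) π η δ′ δ h
    with transfer E E′ π η _ _ (h ∘ inj₁) | transfer F F′ π η _ _ (h ∘ inj₂)
  ... | a , o | a′ , o′ = [ a , a′ ] , λ i → trans (+-cong (o i) (o′ i)) (sym (Lin.fn-+ π _ _ i))
  transfer (d-mul E F) (d-mul E′ F′) π η δ′ δ h with transfer F F′ π η _ _ (h ∘ inj₂)
  ... | a′ , o′ with transfer E E′ π (out F′ η (δ′ ∘ inj₂)) _ _ (h ∘ inj₁)
  ...   | a , o = [ (λ l i → trans (args-cong E o′ (λ _ _ → refl) l i) (a l i)) , a′ ]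
                , λ i → trans (out-cong E o′ (λ _ _ → refl) i) (o i)
  transfer (d-inv E B EB BE) (d-inv E′ B′ EB′ BE′) π η δ′ δ h
    with transfer E E′ π (fn B′ (η -v out E′ 𝟎 δ′)) δ′ δ h
  ... | a , o = (λ l i → trans (args-cong E ρ≋ (λ _ _ → refl) l i) (a l i)) , ρ≋
    where
    ρ′ = fn B′ (η -v out E′ 𝟎 δ′)
    out′ : out E′ ρ′ δ′ ≋ η
    out′ i = trans (out-split E′ ρ′ δ′ i) (trans (+-congʳ (EB′ _ i)) (solve 2 (λ x y → x :- y :+ y := x) refl (η i) _))
    -- By induction π ρ′ solves the equation that determines the output over u; B as a left inverse
    -- makes the solution unique.
    ρ≋ : fn B (fn π η -v out E 𝟎 δ) ≋ fn π ρ′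
    ρ≋ i = trans (Lin.cong B (λ j → begin
      fn π η j - out E 𝟎 δ j                       ≈⟨ +-congʳ (trans (o j) (Lin.cong π out′ j)) ⟨
      out E (fn π ρ′) δ j - out E 𝟎 δ j            ≈⟨ +-congʳ (out-split E _ δ j) ⟩
      fn ⟦ E ⟧ (fn π ρ′) j + out E 𝟎 δ j - out E 𝟎 δ j ≈⟨ solve 2 (λ x y → x :+ y :- y := x) refl _ _ ⟩
      fn ⟦ E ⟧ (fn π ρ′) j                         ∎) i) (BE _ i)

  intertwine : ∀ {n I J} {u : Fin n → Lin I I} {u′ : Fin n → Lin J J} {r} (E : Def u r) (E′ : Def u′ r) (π : Lin J I) →
    (∀ i ξ → fn (u i) (fn π ξ) ≋ fn π (fn (u′ i) ξ)) → ∀ ξ → fn ⟦ E ⟧ (fn π ξ) ≋ fn π (fn ⟦ E′ ⟧ ξ)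
  intertwine {u′ = u′} {r = r} E E′ π h ξ i = trans (sym (out-act E (fn π ξ) i)) (trans (proj₂ tr i) (Lin.cong π (out-act E′ ξ) i))
    where
    tr = transfer E E′ π ξ (λ _ → 𝟎) (λ _ → 𝟎)
      (λ l i → trans (+-identityʳ _) (trans (h _ _ i) (Lin.cong π (λ j → sym (+-identityʳ _)) i)))

  Eval-unique : ∀ {n d} {u : Fin n → Mat d} {r M M′} → Eval u r M → Eval u r M′ → M ≈M M′
  Eval-unique E E′ = ≈M-fromAct (λ ξ i → trans (sym (fromEval-act E ξ i))
    (trans (intertwine (fromEval E) (fromEval E′) idL (λ _ _ _ → refl) ξ i) (fromEval-act E′ ξ i)))

  defined? : ∀ {n d} (u : Fin n → Mat d) r → Dec (∃ λ M → Eval u r M)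
  defined? u (con q) = yes (_ , e-con q)
  defined? u (var i) = yes (_ , e-var i)
  defined? u (f ⊕ g) with defined? u f | defined? u g
  ... | yes (_ , E) | yes (_ , F) = yes (_ , e-add E F)
  ... | no ¬E | _ = no λ { (_ , e-add E F) → ¬E (_ , E) }
  ... | yes _ | no ¬F = no λ { (_ , e-add E F) → ¬F (_ , F) }
  defined? u (f ⊗ g) with defined? u f | defined? u g
  ... | yes (_ , E) | yes (_ , F) = yes (_ , e-mul E F)
  ... | no ¬E | _ = no λ { (_ , e-mul E F) → ¬E (_ , E) }
  ... | yes _ | no ¬F = no λ { (_ , e-mul E F) → ¬F (_ , F) }
  defined? u (inv f) with defined? u f
  ... | no ¬E = no λ { (_ , e-inv E _ _) → ¬E (_ , E) }
  ... | yes (A , E) with singular-or-invertible A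
  ...   | inj₂ (B , AB , BA) = yes (_ , e-inv E AB BA)
  ...   | inj₁ (ξ , ξ≉0 , Aξ) = no λ { (_ , e-inv {A = A′} {B} E′ _ BA′) →
            ¬singular-right {A = B} BA′ (ξ , ξ≉0 , λ i → trans (·-cong {g = ξ} (λ j → Eval-unique E′ E i j) (λ _ → refl)) (Aξ i)) }

  -- This decision licenses the contradiction behind the hitting property: failure at one point is
  -- assumed and vanishing everywhere is deduced.
  definedInvertible? : ∀ {n d} (u : Fin n → Mat d) r → Dec (DefinedInvertibleAt r u)
  definedInvertible? u r with defined? u r
  ... | no ¬E = no λ (_ , E , _) → ¬E (_ , E)
  ... | yes (M , E) with singular-or-invertible M
  ...   | inj₂ M-inv = yes (M , E , M-inv)
  ...   | inj₁ (ξ , ξ≉0 , Mξ) = no λ (M′ , E′ , B , _ , BM′) →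
            ¬singular-right {A = B} BM′ (ξ , ξ≉0 , λ i → trans (·-cong {g = ξ} (λ j → Eval-unique E′ E i j) (λ _ → refl)) (Mξ i))

-- Passing to small matrices

-- `elem-index` makes `elem` surjective, so that `card` bounds a dimension, and `index` injective,
-- so that the Kronecker substitution separates variables.
record Enumerated (A : Set) : Set where
  field
    card  : ℕ
    elem  : Fin card → A
    index : A → Fin card
    elem-index : ∀ a → elem (index a) ≡ a

enumFin : ∀ d → Enumerated (Fin d)
enumFin d = record { card = d ; elem = id ; index = id ; elem-index = λ _ → ≡.refl }

enum× : ∀ {A B} → Enumerated A → Enumerated B → Enumerated (A × B)
enum× a b = record
  { card = A.card ℕ.* B.card
  ; elem = λ i → let p , q = remQuot B.card i in A.elem p , B.elem q
  ; index = λ (x , y) → combine (A.index x) (B.index y)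
  ; elem-index = λ (x , y) → ≡.trans
      (≡.cong (λ (p , q) → A.elem p , B.elem q) (FinP.remQuot-combine (A.index x) (B.index y)))
      (≡.cong₂ _,_ (A.elem-index x) (B.elem-index y)) }
  where
  module A = Enumerated a
  module B = Enumerated b

enum⊎ : ∀ {A B} → Enumerated A → Enumerated B → Enumerated (A ⊎ B)
enum⊎ {A} {B} a b = record
  { card = A.card ℕ.+ B.card
  ; elem = λ i → pick (Fin.splitAt A.card i)
  ; index = λ { (inj₁ x) → A.index x Fin.↑ˡ B.card ; (inj₂ y) → A.card Fin.↑ʳ B.index y }
  ; elem-index = λ { (inj₁ x) → ≡.trans (≡.cong pick (FinP.splitAt-↑ˡ A.card (A.index x) B.card)) (≡.cong inj₁ (A.elem-index x))
                   ; (inj₂ y) → ≡.trans (≡.cong pick (FinP.splitAt-↑ʳ A.card B.card (B.index y))) (≡.cong inj₂ (B.elem-index y)) } }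
  where
  module A = Enumerated a
  module B = Enumerated b
  pick : Fin A.card ⊎ Fin B.card → A ⊎ B
  pick = [ inj₁ ∘ A.elem , inj₂ ∘ B.elem ]

enumLeaf : ∀ {n} (r : Formula n) → Enumerated (Leaf r)
enumLeaf (con _) = record { card = 0 ; elem = λ () ; index = λ () ; elem-index = λ () }
enumLeaf (var _) = record { card = 1 ; elem = λ _ → tt ; index = λ _ → zero ; elem-index = λ _ → ≡.refl }
enumLeaf (f ⊕ g) = enum⊎ (enumLeaf f) (enumLeaf g)
enumLeaf (f ⊗ g) = enum⊎ (enumLeaf f) (enumLeaf g)
enumLeaf (inv f) = enumLeaf f

leaves : ∀ {n} → Formula n → ℕ
leaves r = Enumerated.card (enumLeaf r)

leaves≤ : ∀ {n} (r : Formula n) → leaves r ≤ suc (size r)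
leaves≤ (con _) = ℕ.z≤n
leaves≤ (var _) = ℕP.≤-refl
leaves≤ (f ⊕ g) = ℕP.≤-trans (ℕP.+-mono-≤ (leaves≤ f) (leaves≤ g)) (ℕP.≤-reflexive (≡.cong suc (ℕP.+-suc (size f) (size g))))
leaves≤ (f ⊗ g) = ℕP.≤-trans (ℕP.+-mono-≤ (leaves≤ f) (leaves≤ g)) (ℕP.≤-reflexive (≡.cong suc (ℕP.+-suc (size f) (size g))))
leaves≤ (inv f) = ℕP.≤-trans (leaves≤ f) (ℕP.n≤1+n _)

module Reduction (K : QField) where
  open QField K hiding (zero; _^_)
  open KMat K
  open RingSolver cring
  open Sums cring fromℚ
  open FieldLinear K
  open Operators K
  open import Relation.Binary.Reasoning.Setoid setoid

  fn-sum : ∀ {I J} (L : Lin I J) {k} (c : Fin k → Carrier) (e : Fin k → Vc I) →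
           fn L (λ i → c · (λ j → e j i)) ≋ (λ i → c · (λ j → fn L (e j) i))
  fn-sum L {zero}  c e i = Lin.fn-0 L i
  fn-sum L {suc k} c e i = trans (Lin.lin L (c zero) (e zero) _ i) (+-congˡ (fn-sum L (c ∘ suc) (e ∘ suc) i))

  dependentᴵ : ∀ {I} (en : Enumerated I) {k} → Enumerated.card en < k → (a : Fin k → Vc I) →
              ∃ λ (c : Fin k → Carrier) → (∃ λ i → ¬ c i ≈ 0#) × ((λ t → c · (λ i → a i t)) ≋ 𝟎)
  dependentᴵ en lt a with dependent lt (λ i j → a i (Enumerated.elem en j))
  ... | c , c≉0 , h = c , c≉0 , λ t →
    ≡.subst (λ t → c · (λ i → a i t) ≈ 0#) (Enumerated.elem-index en t) (h (Enumerated.index en t))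

  matrix : ∀ {d} → Lin (Fin d) (Fin d) → Mat d
  matrix L i j = fn L (λ k → idM k j) i

  matrix-act : ∀ {d} (L : Lin (Fin d) (Fin d)) ξ → fn (act (matrix L)) ξ ≋ fn L ξ
  matrix-act L ξ i = begin
    matrix L i · ξ                          ≈⟨ ·-comm (matrix L i) ξ ⟩
    ξ · (λ j → fn L (λ k → idM k j) i)      ≈⟨ fn-sum L ξ (λ j k → idM k j) i ⟨
    fn L (λ k → ξ · (λ j → idM k j)) i      ≈⟨ Lin.cong L (λ k → trans (·-comm ξ (idM k)) (trans (scalarM-· 1# k ξ) (*-identityˡ _))) i ⟩
    fn L ξ i                                ∎

  -- Block upper bidiagonal tuples: diagonal blocks u₀, and ys p in position (p , p + 1).
  module Block {n m} (u₀ : Fin n → Mat m) (b : ℕ) (ys : ℕ → Fin n → Mat m) where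

    -- Defined for all p, and zero from b on, so that the last block row needs no separate
    -- treatment.
    block : ℕ → Lin (Fin (b ℕ.* m)) (Fin m)
    block p with p ℕ.<? b
    ... | yes p<b = record { fn = λ ξ a → ξ (combine (fromℕ< p<b) a) ; cong = λ h a → h _ ; lin = λ _ _ _ _ → refl }
    ... | no _    = record { fn = λ _ → 𝟎 ; cong = λ _ _ → refl
                           ; lin = λ a _ _ _ → solve 1 (λ a → con (0 , 0) := a :* con (0 , 0) :+ con (0 , 0)) refl a }

    block-≥ : ∀ p → b ≤ p → ∀ ξ → fn (block p) ξ ≋ 𝟎
    block-≥ p b≤p ξ a with p ℕ.<? b
    ... | yes p<b = contradiction p<b (ℕP.≤⇒≯ b≤p)
    ... | no _    = refl

    block-zero : ∀ {ξ} → (∀ p → fn (block p) ξ ≋ 𝟎) → ξ ≋ 𝟎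
    block-zero {ξ} h x with remQuot {b} m x in eq
    ... | p , a with toℕ p ℕ.<? b | h (toℕ p) a
    ...   | no p≮b  | _  = contradiction (FinP.toℕ<n p) p≮b
    ...   | yes p<b | h₀ = trans (reflexive (≡.cong ξ (≡.trans (≡.sym (FinP.combine-remQuot {b} m x))
                             (≡.trans (≡.cong (λ (p , a) → combine p a) eq) (≡.cong (λ p → combine p a) (≡.sym (FinP.fromℕ<-toℕ p p<b))))))) h₀

    stepL : Fin n → ℕ → Lin (Fin (b ℕ.* m)) (Fin m)
    stepL i p = addL (compL (act (u₀ i)) (block p)) (compL (act (ys p i)) (block (suc p)))

    tupleL : Fin n → Lin (Fin (b ℕ.* m)) (Fin (b ℕ.* m))
    tupleL i = record
      { fn   = λ ξ x → fn (stepL i (toℕ (proj₁ (remQuot {b} m x)))) ξ (proj₂ (remQuot {b} m x))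
      ; cong = λ h x → Lin.cong (stepL i _) h _
      ; lin  = λ a ξ η x → Lin.lin (stepL i _) a ξ η _ }

    tuple : Fin n → Mat (b ℕ.* m)
    tuple i = matrix (tupleL i)

    block-tupleL : ∀ p i ξ → fn (block p) (fn (tupleL i) ξ) ≋ fn (stepL i p) ξ
    block-tupleL p i ξ a with p ℕ.<? b in eq
    ... | no p≮b = sym (trans (+-cong (·-zeroʳ (u₀ i a) (λ _ → refl)) (·-zeroʳ (ys p i a) (block-≥ (suc p) (ℕP.m≤n⇒m≤1+n (ℕP.≮⇒≥ p≮b)) ξ)))
                             (+-identityˡ 0#))
    ... | yes p<b = trans
      (reflexive (≡.cong₂ (λ t a → fn (stepL i t) ξ a)
        (≡.trans (≡.cong (toℕ ∘ proj₁) (FinP.remQuot-combine (fromℕ< p<b) a)) (FinP.toℕ-fromℕ< p<b))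
        (≡.cong proj₂ (FinP.remQuot-combine (fromℕ< p<b) a))))
      (+-congʳ (·-cong {f = u₀ i a} (λ _ → refl) same))
      where
      same : ∀ c → fn (block p) ξ c ≈ ξ (combine (fromℕ< p<b) c)
      same c rewrite eq = refl

    block-tuple : ∀ p i ξ → fn (block p) (fn (act (tuple i)) ξ) ≋ fn (act (u₀ i)) (fn (block p) ξ) +v fn (act (ys p i)) (fn (block (suc p)) ξ)
    block-tuple p i ξ a = trans (Lin.cong (block p) (matrix-act (tupleL i) ξ) a) (block-tupleL p i ξ a)

    -- Projection to block p fails to intertwine `tuple` and u₀ exactly by the superdiagonal block
    -- acting on block p + 1, so `transfer` applies with that term as perturbation.
    block-transfer : ∀ {r M M′} (E : Eval u₀ r M) (E′ : Eval tuple r M′) η p →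
      let ws = args (fromEval E′) η (λ _ → 𝟎)
          δ  = λ l → fn (act (ys p (label r l))) (fn (block (suc p)) (ws l)) in
      (∀ l → args (fromEval E) (fn (block p) η) δ l ≋ fn (block p) (ws l)) ×
      (out (fromEval E) (fn (block p) η) δ ≋ fn (block p) (fn (act M′) η))
    block-transfer {r} {M} {M′} E E′ η p = proj₁ tr , λ i →
        trans (proj₂ tr i) (Lin.cong (block p) (λ j → trans (out-act (fromEval E′) η j) (fromEval-act E′ η j)) i)
      where
      ws : Leaf r → Vc (Fin (b ℕ.* m))
      ws = args (fromEval E′) η (λ _ → 𝟎)
      δ : Leaf r → Vc (Fin m)
      δ l = fn (act (ys p (label r l))) (fn (block (suc p)) (ws l))
      hyp : ∀ l → fn (act (u₀ (label r l))) (fn (block p) (ws l)) +v δ l ≋ fn (block p) (fn (act (tuple (label r l))) (ws l) +v 𝟎)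
      hyp l i = trans (sym (block-tuple p (label r l) (ws l) i))
        (Lin.cong (block p) {fn (act (tuple (label r l))) (ws l)} {fn (act (tuple (label r l))) (ws l) +v 𝟎} (λ j → sym (+-identityʳ _)) i)
      tr = transfer (fromEval E) (fromEval E′) (block p) η (λ _ → 𝟎) δ hyp

    -- Back substitution from the last block. Once block p + 1 of the leaf arguments vanishes, the
    -- run on block p is unperturbed; then A kills block p of ξ, and A is injective. In `vanish`, k
    -- bounds the distance from p to b.
    tuple-nonsingular : ∀ {f A B A′} → Eval u₀ f A → (B *M A) ≈M idM → Eval tuple f A′ →
      ∀ ξ → fn (act A′) ξ ≋ 𝟎 → ξ ≋ 𝟎
    tuple-nonsingular {f} {A} {B} {A′} E₀ BA E₀′ ξ A′ξ = block-zero (λ p → proj₁ (vanish b p (ℕP.m≤n+m b p)))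
      where
      E = fromEval E₀
      ws : Leaf f → Vc (Fin (b ℕ.* m))
      ws = args (fromEval E₀′) ξ (λ _ → 𝟎)
      vanish : ∀ k p → b ≤ p ℕ.+ k → fn (block p) ξ ≋ 𝟎 × (∀ l → fn (block p) (ws l) ≋ 𝟎)
      vanish zero p b≤ = block-≥ p b≤p ξ , λ l → block-≥ p b≤p (ws l)
        where
        b≤p : b ≤ p
        b≤p = ≡.subst (b ≤_) (ℕP.+-identityʳ p) b≤
      vanish (suc k) p b≤ = ξ₀≋0 , λ l i → trans (sym (proj₁ tr l i)) (args-0 E {ξ₀} {δ} ξ₀≋0 δ≋0 l i)
        where
        ih : fn (block (suc p)) ξ ≋ 𝟎 × (∀ l → fn (block (suc p)) (ws l) ≋ 𝟎)
        ih = vanish k (suc p) (≡.subst (b ≤_) (ℕP.+-suc p k) b≤)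
        δ : Leaf f → Vc (Fin m)
        δ l = fn (act (ys p (label f l))) (fn (block (suc p)) (ws l))
        δ≋0 : ∀ l → δ l ≋ 𝟎
        δ≋0 l = Lin.fn-≋0 (act (ys p (label f l))) (proj₂ ih l)
        ξ₀ : Vc (Fin m)
        ξ₀ = fn (block p) ξ
        tr : (∀ l → args E ξ₀ δ l ≋ fn (block p) (ws l)) × (out E ξ₀ δ ≋ fn (block p) (fn (act A′) ξ))
        tr = block-transfer E₀ E₀′ ξ p
        Aξ₀ : fn (act A) ξ₀ ≋ 𝟎
        Aξ₀ i = begin
          fn (act A) ξ₀ i                  ≈⟨ fromEval-act E₀ ξ₀ i ⟨
          fn ⟦ E ⟧ ξ₀ i                    ≈⟨ +-identityʳ _ ⟨
          fn ⟦ E ⟧ ξ₀ i + 0#               ≈⟨ +-congˡ (out-0 E {𝟎} {δ} (λ _ → refl) δ≋0 i) ⟨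
          fn ⟦ E ⟧ ξ₀ i + out E 𝟎 δ i      ≈⟨ out-split E ξ₀ δ i ⟨
          out E ξ₀ δ i                     ≈⟨ proj₂ tr i ⟩
          fn (block p) (fn (act A′) ξ) i   ≈⟨ Lin.fn-≋0 (block p) A′ξ i ⟩
          0#                               ∎
        ξ₀≋0 : ξ₀ ≋ 𝟎
        ξ₀≋0 i = trans (sym (idM-act BA ξ₀ i)) (trans (*M-· B A ξ₀ i) (·-zeroʳ (B i) Aξ₀))

    evalTuple : ∀ {r M} → Eval u₀ r M → ∃ λ M′ → Eval tuple r M′
    evalTuple (e-con q) = _ , e-con q
    evalTuple (e-var i) = _ , e-var i
    evalTuple (e-add E F) = _ , e-add (proj₂ (evalTuple E)) (proj₂ (evalTuple F))
    evalTuple (e-mul E F) = _ , e-mul (proj₂ (evalTuple E)) (proj₂ (evalTuple F))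
    evalTuple (e-inv {B = B} E AB BA) = invert (singular-or-invertible (proj₁ (evalTuple E)))
      where
      invert : Singular (proj₁ (evalTuple E)) ⊎ Invertible (proj₁ (evalTuple E)) → ∃ λ M′ → Eval tuple (inv _) M′
      invert (inj₂ (B′ , A′B′ , B′A′)) = B′ , e-inv (proj₂ (evalTuple E)) A′B′ B′A′
      invert (inj₁ (ξ , (j , ξj≉0) , A′ξ)) = contradiction (tuple-nonsingular {B = B} E BA (proj₂ (evalTuple E)) ξ A′ξ j) ξj≉0

    inject : ℕ → Vc (Fin m) → Vc (Fin (b ℕ.* m))
    inject J a x with toℕ (proj₁ (remQuot {b} m x)) ℕ.≟ J
    ... | yes _ = a (proj₂ (remQuot {b} m x))
    ... | no _  = 0#

    block-inject : ∀ J a → J < b → fn (block J) (inject J a) ≋ a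
    block-inject J a J<b c with J ℕ.<? b
    ... | no J≮b = contradiction J<b J≮b
    ... | yes J<b′ with toℕ (proj₁ (remQuot {b} m (combine (fromℕ< J<b′) c))) ℕ.≟ J
    ...   | yes _ = reflexive (≡.cong a (≡.cong proj₂ (FinP.remQuot-combine (fromℕ< J<b′) c)))
    ...   | no ≢J = contradiction (≡.trans (≡.cong (toℕ ∘ proj₁) (FinP.remQuot-combine (fromℕ< J<b′) c)) (FinP.toℕ-fromℕ< J<b′)) ≢J

    block-inject-≢ : ∀ J a p → p ≢ J → fn (block p) (inject J a) ≋ 𝟎
    block-inject-≢ J a p p≢J c with p ℕ.<? b
    ... | no _ = refl
    ... | yes p<b with toℕ (proj₁ (remQuot {b} m (combine (fromℕ< p<b) c))) ℕ.≟ J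
    ...   | no _ = refl
    ...   | yes ≡J = contradiction (≡.trans (≡.sym (FinP.toℕ-fromℕ< p<b)) (≡.trans (≡.sym (≡.cong (toℕ ∘ proj₁) (FinP.remQuot-combine (fromℕ< p<b) c))) ≡J)) p≢J

  -- Interface to the bidiagonal tuple that hides how pairs are encoded as indices in
  -- `Fin (b ℕ.* m)`.
  record BlockSystem {n m} (u₀ : Fin n → Mat m) (b : ℕ) (ys : ℕ → Fin n → Mat m) {r M} (E : Eval u₀ r M) : Set where
    field
      tuple : Fin n → Mat (b ℕ.* m)
      {M′} : Mat (b ℕ.* m)
      E′ : Eval tuple r M′
      block : ℕ → Lin (Fin (b ℕ.* m)) (Fin m)
      block-≥ : ∀ p → b ≤ p → ∀ ξ → fn (block p) ξ ≋ 𝟎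
      inject : ℕ → Vc (Fin m) → Vc (Fin (b ℕ.* m))
      block-inject : ∀ J a → J < b → fn (block J) (inject J a) ≋ a
      block-inject-≢ : ∀ J a p → p ≢ J → fn (block p) (inject J a) ≋ 𝟎
      -- Blockwise, a run over the tuple is a run over u₀ perturbed by the next block.
      block-transfer : ∀ η p →
        let ws = args (fromEval E′) η (λ _ → 𝟎)
            δ  = λ l → fn (act (ys p (label r l))) (fn (block (suc p)) (ws l)) in
        (∀ l → args (fromEval E) (fn (block p) η) δ l ≋ fn (block p) (ws l)) ×
        (out (fromEval E) (fn (block p) η) δ ≋ fn (block p) (fn (act M′) η))

  blockSystem : ∀ {n m} (u₀ : Fin n → Mat m) b ys {r M} (E : Eval u₀ r M) → BlockSystem u₀ b ys E
  blockSystem u₀ b ys E = record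
    { tuple = tuple ; E′ = proj₂ (evalTuple E) ; block = block ; block-≥ = block-≥ ; inject = inject
    ; block-inject = block-inject ; block-inject-≢ = block-inject-≢ ; block-transfer = block-transfer E (proj₂ (evalTuple E)) }
    where open Block u₀ b ys

-- Paths of insertions and the pumping argument

module Pumping (K : QField) {n m} (u₀ : Fin n → KMat.Mat K m) {r : Formula n} {M₀} (E₀ : KMat.Eval K u₀ r M₀) where
  open QField K hiding (zero; _^_)
  open KMat K
  open RingSolver cring
  open Sums cring fromℚ
  open FieldLinear K
  open Operators K
  open Reduction K
  open import Relation.Binary.Reasoning.Setoid setoid

  Tuple : Set
  Tuple = Fin n → Mat m

  -- Index set of the states of the automaton. A state holds the argument arriving at every variable
  -- leaf, whence the dimension `leaves r ℕ.* m`.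
  S : Set
  S = Leaf r × Fin m

  E : Def (act ∘ u₀) r
  E = fromEval E₀

  at : ∀ {I} → Vc (Leaf r × I) → Leaf r → Vc I
  at z l i = z (l , i)

  applyL : Tuple → Lin S S
  applyL Y = record
    { fn   = λ z (l , a) → fn (act (Y (label r l))) (at z l) a
    ; cong = λ h (l , a) → Lin.cong (act (Y (label r l))) (λ c → h (l , c)) a
    ; lin  = λ a z z′ (l , c) → Lin.lin (act (Y (label r l))) a (at z l) (at z′ l) c }

  argsL : ∀ {I} {u : Fin n → Lin I I} → Def u r → Lin (Leaf r × I) (Leaf r × I)
  argsL F = record
    { fn   = λ δ (l , a) → args F 𝟎 (at δ) l a
    ; cong = λ h (l , a) → args-cong F (λ _ → refl) (λ l c → h (l , c)) l a
    ; lin  = λ a δ δ′ (l , c) → trans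
        (args-cong F (λ _ → solve 1 (λ a → con (0 , 0) := a :* con (0 , 0) :+ con (0 , 0)) refl a) (λ _ _ → refl) l c)
        (args-lin F a 𝟎 𝟎 (at δ) (at δ′) l c) }

  outL : ∀ {I} {u : Fin n → Lin I I} → Def u r → Lin (Leaf r × I) I
  outL F = record
    { fn   = λ δ → out F 𝟎 (at δ)
    ; cong = λ h → out-cong F (λ _ → refl) (λ l c → h (l , c))
    ; lin  = λ a δ δ′ c → trans
        (out-cong F (λ _ → solve 1 (λ a → con (0 , 0) := a :* con (0 , 0) :+ con (0 , 0)) refl a) (λ _ _ → refl) c)
        (out-lin F a 𝟎 𝟎 (at δ) (at δ′) c) }

  -- Y is applied to the arguments recorded at the leaves, and the results are fed as perturbation
  -- into a fresh run on zero input; the arguments of that run are the next state.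
  stateL : Tuple → Lin S S
  stateL Y = compL (argsL E) (applyL Y)

  finalL : Tuple → Lin S (Fin m)
  finalL Y = compL (outL E) (applyL Y)

  initial : Vc (Fin m) → Vc S
  initial a (l , c) = args E a (λ _ → 𝟎) l c

  -- The states reached from an input by inserting j perturbations; finalL reads off the
  -- coefficient of the (j + 1)-fold insertion in the expansion of r around u₀.
  data Reach : ℕ → Vc S → Set where
    origin : ∀ a → Reach 0 (initial a)
    insert : ∀ {j z} → Reach j z → (Y : Tuple) → Reach (suc j) (fn (stateL Y) z)

  Silent : ℕ → Set
  Silent j = ∀ z → Reach j z → ∀ Y → fn (finalL Y) z ≋ 𝟎

  module _ (b : ℕ) (vanishes : ∀ (v : Fin n → Mat (b ℕ.* m)) {M} → Eval v r M → M ≈M zeroM) where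

    private
      actZero : ∀ {d} {M : Mat d} → M ≈M zeroM → ∀ ξ → fn (act M) ξ ≋ 𝟎
      actZero {d} M≈0 ξ i = sum-0 d (λ j → trans (*-congʳ (M≈0 i j)) (zeroˡ _))

    -- Latest insertion first: the input enters at block j + 1 and the run descends to block 0, so
    -- the earliest insertion occupies the superdiagonal position j and the final `Y` position 0.
    inserted : ∀ {j z} → Reach j z → ℕ → Tuple
    inserted (origin a) _ = λ _ → zeroM
    inserted (insert ρ Y) zero = Y
    inserted (insert ρ Y) (suc p) = inserted ρ p

    input : ∀ {j z} → Reach j z → Vc (Fin m)
    input (origin a) = a
    input (insert ρ Y) = input ρ

    perturbations : ∀ {j z} → Reach j z → Tuple → ℕ → Tuple
    perturbations ρ Y zero = Y
    perturbations ρ Y (suc p) = inserted ρ p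

    module Path {j z} (ρ : Reach j z) (Y : Tuple) (1+j<b : suc j < b)
                (sys : BlockSystem u₀ b (perturbations ρ Y) E₀) where
      open BlockSystem sys

      ys : ℕ → Tuple
      ys = perturbations ρ Y

      η : Vc (Fin (b ℕ.* m))
      η = inject (suc j) (input ρ)
      ws : Leaf r → Vc (Fin (b ℕ.* m))
      ws = args (fromEval E′) η (λ _ → 𝟎)
      next : ℕ → Leaf r → Vc (Fin m)
      next p l = fn (act (ys p (label r l))) (fn (block (suc p)) (ws l))

      tr : ∀ p → (∀ l → args E (fn (block p) η) (next p) l ≋ fn (block p) (ws l)) ×
                 (out E (fn (block p) η) (next p) ≋ fn (block p) (fn (act M′) η))
      tr p = block-transfer η p

      above : ∀ k p → b ≤ p ℕ.+ k → suc j < p → ∀ l → fn (block p) (ws l) ≋ 𝟎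
      above zero    p b≤ _  l = block-≥ p (≡.subst (b ≤_) (ℕP.+-identityʳ p) b≤) (ws l)
      above (suc k) p b≤ lt l i = trans (sym (proj₁ (tr p) l i)) (args-0 E {fn (block p) η} {next p}
        (block-inject-≢ (suc j) (input ρ) p (ℕP.>⇒≢ lt))
        (λ l → Lin.fn-≋0 (act (ys p (label r l))) (above k (suc p) (≡.subst (b ≤_) (ℕP.+-suc p k) b≤) (ℕP.m≤n⇒m≤1+n lt) l)) l i)

      top : ∀ l → fn (block (suc j)) (ws l) ≋ args E (input ρ) (λ _ → 𝟎) l
      top l i = trans (sym (proj₁ (tr (suc j)) l i)) (args-cong E {fn (block (suc j)) η} {input ρ} {next (suc j)} {λ _ → 𝟎}
        (block-inject (suc j) (input ρ) 1+j<b)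
        (λ l → Lin.fn-≋0 (act (ys (suc j) (label r l))) (above b (suc (suc j)) (ℕP.m≤n+m b _) ℕP.≤-refl l)) l i)

      -- Block t of the leaf arguments is the state after the first j + 1 - t insertions. The
      -- equations say that σ is this initial segment of the path ρ.
      blocks : ∀ {i w} (σ : Reach i w) t → t ℕ.+ i ≡ suc j → input σ ≡ input ρ → (∀ p → p < i → ys (t ℕ.+ p) ≡ inserted σ p) →
               ∀ l → fn (block t) (ws l) ≋ at w l
      blocks (origin a) t t+0≡ in≡ _ l c = trans (reflexive (≡.cong (λ t → fn (block t) (ws l) c) (≡.trans (≡.sym (ℕP.+-identityʳ t)) t+0≡)))
        (trans (top l c) (reflexive (≡.cong (λ a → args E a (λ _ → 𝟎) l c) (≡.sym in≡))))
      blocks (insert {i} {w} σ Y′) t t+i≡ in≡ same l c = trans (sym (proj₁ (tr t) l c))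
        (args-cong E {fn (block t) η} {𝟎} {next t} {λ l c → fn (applyL Y′) w (l , c)} (block-inject-≢ (suc j) (input ρ) t t≢) next≋ l c)
        where
        t≢ : t ≢ suc j
        t≢ t≡ = ℕP.m≢1+m+n t (≡.trans t≡ (≡.trans (≡.sym t+i≡) (ℕP.+-suc t i)))
        ys≡ : ys t ≡ Y′
        ys≡ = ≡.trans (≡.cong ys (≡.sym (ℕP.+-identityʳ t))) (same 0 (ℕ.s≤s ℕ.z≤n))
        ih : ∀ l → fn (block (suc t)) (ws l) ≋ at w l
        ih = blocks σ (suc t) (≡.trans (≡.sym (ℕP.+-suc t i)) t+i≡) in≡
          (λ p p<i → ≡.trans (≡.cong ys (≡.sym (ℕP.+-suc t p))) (same (suc p) (ℕ.s≤s p<i)))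
        next≋ : ∀ l → next t l ≋ at (fn (applyL Y′) w) l
        next≋ l c = trans (Lin.cong (act (ys t (label r l))) (ih l) c)
          (reflexive (≡.cong (λ Y → fn (act (Y (label r l))) (at w l) c) ys≡))

      final≋0 : fn (finalL Y) z ≋ 𝟎
      final≋0 c = begin
        fn (finalL Y) z c                         ≈⟨ out-cong E {𝟎} {fn (block 0) η} {at (fn (applyL Y) z)} {next 0}
                                                       (λ a → sym (block-inject-≢ (suc j) (input ρ) 0 (λ ()) a))
                                                       (λ l → Lin.cong (act (Y (label r l))) (λ a → sym (blocks ρ 1 ≡.refl ≡.refl (λ _ _ → ≡.refl) l a))) c ⟩
        out E (fn (block 0) η) (next 0) c         ≈⟨ proj₂ (tr 0) c ⟩
        fn (block 0) (fn (act M′) η) c            ≈⟨ Lin.fn-≋0 (block 0) (actZero (vanishes tuple E′) η) c ⟩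
        0#                                        ∎

    silent-short : ∀ j → suc j < b → Silent j
    silent-short j 1+j<b z ρ Y = Path.final≋0 ρ Y 1+j<b (blockSystem u₀ b (perturbations ρ Y) E₀)

    private
      base-at : 0 < b → BlockSystem u₀ b (λ _ _ → zeroM) E₀ → ∀ a → out E a (λ _ → 𝟎) ≋ 𝟎
      base-at 0<b sys a c = begin
        out E a (λ _ → 𝟎) c                             ≈⟨ out-cong E {a} {fn (block 0) η} {λ _ → 𝟎} {δ} (λ c → sym (block-inject 0 a 0<b c))
                                                             (λ l c → sym (sum-0 m (λ i → zeroˡ _))) c ⟩
        out E (fn (block 0) η) δ c                      ≈⟨ proj₂ (block-transfer η 0) c ⟩
        fn (block 0) (fn (act M′) η) c                  ≈⟨ Lin.fn-≋0 (block 0) (actZero (vanishes tuple E′) η) c ⟩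
        0#                                              ∎
        where
        open BlockSystem sys
        η : Vc (Fin (b ℕ.* m))
        η = inject 0 a
        δ : Leaf r → Vc (Fin m)
        δ l = fn (act zeroM) (fn (block 1) (args (fromEval E′) η (λ _ → 𝟎) l))

    base : 0 < b → ∀ a → out E a (λ _ → 𝟎) ≋ 𝟎
    base 0<b = base-at 0<b (blockSystem u₀ b (λ _ _ → zeroM) E₀)

    -- Counted from the end: entry p is the state before the last p insertions, which
    -- `continueL ρ p` replays.
    history : ∀ {k z} → Reach k z → Fin (suc k) → Vc S
    history {z = z} ρ zero = z
    history (insert ρ Y) (suc p) = history ρ p

    continueL : ∀ {k z} → Reach k z → Fin (suc k) → Lin S S
    continueL ρ zero = idL
    continueL (insert ρ Y) (suc p) = compL (stateL Y) (continueL ρ p)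

    continue-history : ∀ {k z} (ρ : Reach k z) p → fn (continueL ρ p) (history ρ p) ≋ z
    continue-history ρ zero _ = refl
    continue-history (insert ρ Y) (suc p) = Lin.cong (stateL Y) (continue-history ρ p)

    history-reach : ∀ {k z} (ρ : Reach k z) p → ∃ λ i → Reach i (history ρ p) × i ℕ.+ toℕ p ≡ k
    history-reach {k} ρ zero = k , ρ , ℕP.+-identityʳ k
    history-reach (insert ρ Y) (suc p) with history-reach ρ p
    ... | i , σ , eq = i , σ , ≡.trans (ℕP.+-suc i _) (≡.cong suc eq)

    continue-reach : ∀ {k z} (ρ : Reach k z) p {i w} → Reach i w → Reach (toℕ p ℕ.+ i) (fn (continueL ρ p) w)
    continue-reach ρ zero σ = σ
    continue-reach (insert ρ Y) (suc p) σ = insert (continue-reach ρ p σ) Y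

    enumS : Enumerated S
    enumS = enum× (enumLeaf r) (enumFin m)

    -- Pumping: more states than the dimension are dependent; cutting a segment out of a path
    -- shortens it, so the first nonzero coefficient of the dependency forces the output to vanish.
    pump : ∀ k → leaves r ℕ.* m ≤ k → (∀ {j} → j < k → Silent j) → Silent k
    pump k D≤k shorter z ρ Y a with dependentᴵ enumS (ℕ.s≤s D≤k) (history ρ)
    ... | c , c≉0 , rel with leading c c≉0
    ...   | p , cp≉0 , below = *-zero-cancelˡ cp≉0 (begin
      c p * fn (finalL Y) z a                             ≈⟨ *-congˡ (Lin.cong (finalL Y) (continue-history ρ p) a) ⟨
      c p * fn F (history ρ p) a                          ≈⟨ sum-single (suc k) p others ⟨
      c · (λ q → fn F (history ρ q) a)                    ≈⟨ fn-sum F c (history ρ) a ⟨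
      fn F (λ t → c · (λ q → history ρ q t)) a            ≈⟨ Lin.fn-≋0 F rel a ⟩
      0#                                                  ∎)
      where
      F : Lin S (Fin m)
      F = compL (finalL Y) (continueL ρ p)
      others : ∀ q → q ≢ p → c q * fn F (history ρ q) a ≈ 0#
      others q q≢p with ℕP.<-cmp (toℕ q) (toℕ p)
      ... | tri< q<p _ _ = trans (*-congʳ (below q q<p)) (zeroˡ _)
      ... | tri≈ _ q≡p _ = contradiction (FinP.toℕ-injective q≡p) q≢p
      ... | tri> _ _ p<q with history-reach ρ q
      ...   | i , σ , eq = trans (*-congˡ (shorter lt _ (continue-reach ρ p σ) Y a)) (zeroʳ _)
        where
        -- Replaying the last p insertions from the state q places before the end leaves out q - p >
        -- 0 insertions.
        lt : toℕ p ℕ.+ i < k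
        lt = ≡.subst (toℕ p ℕ.+ i <_) (≡.trans (ℕP.+-comm (toℕ q) i) eq) (ℕP.+-monoˡ-< i p<q)

    silent : leaves r ℕ.* m < b → ∀ k → Silent k
    silent D<b = ℕI.<-rec Silent go
      where
      go : ∀ k → (∀ {j} → j < k → Silent j) → Silent k
      go k shorter with leaves r ℕ.* m ℕ.≤? k
      ... | yes D≤k = pump k D≤k shorter
      ... | no D≰k  = silent-short k (ℕP.≤-<-trans (ℕP.≰⇒> D≰k) D<b)

-- From the base point to an arbitrary tuple

module Line (K : QField) {n m e} (u₀ : Fin n → KMat.Mat K m) (v : Fin n → KMat.Mat K e) {r : Formula n} {M₀ Mᵥ}
            (E₀ : KMat.Eval K u₀ r M₀) (Eᵥ : KMat.Eval K v r Mᵥ) where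
  open QField K hiding (zero; _^_)
  open KMat K
  open RingSolver cring
  open Sums cring fromℚ
  open FieldLinear K
  open Operators K
  open Reduction K
  open Pumping K u₀ E₀
  open import Relation.Binary.Reasoning.Setoid setoid

  I : Set
  I = Fin e × Fin m

  rowL : Fin e → Lin I (Fin m)
  rowL p = record { fn = λ ξ a → ξ (p , a) ; cong = λ h a → h (p , a) ; lin = λ _ _ _ _ → refl }

  onRows : Lin (Fin m) (Fin m) → Lin I I
  onRows L = record
    { fn = λ ξ (p , a) → fn L (λ c → ξ (p , c)) a ; cong = λ h (p , a) → Lin.cong L (λ c → h (p , c)) a
    ; lin = λ c ξ η (p , a) → Lin.lin L c _ _ a }

  onCols : Lin (Fin e) (Fin e) → Lin I I
  onCols L = record
    { fn = λ ξ (p , a) → fn L (λ q → ξ (q , a)) p ; cong = λ h (p , a) → Lin.cong L (λ q → h (q , a)) p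
    ; lin = λ c ξ η (p , a) → Lin.lin L c _ _ p }

  module _ {u : Fin n → Lin (Fin m) (Fin m)} where
    defRows : ∀ {f} → Def u f → Def (onRows ∘ u) f
    defRows-act : ∀ {f} (F : Def u f) ξ → fn ⟦ defRows F ⟧ ξ ≋ fn (onRows ⟦ F ⟧) ξ
    defRows (d-con q) = d-con q
    defRows (d-var i) = d-var i
    defRows (d-add F G) = d-add (defRows F) (defRows G)
    defRows (d-mul F G) = d-mul (defRows F) (defRows G)
    defRows (d-inv F B FB BF) = d-inv (defRows F) (onRows B)
      (λ ξ (p , a) → trans (defRows-act F _ (p , a)) (FB _ a))
      (λ ξ (p , a) → trans (Lin.cong B (λ c → defRows-act F ξ (p , c)) a) (BF _ a))
    defRows-act (d-con q) ξ _ = refl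
    defRows-act (d-var i) ξ _ = refl
    defRows-act (d-add F G) ξ i = +-cong (defRows-act F ξ i) (defRows-act G ξ i)
    defRows-act (d-mul F G) ξ (p , a) = trans (defRows-act F _ (p , a)) (Lin.cong ⟦ F ⟧ (λ c → defRows-act G ξ (p , c)) a)
    defRows-act (d-inv F B _ _) ξ _ = refl

  module _ {u : Fin n → Lin (Fin e) (Fin e)} where
    defCols : ∀ {f} → Def u f → Def (onCols ∘ u) f
    defCols-act : ∀ {f} (F : Def u f) ξ → fn ⟦ defCols F ⟧ ξ ≋ fn (onCols ⟦ F ⟧) ξ
    defCols (d-con q) = d-con q
    defCols (d-var i) = d-var i
    defCols (d-add F G) = d-add (defCols F) (defCols G)
    defCols (d-mul F G) = d-mul (defCols F) (defCols G)
    defCols (d-inv F B FB BF) = d-inv (defCols F) (onCols B)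
      (λ ξ (p , a) → trans (defCols-act F _ (p , a)) (FB _ p))
      (λ ξ (p , a) → trans (Lin.cong B (λ q → defCols-act F ξ (q , a)) p) (BF _ p))
    defCols-act (d-con q) ξ _ = refl
    defCols-act (d-var i) ξ _ = refl
    defCols-act (d-add F G) ξ i = +-cong (defCols-act F ξ i) (defCols-act G ξ i)
    defCols-act (d-mul F G) ξ (p , a) = trans (defCols-act F _ (p , a)) (Lin.cong ⟦ F ⟧ (λ q → defCols-act G ξ (q , a)) p)
    defCols-act (d-inv F B _ _) ξ _ = refl

  uᴿ vᶜ : Fin n → Lin I I
  uᴿ = onRows ∘ act ∘ u₀
  vᶜ = onCols ∘ act ∘ v

  -- Both tuples act on K^e ⊗ K^m: u₀ on the second factor and v on the first.
  module Core (Eᴿ : Def uᴿ r) (Eᶜ : Def vᶜ r) where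

    T : Set
    T = Leaf r × I

    -- v - u₀ applied at every leaf: the perturbation that turns a run over u₀ into a run over v.
    gapL : Lin T T
    gapL = record
      { fn   = λ w (l , i) → fn (vᶜ (label r l)) (at w l) i - fn (uᴿ (label r l)) (at w l) i
      ; cong = λ h (l , i) → +-cong (Lin.cong (vᶜ (label r l)) (λ c → h (l , c)) i) (-‿cong (Lin.cong (uᴿ (label r l)) (λ c → h (l , c)) i))
      ; lin  = λ a w w′ (l , i) → trans
          (+-cong (Lin.lin (vᶜ (label r l)) a (at w l) (at w′ l) i) (-‿cong (Lin.lin (uᴿ (label r l)) a (at w l) (at w′ l) i)))
          (solve 5 (λ a p q s t → (a :* p :+ q) :- (a :* s :+ t) := a :* (p :- s) :+ (q :- t)) refl a _ _ _ _) }

    Gᴿ Gᶜ : Lin T T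
    Gᴿ = compL (argsL Eᴿ) gapL
    Gᶜ = compL (argsL Eᶜ) gapL

    -- The leaf arguments w of a run over v satisfy w - Gᴿ w = base state, as that run is a
    -- perturbed run over u₀; `S⁻L` is the operator on the left. Reading runs over u₀ as perturbed
    -- runs over v gives the right inverse `RL` = 1 + Gᶜ in closed form.
    S⁻L RL : Lin T T
    S⁻L = addL idL (compL (scaleL (- 1#)) Gᴿ)
    RL  = addL idL Gᶜ

    S⁻R : ∀ w → fn S⁻L (fn RL w) ≋ w
    S⁻R w (l , i) = begin
      w (l , i) + X (l , i) + - 1# * fn Gᴿ (w +v X) (l , i)
        ≈⟨ +-congˡ (*-congˡ key) ⟩
      w (l , i) + X (l , i) + - 1# * X (l , i)
        ≈⟨ solve 2 (λ w x → w :+ x :+ :- con (1 , 0) :* x := w) refl _ _ ⟩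
      w (l , i) ∎
      where
      X : Vc T
      X = fn Gᶜ w
      tr = transfer Eᴿ Eᶜ idL 𝟎 (at (fn gapL w)) (at (fn gapL (w +v X)))
        (λ l i → trans (+-congˡ (Lin.fn-+ gapL w X (l , i)))
          (solve 3 (λ u v y → u :+ (y :+ (v :- u)) := v :+ y) refl _ _ _))
      key : fn Gᴿ (w +v X) (l , i) ≈ X (l , i)
      key = proj₁ tr l i

    module Input (η : Vc I) where
      base-state : Vc T
      base-state (l , i) = args Eᴿ η (λ _ → 𝟎) l i
      true-state : Vc T
      true-state (l , i) = args Eᶜ η (λ _ → 𝟎) l i

      true≋R-base : true-state ≋ fn RL base-state
      true≋R-base (l , i) = begin
        args Eᶜ η (λ _ → 𝟎) l i
          ≈⟨ args-cong Eᶜ {η} {η +v 𝟎} {λ _ → 𝟎} {λ l → neg l +v at (fn gapL base-state) l}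
               (λ _ → sym (+-identityʳ _)) (λ l i → sym (-‿inverseˡ _)) l i ⟩
        args Eᶜ (η +v 𝟎) (λ l → neg l +v at (fn gapL base-state) l) l i
          ≈⟨ args-+ Eᶜ η 𝟎 neg (at (fn gapL base-state)) l i ⟩
        args Eᶜ η neg l i + fn Gᶜ base-state (l , i)
          ≈⟨ +-congʳ (proj₁ tr l i) ⟩
        base-state (l , i) + fn Gᶜ base-state (l , i) ∎
        where
        neg : Leaf r → Vc I
        neg l i = - fn gapL base-state (l , i)
        tr = transfer Eᶜ Eᴿ idL η (λ _ → 𝟎) neg
          (λ l i → solve 2 (λ u v → v :+ :- (v :- u) := u :+ con (0 , 0)) refl _ _)

      output : fn ⟦ Eᶜ ⟧ η ≋ fn ⟦ Eᴿ ⟧ η +v fn (outL Eᴿ) (fn gapL true-state)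
      output i = begin
        fn ⟦ Eᶜ ⟧ η i                       ≈⟨ out-act Eᶜ η i ⟨
        out Eᶜ η (λ _ → 𝟎) i                ≈⟨ proj₂ tr i ⟨
        out Eᴿ η (at (fn gapL true-state)) i ≈⟨ out-split Eᴿ η _ i ⟩
        _ ∎
        where
        tr = transfer Eᴿ Eᶜ idL η (λ _ → 𝟎) (at (fn gapL true-state))
          (λ l i → solve 2 (λ u v → u :+ (v :- u) := v :+ con (0 , 0)) refl _ _)

    module _ (η : Vc I) (Good : Vc T → Set)
             (good-cong : ∀ {w w′} → w ≋ w′ → Good w → Good w′)
             (good-lin : ∀ a {w w′} → Good w → Good w′ → Good (a *v w +v w′))
             (good-S : ∀ {w} → Good w → Good (fn S⁻L w))
             (enumT : Enumerated T)
             (good-base : Good (Input.base-state η)) where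

      open Input η

      power : ℕ → Vc T
      power zero    = base-state
      power (suc k) = fn RL (power k)

      good-scale : ∀ {a w} → ¬ a ≈ 0# → Good (a *v w) → Good w
      good-scale {a} {w} a≉0 g with inverse a a≉0
      ... | i , ai≈1 = good-cong
        (λ t → trans (solve 4 (λ i a w b → i :* (a :* w) :+ (:- con (1 , 0) :* b :+ b) := a :* i :* w) refl i a (w t) (base-state t))
               (trans (*-congʳ ai≈1) (*-identityˡ _)))
        -- The inner combination - base + base is the zero vector, turning closure under `good-lin`
        -- into closure under scaling.
        (good-lin i g (good-lin (- 1#) good-base good-base))

      -- Goodness is stable under `S⁻L`, but it is wanted for `RL`. In a relation among the vectors
      -- `power (suc j)`, `S⁻L` lowers each power by one, and the resulting multiple of the base
      -- state is subtracted as good. This repeats until a single nonzero coefficient is left, in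
      -- front of `power 1`. Finite dimension supplies the relation to start from.
      strip : ∀ {k} (c : Fin k → Carrier) → (∃ λ j → ¬ c j ≈ 0#) →
              Good (λ t → c · (λ j → power (suc (toℕ j)) t)) → Good (power 1)
      strip {suc k} c (j , cj≉0) g with FinP.any? (λ i → ¬? (c (suc i) ≟ 0#))
      ... | yes nz = strip (c ∘ suc) nz (good-cong shift (good-lin (- c zero) good-base (good-S g)))
        where
        shift : (- c zero *v base-state +v fn S⁻L (λ t → c · (λ j → power (suc (toℕ j)) t))) ≋
                (λ t → (c ∘ suc) · (λ j → power (suc (toℕ j)) t))
        shift t = begin
          - c zero * base-state t + fn S⁻L (λ t → c · (λ j → power (suc (toℕ j)) t)) t
            ≈⟨ +-congˡ (fn-sum S⁻L c (λ j → power (suc (toℕ j))) t) ⟩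
          - c zero * base-state t + c · (λ j → fn S⁻L (power (suc (toℕ j))) t)
            ≈⟨ +-congˡ (·-cong {f = c} (λ _ → refl) (λ j → S⁻R (power (toℕ j)) t)) ⟩
          - c zero * base-state t + (c zero * base-state t + (c ∘ suc) · (λ j → power (suc (toℕ j)) t))
            ≈⟨ solve 3 (λ c b s → :- c :* b :+ (c :* b :+ s) := s) refl (c zero) (base-state t) _ ⟩
          (c ∘ suc) · (λ j → power (suc (toℕ j)) t) ∎
      ... | no all0 = good-scale c₀≉0 (good-cong (λ t → trans (+-congˡ (rest t)) (+-identityʳ _)) g)
        where
        zero-suc : ∀ i → c (suc i) ≈ 0#
        zero-suc i = decidable-stable (c (suc i) ≟ 0#) (λ nz → all0 (i , nz))
        nonzero : ∀ j → ¬ c j ≈ 0# → ¬ c zero ≈ 0#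
        nonzero zero    h = h
        nonzero (suc j) h = contradiction (zero-suc j) h
        c₀≉0 : ¬ c zero ≈ 0#
        c₀≉0 = nonzero j cj≉0
        rest : ∀ t → (c ∘ suc) · (λ j → power (suc (suc (toℕ j))) t) ≈ 0#
        rest t = sum-0 k (λ j → trans (*-congʳ (zero-suc j)) (zeroˡ _))

      good-true : Good true-state
      good-true with dependentᴵ enumT (ℕP.n<1+n _) (λ j → power (suc (toℕ j)))
      ... | c , c≉0 , rel = good-cong (λ t → sym (true≋R-base t))
        (strip c c≉0 (good-cong (λ t → trans (-‿inverseˡ′ t) (sym (rel t))) (good-lin (- 1#) good-base good-base)))
        where
        -‿inverseˡ′ : ∀ t → - 1# * base-state t + base-state t ≈ 0#
        -‿inverseˡ′ t = solve 1 (λ b → :- con (1 , 0) :* b :+ b := con (0 , 0)) refl (base-state t)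

  -- Every continuation by exactly k more insertions has zero output. Unlike `Silent`, this is a
  -- condition on arbitrary states, and it defines a subspace.
  Null : ℕ → Vc S → Set
  Null zero    z = ∀ Y → fn (finalL Y) z ≋ 𝟎
  Null (suc k) z = ∀ Y → Null k (fn (stateL Y) z)

  null-cong : ∀ k {z z′} → z ≋ z′ → Null k z → Null k z′
  null-cong zero    h z0 Y a = trans (Lin.cong (finalL Y) (λ i → sym (h i)) a) (z0 Y a)
  null-cong (suc k) h z0 Y   = null-cong k (Lin.cong (stateL Y) h) (z0 Y)

  null-lin : ∀ k a {z z′} → Null k z → Null k z′ → Null k (a *v z +v z′)
  null-lin zero    a {z} {z′} z0 z′0 Y i = trans (Lin.lin (finalL Y) a z z′ i)
    (trans (+-cong (trans (*-congˡ (z0 Y i)) (zeroʳ a)) (z′0 Y i)) (+-identityˡ 0#))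
  null-lin (suc k) a {z} {z′} z0 z′0 Y   =
    null-cong k (λ i → sym (Lin.lin (stateL Y) a z z′ i)) (null-lin k a (z0 Y) (z′0 Y))

  null-𝟎 : ∀ k → Null k 𝟎
  null-𝟎 zero    Y = Lin.fn-0 (finalL Y)
  null-𝟎 (suc k) Y = null-cong k (λ i → sym (Lin.fn-0 (stateL Y) i)) (null-𝟎 k)

  null-sum : ∀ k {d} (c : Fin d → Carrier) {zs : Fin d → Vc S} → (∀ q → Null k (zs q)) → Null k (λ t → c · (λ q → zs q t))
  null-sum k {zero}  c h = null-𝟎 k
  null-sum k {suc d} c h = null-lin k (c zero) (h zero) (null-sum k (c ∘ suc) (h ∘ suc))

  silent⇒null : (∀ j → Silent j) → ∀ k {j z} → Reach j z → Null k z
  silent⇒null sil zero    ρ Y = sil _ _ ρ Y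
  silent⇒null sil (suc k) ρ Y = silent⇒null sil k (insert ρ Y)

  module Conclude (sil : ∀ j → Silent j) (base₀ : ∀ a → out E a (λ _ → 𝟎) ≋ 𝟎) where
    Eᴿ : Def uᴿ r
    Eᴿ = defRows E
    Eᶜ : Def vᶜ r
    Eᶜ = defCols (fromEval Eᵥ)
    open Core Eᴿ Eᶜ

    row : Fin e → Vc T → Vc S
    row p w (l , a) = w (l , (p , a))

    row-args : ∀ p η δ l → args E (fn (rowL p) η) (fn (rowL p) ∘ δ) l ≋ fn (rowL p) (args Eᴿ η δ l)
    row-args p η δ = proj₁ (transfer E Eᴿ (rowL p) η δ (fn (rowL p) ∘ δ) (λ _ _ → refl))

    row-out : ∀ p η δ → out E (fn (rowL p) η) (fn (rowL p) ∘ δ) ≋ fn (rowL p) (out Eᴿ η δ)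
    row-out p η δ = proj₂ (transfer E Eᴿ (rowL p) η δ (fn (rowL p) ∘ δ) (λ _ _ → refl))

    scalars : Fin e → Fin e → Tuple
    scalars p q i = scalarM (v i p q)

    -- The gap mixes rows through the entries of v only, and each entry acts on K^m as a scalar
    -- matrix. So in one row the gap is a combination of insertions of scalar matrices and of u₀, to
    -- which the vanishing of paths applies.
    row-gap : ∀ p w → row p (fn gapL w) ≋
              (- 1#) *v fn (applyL u₀) (row p w) +v (λ t → (λ _ → 1#) · (λ q → fn (applyL (scalars p q)) (row q w) t))
    row-gap p w (l , a) = begin
      fn (act (v i)) (λ q → w (l , (q , a))) p - U                                  ≈⟨ solve 2 (λ s u → s :- u := :- con (1 , 0) :* u :+ s) refl _ _ ⟩
      - 1# * U + fn (act (v i)) (λ q → w (l , (q , a))) p                           ≈⟨ +-congˡ (sum-cong e (λ q →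
                                                                                         sym (trans (*-identityˡ _) (scalarM-· (v i p q) a (λ c → w (l , (q , c))))))) ⟩
      - 1# * U + (λ _ → 1#) · (λ q → fn (applyL (scalars p q)) (row q w) (l , a))   ∎
      where
      i = label r l
      U = fn (applyL u₀) (row p w) (l , a)

    row-fn : ∀ {J} (L : Lin S J) p w → fn L (row p (fn gapL w)) ≋
             (- 1#) *v fn (compL L (applyL u₀)) (row p w) +v (λ t → (λ _ → 1#) · (λ q → fn (compL L (applyL (scalars p q))) (row q w) t))
    row-fn L p w t = trans (Lin.cong L (row-gap p w) t) (trans (Lin.lin L (- 1#) _ _ t)
      (+-congˡ (fn-sum L (λ _ → 1#) (λ q → fn (applyL (scalars p q)) (row q w)) t)))

    Good : Vc T → Set
    Good w = ∀ p k → Null k (row p w)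

    good-G : ∀ {w} → Good w → Good (fn Gᴿ w)
    good-G {w} g p k = null-cong k
      (λ { (l , a) → trans (sym (row-fn (argsL E) p w (l , a))) (row-args p 𝟎 (at (fn gapL w)) l a) })
      (null-lin k (- 1#) (g p (suc k) u₀) (null-sum k (λ _ → 1#) (λ q → g q (suc k) (scalars p q))))

    good-S : ∀ {w} → Good w → Good (fn S⁻L w)
    good-S {w} g p k = null-cong k (λ _ → +-comm _ _) (null-lin k (- 1#) (good-G g p k) (g p k))

    good-base : ∀ η → Good (Input.base-state η)
    good-base η p k = null-cong k (λ (l , a) → row-args p η (λ _ → 𝟎) l a) (silent⇒null sil k (origin (fn (rowL p) η)))

    enumT : Enumerated T
    enumT = enum× (enumLeaf r) (enum× (enumFin e) (enumFin m))

    colwise-zero : ∀ η → fn ⟦ Eᶜ ⟧ η ≋ 𝟎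
    colwise-zero η (p , a) = trans (output (p , a)) (trans (+-cong first second) (+-identityˡ 0#))
      where
      open Input η
      first : fn ⟦ Eᴿ ⟧ η (p , a) ≈ 0#
      first = trans (sym (out-act Eᴿ η (p , a))) (trans (sym (row-out p η (λ _ → 𝟎) a)) (base₀ (fn (rowL p) η) a))
      gt : Good true-state
      gt = good-true η Good (λ h g p k → null-cong k (λ (l , a) → h (l , (p , a))) (g p k))
             (λ c g g′ p k → null-lin k c (g p k) (g′ p k)) good-S enumT (good-base η)
      second : fn (outL Eᴿ) (fn gapL true-state) (p , a) ≈ 0#
      second = trans (sym (row-out p 𝟎 (at (fn gapL true-state)) a)) (trans (row-fn (outL E) p true-state a)
        (trans (+-cong (trans (*-congˡ (gt p 0 u₀ a)) (zeroʳ _)) (sum-0 e (λ q → trans (*-congˡ (gt q 0 (scalars p q) a)) (zeroʳ _))))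
               (+-identityˡ 0#)))

    -- ξ is repeated along the second factor, where v acts trivially; an index of that factor serves
    -- to read off the result.
    vanishes-at-v : Fin m → Mᵥ ≈M zeroM
    vanishes-at-v a₀ = ≈M-fromAct (λ ξ p → begin
      Mᵥ p · ξ                                  ≈⟨ fromEval-act Eᵥ ξ p ⟨
      fn ⟦ fromEval Eᵥ ⟧ ξ p                    ≈⟨ defCols-act (fromEval Eᵥ) (λ (q , _) → ξ q) (p , a₀) ⟨
      fn ⟦ Eᶜ ⟧ (λ (q , _) → ξ q) (p , a₀)      ≈⟨ colwise-zero (λ (q , _) → ξ q) (p , a₀) ⟩
      0#                                        ≈⟨ sum-0 e (λ _ → zeroˡ _) ⟨
      zeroM p · ξ                               ∎)

-- A single dimension decides: b blocks accommodate all paths short of the pumping length, pumping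
-- handles the longer ones, and the comparison along v needs nothing but the vanishing of all paths.
vanishing-propagates : ∀ (K : QField) {n m} (u₀ : Fin n → KMat.Mat K (suc m)) {r : Formula n} {M₀} → KMat.Eval K u₀ r M₀ →
  ∀ b → leaves r ℕ.* suc m < b →
  (∀ (v : Fin n → KMat.Mat K (b ℕ.* suc m)) {M} → KMat.Eval K v r M → KMat._≈M_ K M (KMat.zeroM K)) →
  ∀ {e} (v : Fin n → KMat.Mat K e) {M} → KMat.Eval K v r M → KMat._≈M_ K M (KMat.zeroM K)
vanishing-propagates K u₀ E₀ b lt van v Eᵥ =
  Line.Conclude.vanishes-at-v K u₀ v E₀ Eᵥ
    (Pumping.silent K u₀ E₀ b van lt)
    (Pumping.base K u₀ E₀ b van (ℕP.≤-<-trans ℕ.z≤n lt))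
    zero

-- Polynomial functions and the Kronecker point

-- y, and the entries of n generic d × d matrices.
Var : ℕ → ℕ → Set
Var n d = ⊤ ⊎ (Fin n × Fin d × Fin d)

enumVar : ∀ n d → Enumerated (Var n d)
enumVar n d = enum⊎ (record { card = 1 ; elem = λ _ → tt ; index = λ _ → zero ; elem-index = λ _ → ≡.refl })
                    (enum× (enumFin n) (enum× (enumFin d) (enumFin d)))

module Polynomials (K : QField) (n d : ℕ) where
  open QField K hiding (zero)
  open RingSolver cring
  open import Relation.Binary.Reasoning.Setoid setoid

  Point : Set
  Point = Var n d → Carrier

  Fun : CommutativeRing 0ℓ 0ℓ
  Fun = Pointwise.commutativeRing Point cring

  Word : Set
  Word = List (Var n d)

  word : Word → Point → Carrier
  word []      x = 1#
  word (v ∷ w) x = x v * word w x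

  word-++ : ∀ w w′ x → word (w ++ w′) x ≈ word w x * word w′ x
  word-++ []      w′ x = sym (*-identityˡ _)
  word-++ (v ∷ w) w′ x = trans (*-congˡ (word-++ w w′ x)) (sym (*-assoc _ _ _))

  Terms : Set
  Terms = List (ℚ × Word)

  value : Terms → Point → Carrier
  value []             x = 0#
  value ((c , w) ∷ ts) x = fromℚ c * word w x + value ts x

  value-++ : ∀ ts us x → value (ts ++ us) x ≈ value ts x + value us x
  value-++ []       us x = sym (+-identityˡ _)
  value-++ (t ∷ ts) us x = trans (+-congˡ (value-++ ts us x)) (sym (+-assoc _ _ _))

  scaleT : ℚ → Word → Terms → Terms
  scaleT c w = map (λ (c′ , w′) → c ℚ.* c′ , w ++ w′)

  value-scaleT : ∀ c w ts x → value (scaleT c w ts) x ≈ fromℚ c * word w x * value ts x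
  value-scaleT c w []               x = sym (zeroʳ _)
  value-scaleT c w ((c′ , w′) ∷ ts) x = trans
    (+-cong (*-cong (fromℚ-* c c′) (word-++ w w′ x)) (value-scaleT c w ts x))
    (solve 5 (λ c c′ w w′ t → c :* c′ :* (w :* w′) :+ c :* w :* t := c :* w :* (c′ :* w′ :+ t)) refl _ _ _ _ _)

  mulT : Terms → Terms → Terms
  mulT []             us = []
  mulT ((c , w) ∷ ts) us = scaleT c w us ++ mulT ts us

  value-mulT : ∀ ts us x → value (mulT ts us) x ≈ value ts x * value us x
  value-mulT []             us x = sym (zeroˡ _)
  value-mulT ((c , w) ∷ ts) us x = trans (value-++ (scaleT c w us) (mulT ts us) x)
    (trans (+-cong (value-scaleT c w us x) (value-mulT ts us x)) (sym (distribʳ _ _ _)))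

  Degree≤ : ℕ → Terms → Set
  Degree≤ m = All (λ (_ , w) → length w ≤ m)

  degree-scaleT : ∀ {a b} c w {ts} → length w ≤ a → Degree≤ b ts → Degree≤ (a ℕ.+ b) (scaleT c w ts)
  degree-scaleT c w lw []       = []
  degree-scaleT c w {(_ , w′) ∷ _} lw (l ∷ ls) =
    ℕP.≤-trans (ℕP.≤-reflexive (ListP.length-++ w)) (ℕP.+-mono-≤ lw l) ∷ degree-scaleT c w lw ls

  degree-mulT : ∀ {a b ts us} → Degree≤ a ts → Degree≤ b us → Degree≤ (a ℕ.+ b) (mulT ts us)
  degree-mulT []       _  = []
  degree-mulT {ts = (c , w) ∷ _} (l ∷ ls) ms = AllP.++⁺ (degree-scaleT c w l ms) (degree-mulT ls ms)

  -- Functions with a witnessing list of terms: elimination sees only the ring of functions, while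
  -- degree and substitution are read off the terms.
  Polynomial : ℕ → (Point → Carrier) → Set
  Polynomial m p = ∃ λ ts → Degree≤ m ts × (∀ x → p x ≈ value ts x)

  poly-resp : ∀ {m p q} → (∀ x → p x ≈ q x) → Polynomial m p → Polynomial m q
  poly-resp h (ts , ds , eq) = ts , ds , λ x → trans (sym (h x)) (eq x)

  poly-≤ : ∀ {a b p} → a ≤ b → Polynomial a p → Polynomial b p
  poly-≤ a≤b (ts , ds , eq) = ts , All.map (λ l → ℕP.≤-trans l a≤b) ds , eq

  poly-con : ∀ c {m} → Polynomial m (λ _ → fromℚ c)
  poly-con c = (c , []) ∷ [] , ℕ.z≤n ∷ [] , λ x → solve 1 (λ c → c := c :* con (1 , 0) :+ con (0 , 0)) refl _

  poly-0 : ∀ {m} → Polynomial m (λ _ → 0#)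
  poly-0 = [] , [] , λ _ → refl

  poly-1 : ∀ {m} → Polynomial m (λ _ → 1#)
  poly-1 = poly-resp (λ _ → fromℚ-1) (poly-con ℚ.1ℚ)

  poly-var : ∀ v → Polynomial 1 (λ x → x v)
  poly-var v = (ℚ.1ℚ , v ∷ []) ∷ [] , ℕP.≤-refl ∷ [] , λ x → trans
    (solve 1 (λ y → y := con (1 , 0) :* (y :* con (1 , 0)) :+ con (0 , 0)) refl (x v)) (+-congʳ (*-congʳ (sym fromℚ-1)))

  poly-+ : ∀ {m p q} → Polynomial m p → Polynomial m q → Polynomial m (λ x → p x + q x)
  poly-+ (ts , ds , eq) (us , ds′ , eq′) = ts ++ us , AllP.++⁺ ds ds′ , λ x →
    trans (+-cong (eq x) (eq′ x)) (sym (value-++ ts us x))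

  poly-* : ∀ {a b p q} → Polynomial a p → Polynomial b q → Polynomial (a ℕ.+ b) (λ x → p x * q x)
  poly-* (ts , ds , eq) (us , ds′ , eq′) = mulT ts us , degree-mulT ds ds′ , λ x →
    trans (*-cong (eq x) (eq′ x)) (sym (value-mulT ts us x))

  fromℚ-neg1 : fromℚ (ℚ.- ℚ.1ℚ) ≈ - 1#
  fromℚ-neg1 = begin
    fromℚ (ℚ.- ℚ.1ℚ)                   ≈⟨ solve 2 (λ o a → a := o :+ a :- o) refl 1# _ ⟩
    1# + fromℚ (ℚ.- ℚ.1ℚ) - 1#         ≈⟨ +-congʳ (+-congʳ fromℚ-1) ⟨
    fromℚ ℚ.1ℚ + fromℚ (ℚ.- ℚ.1ℚ) - 1# ≈⟨ +-congʳ (fromℚ-+ ℚ.1ℚ (ℚ.- ℚ.1ℚ)) ⟨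
    fromℚ ℚ.0ℚ - 1#                    ≈⟨ +-congʳ fromℚ-0 ⟩
    0# - 1#                            ≈⟨ +-identityˡ _ ⟩
    - 1#                               ∎

  poly-neg : ∀ {m p} → Polynomial m p → Polynomial m (λ x → - p x)
  poly-neg {m} {p} P = poly-resp (λ x → trans (*-congʳ fromℚ-neg1) (solve 1 (λ a → :- con (1 , 0) :* a := :- a) refl (p x)))
    (poly-* {0} {m} {λ _ → fromℚ (ℚ.- ℚ.1ℚ)} {p} (poly-con (ℚ.- ℚ.1ℚ)) P)

  word-map : ∀ (σ : Var n d → Var n d) w x → word (map σ w) x ≈ word w (x ∘ σ)
  word-map σ []      x = refl
  word-map σ (v ∷ w) x = *-congˡ (word-map σ w x)

  poly-∘ : ∀ (σ : Var n d → Var n d) {m p} → Polynomial m p → Polynomial m (λ x → p (x ∘ σ))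
  poly-∘ σ {m} (ts , ds , eq) = rename ts , degree ts ds , λ x → trans (eq (x ∘ σ)) (value-rename ts x)
    where
    rename : Terms → Terms
    rename = map (λ (c , w) → c , map σ w)
    degree : ∀ ts → Degree≤ m ts → Degree≤ m (rename ts)
    degree [] [] = []
    degree ((_ , w) ∷ ts) (l ∷ ls) = ≡.subst (_≤ m) (≡.sym (ListP.length-map σ w)) l ∷ degree ts ls
    value-rename : ∀ ts x → value ts (x ∘ σ) ≈ value (rename ts) x
    value-rename [] x = refl
    value-rename ((c , w) ∷ ts) x = +-cong (*-congˡ (sym (word-map σ w x))) (value-rename ts x)

  word-cong : ∀ w {x x′ : Point} → (∀ v → x v ≈ x′ v) → word w x ≈ word w x′
  word-cong []      h = refl
  word-cong (v ∷ w) h = *-cong (h v) (word-cong w h)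

  poly-ext : ∀ {m p} → Polynomial m p → ∀ {x x′} → (∀ v → x v ≈ x′ v) → p x ≈ p x′
  poly-ext (ts , _ , eq) {x} {x′} h = trans (eq x) (trans (go ts) (sym (eq x′)))
    where
    go : ∀ ts → value ts x ≈ value ts x′
    go [] = refl
    go ((_ , w) ∷ ts) = +-cong (*-congˡ (word-cong w h)) (go ts)

  poly-degree0 : ∀ {p} → Polynomial 0 p → ∀ x x′ → p x ≈ p x′
  poly-degree0 (ts , ds , eq) x x′ = trans (eq x) (trans (go ts ds) (sym (eq x′)))
    where
    go : ∀ ts → Degree≤ 0 ts → value ts x ≈ value ts x′
    go [] [] = refl
    go ((_ , []) ∷ ts) (_ ∷ ls) = +-congˡ (go ts ls)

  𝐲 : Var n d
  𝐲 = inj₁ tt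

  y≔0 : Point → Point
  y≔0 x (inj₁ _) = 0#
  y≔0 x (inj₂ t) = x (inj₂ t)

  splitWord : ∀ w → (∀ x → word w x ≈ word w (y≔0 x)) ⊎
                    (∃ λ w′ → suc (length w′) ≡ length w × (∀ x → word w x ≈ x 𝐲 * word w′ x))
  splitWord [] = inj₁ (λ _ → refl)
  splitWord (inj₁ tt ∷ w) = inj₂ (w , ≡.refl , λ _ → refl)
  splitWord (inj₂ t ∷ w) with splitWord w
  ... | inj₁ h = inj₁ (λ x → *-congˡ (h x))
  ... | inj₂ (w′ , l , h) = inj₂ (inj₂ t ∷ w′ , ≡.cong suc l , λ x → trans (*-congˡ (h x))
          (solve 3 (λ a y w → a :* (y :* w) := y :* (a :* w)) refl _ _ _))

  -- Division by y. The drop in degree makes the computation of the order in y terminate.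
  splitY : ∀ {m p} → Polynomial (suc m) p →
           ∃ λ p₁ → Polynomial m p₁ × (∀ x → p x ≈ p (y≔0 x) + x 𝐲 * p₁ x)
  splitY {m} {p} (ts , ds , eq) = let us , ds′ , eq′ = go ts ds in
    value us , (us , ds′ , λ _ → refl) , λ x → trans (eq x) (trans (eq′ x) (+-congʳ (sym (eq (y≔0 x)))))
    where
    go : ∀ ts → Degree≤ (suc m) ts → ∃ λ us → Degree≤ m us × (∀ x → value ts x ≈ value ts (y≔0 x) + x 𝐲 * value us x)
    go [] [] = [] , [] , λ x → sym (trans (+-identityˡ _) (zeroʳ _))
    go ((c , w) ∷ ts) (l ∷ ls) with go ts ls | splitWord w
    ... | us , ds′ , h | inj₁ hw = us , ds′ , λ x → trans (+-cong (*-congˡ (hw x)) (h x)) (sym (+-assoc _ _ _))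
    ... | us , ds′ , h | inj₂ (w′ , lw , hw) = (c , w′) ∷ us , ℕP.≤-pred (≡.subst (_≤ suc m) (≡.sym lw) l) ∷ ds′ ,
      λ x → trans (+-cong (*-congˡ (hw x)) (h x)) (trans
        (solve 5 (λ c y w t u → c :* (y :* w) :+ (t :+ y :* u) := c :* (con (0 , 0) :* con (0 , 0)) :+ t :+ y :* (c :* w :+ u)) refl
          _ _ _ _ _)
        (+-congʳ (+-congʳ (*-congˡ (trans (zeroˡ _) (sym (trans (hw (y≔0 x)) (zeroˡ _))))))))

  poly-y≔0 : ∀ {m p} → Polynomial m p → Polynomial m (λ x → p (y≔0 x))
  poly-y≔0 {m} (ts , ds , eq) = let us , ds′ , eq′ = go ts ds in us , ds′ , λ x → trans (eq (y≔0 x)) (eq′ x)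
    where
    go : ∀ ts → Degree≤ m ts → ∃ λ us → Degree≤ m us × (∀ x → value ts (y≔0 x) ≈ value us x)
    go [] [] = [] , [] , λ _ → refl
    go ((c , w) ∷ ts) (l ∷ ls) with go ts ls | splitWord w
    ... | us , ds′ , h | inj₁ hw = (c , w) ∷ us , l ∷ ds′ , λ x → +-cong (*-congˡ (sym (hw x))) (h x)
    ... | us , ds′ , h | inj₂ (w′ , lw , hw) = us , ds′ , λ x → trans
      (+-cong (trans (*-congˡ (trans (hw (y≔0 x)) (zeroˡ _))) (zeroʳ _)) (h x)) (+-identityˡ _)

  -- Degree on a logarithmic scale, so that a product costs one level, as `Filtered` demands.
  P : ℕ → (Point → Carrier) → Set
  P k = Polynomial (2 ℕ.^ k)

  P-* : ∀ {k p q} → P k p → P k q → P (suc k) (λ x → p x * q x)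
  P-* {k} Pp Pq = poly-≤ (ℕP.≤-reflexive (≡.cong (2 ℕ.^ k ℕ.+_) (≡.sym (ℕP.+-identityʳ _)))) (poly-* Pp Pq)

  P-suc : ∀ {k p} → P k p → P (suc k) p
  P-suc {k} = poly-≤ (ℕP.m≤m+n (2 ℕ.^ k) _)

module Kronecker (K : QField) {ℓ} (Kz : IsℚωzField K ℓ) (n d kmax : ℕ) where
  open QField K hiding (zero)
  open IsℚωzField Kz
  open RingSolver cring
  open FieldLinear K using (^-+; ^-nonzero)
  open Polynomials K n d
  open Enumerated (enumVar n d)
  open import Relation.Binary.Reasoning.Setoid setoid

  addAt : ℕ → ℚ → List ℚ → List ℚ
  addAt zero    c []       = c ∷ []
  addAt zero    c (a ∷ as) = (c ℚ.+ a) ∷ as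
  addAt (suc m) c []       = ℚ.0ℚ ∷ addAt m c []
  addAt (suc m) c (a ∷ as) = a ∷ addAt m c as

  -- The linear functional z^m ↦ φ m on coefficient lists. With φ = `z ^_` it evaluates at U, with φ
  -- = `decode (x ∘ elem)` at an arbitrary point x, both from the same list.
  pair : (ℕ → Carrier) → List ℚ → Carrier
  pair φ []       = 0#
  pair φ (a ∷ as) = fromℚ a * φ 0 + pair (φ ∘ suc) as

  pair-addAt : ∀ φ m c as → pair φ (addAt m c as) ≈ fromℚ c * φ m + pair φ as
  pair-addAt φ zero    c []       = refl
  pair-addAt φ zero    c (a ∷ as) = trans (+-congʳ (*-congʳ (fromℚ-+ c a)))
    (solve 4 (λ c a f r → (c :+ a) :* f :+ r := c :* f :+ (a :* f :+ r)) refl _ _ _ _)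
  pair-addAt φ (suc m) c []       = trans (+-cong (trans (*-congʳ fromℚ-0) (zeroˡ _)) (pair-addAt (φ ∘ suc) m c [])) (+-identityˡ _)
  pair-addAt φ (suc m) c (a ∷ as) = trans (+-congˡ (pair-addAt (φ ∘ suc) m c as))
    (solve 3 (λ a c r → a :+ (c :+ r) := c :+ (a :+ r)) refl _ _ _)

  pair-zero : ∀ φ {as} → All (λ a → fromℚ a ≈ 0#) as → pair φ as ≈ 0#
  pair-zero φ []         = refl
  pair-zero φ (a≈0 ∷ hs) = trans (+-cong (trans (*-congʳ a≈0) (zeroˡ _)) (pair-zero (φ ∘ suc) hs)) (+-identityˡ 0#)

  pair-* : ∀ a φ as → pair (λ m → a * φ m) as ≈ a * pair φ as
  pair-* a φ []       = sym (zeroʳ a)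
  pair-* a φ (c ∷ as) = trans (+-congˡ (pair-* a (φ ∘ suc) as))
    (solve 4 (λ c a f r → c :* (a :* f) :+ a :* r := a :* (c :* f :+ r)) refl _ _ _ _)

  evalωz-pair : ∀ as → evalωz (map (_∷ []) as) ≈ pair (z ^_) as
  evalωz-pair []       = refl
  evalωz-pair (a ∷ as) = +-cong (trans (+-congˡ (zeroʳ ω)) (trans (+-identityʳ _) (sym (*-identityʳ _))))
    (trans (*-congˡ (evalωz-pair as)) (sym (pair-* z (z ^_) as)))

  z-power-independent : ∀ as → pair (z ^_) as ≈ 0# → All (λ a → fromℚ a ≈ 0#) as
  z-power-independent as h = All.map (λ eq → trans (sym (trans (+-congˡ (zeroʳ ω)) (+-identityʳ _))) eq)
    (AllP.map⁻ (z-transc (map (_∷ []) as) (trans (evalωz-pair as) h)))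

  -- One more than the largest admissible degree: exponents are digits in base B and no carries
  -- occur.
  B : ℕ
  B = suc (2 ℕ.^ kmax)

  bump : ∀ {M} → Fin M → (Fin M → ℕ) → Fin M → ℕ
  bump zero    e zero    = suc (e zero)
  bump zero    e (suc i) = e (suc i)
  bump (suc j) e zero    = e zero
  bump (suc j) e (suc i) = bump j (e ∘ suc) i

  bump-≤ : ∀ {M} j (e : Fin M → ℕ) i → bump j e i ≤ suc (e i)
  bump-≤ zero    e zero    = ℕP.≤-refl
  bump-≤ zero    e (suc i) = ℕP.n≤1+n _
  bump-≤ (suc j) e zero    = ℕP.n≤1+n _
  bump-≤ (suc j) e (suc i) = bump-≤ j (e ∘ suc) i

  encode : ∀ {M} → (Fin M → ℕ) → ℕ
  encode {zero}  e = 0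
  encode {suc M} e = e zero ℕ.+ encode (e ∘ suc) ℕ.* B

  encode-bump : ∀ {M} j (e : Fin M → ℕ) → encode (bump j e) ≡ B ℕ.^ toℕ j ℕ.+ encode e
  encode-bump zero    e = ≡.refl
  encode-bump (suc j) e = ≡.trans (≡.cong (λ t → e zero ℕ.+ t ℕ.* B) (encode-bump j (e ∘ suc)))
    (≡.trans (≡.cong (e zero ℕ.+_) (ℕP.*-distribʳ-+ B (B ℕ.^ toℕ j) (encode (e ∘ suc))))
    (≡.trans (≡.sym (ℕP.+-assoc (e zero) _ _))
    (≡.trans (≡.cong (ℕ._+ encode (e ∘ suc) ℕ.* B) (≡.trans (ℕP.+-comm (e zero) _) (≡.cong (ℕ._+ e zero) (ℕP.*-comm (B ℕ.^ toℕ j) B))))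
             (ℕP.+-assoc (B ℕ.* B ℕ.^ toℕ j) (e zero) _))))

  monomial : ∀ {M} → (Fin M → ℕ) → (Fin M → Carrier) → Carrier
  monomial {zero}  e x = 1#
  monomial {suc M} e x = x zero ^ e zero * monomial (e ∘ suc) (x ∘ suc)

  monomial-bump : ∀ {M} j (e : Fin M → ℕ) x → monomial (bump j e) x ≈ x j * monomial e x
  monomial-bump zero    e x = *-assoc _ _ _
  monomial-bump (suc j) e x = trans (*-congˡ (monomial-bump j (e ∘ suc) (x ∘ suc)))
    (solve 3 (λ a b c → a :* (b :* c) := b :* (a :* c)) refl _ _ _)

  -- The value at x of the monomial whose exponents are the digits of m in base B.
  decode : ∀ {M} → (Fin M → Carrier) → ℕ → Carrier
  decode {zero}  x m = 1#
  decode {suc M} x m = x zero ^ (m % B) * decode (x ∘ suc) (m / B)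

  decode-encode : ∀ {M} (e : Fin M → ℕ) x → (∀ i → e i < B) → decode x (encode e) ≡ monomial e x
  decode-encode {zero}  e x h = ≡.refl
  decode-encode {suc M} e x h = ≡.cong₂ (λ a b → x zero ^ a * b)
    (≡.trans ([m+kn]%n≡m%n (e zero) (encode (e ∘ suc)) B) (m<n⇒m%n≡m (h zero)))
    (≡.trans (≡.cong (decode (x ∘ suc)) quot) (decode-encode (e ∘ suc) (x ∘ suc) (h ∘ suc)))
    where
    quot : (e zero ℕ.+ encode (e ∘ suc) ℕ.* B) / B ≡ encode (e ∘ suc)
    quot = ≡.trans (+-distrib-/-∣ʳ (e zero) {encode (e ∘ suc) ℕ.* B} (divides (encode (e ∘ suc)) ≡.refl))
      (≡.cong₂ ℕ._+_ (m<n⇒m/n≡0 (h zero)) (m*n/n≡m (encode (e ∘ suc)) B))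

  count : Word → Fin card → ℕ
  count []      = λ _ → 0
  count (v ∷ w) = bump (index v) (count w)

  count-≤ : ∀ w i → count w i ≤ length w
  count-≤ []      i = ℕ.z≤n
  count-≤ (v ∷ w) i = ℕP.≤-trans (bump-≤ (index v) (count w) i) (ℕ.s≤s (count-≤ w i))

  word-monomial : ∀ w x → word w x ≈ monomial (count w) (x ∘ elem)
  word-monomial [] x = sym (one (x ∘ elem))
    where
    one : ∀ {M} (x : Fin M → Carrier) → monomial (λ _ → 0) x ≈ 1#
    one {zero}  x = refl
    one {suc M} x = trans (*-identityˡ _) (one (x ∘ suc))
  word-monomial (v ∷ w) x = trans (*-cong (reflexive (≡.cong x (≡.sym (elem-index v)))) (word-monomial w x))
    (sym (monomial-bump (index v) (count w) (x ∘ elem)))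

  -- Kronecker substitution: in base B the exponent of a power of z records a whole monomial.
  U : Point
  U v = z ^ (B ℕ.^ toℕ (index v))

  weight : Word → ℕ
  weight w = encode (count w)

  word-U : ∀ w → word w U ≈ z ^ weight w
  word-U [] = sym (zero-weight {card})
    where
    enc0 : ∀ {M} → encode {M} (λ _ → 0) ≡ 0
    enc0 {zero}  = ≡.refl
    enc0 {suc M} = ≡.cong (ℕ._* B) (enc0 {M})
    zero-weight : ∀ {M} → z ^ encode {M} (λ _ → 0) ≈ 1#
    zero-weight {M} = reflexive (≡.cong (z ^_) (enc0 {M}))
  word-U (v ∷ w) = trans (*-congˡ (word-U w)) (trans (sym (^-+ z (B ℕ.^ toℕ (index v)) (weight w)))
    (reflexive (≡.cong (z ^_) (≡.sym (encode-bump (index v) (count w))))))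

  coefficients : Terms → List ℚ
  coefficients = foldr (λ (c , w) → addAt (weight w) c) []

  value-pair : ∀ φ x ts → All (λ (_ , w) → word w x ≈ φ (weight w)) ts → value ts x ≈ pair φ (coefficients ts)
  value-pair φ x [] [] = refl
  value-pair φ x ((c , w) ∷ ts) (h ∷ hs) =
    trans (+-cong (*-congˡ h) (value-pair φ x ts hs)) (sym (pair-addAt φ (weight w) c (coefficients ts)))

  -- Collecting terms by weight gives one list of rational coefficients. Vanishing at U kills this
  -- list because z is transcendental, and the list determines p everywhere by decoding weights into
  -- monomials.
  zero-at-U : ∀ {k p} → k ≤ kmax → P k p → p U ≈ 0# → ∀ x → p x ≈ 0#
  zero-at-U {k} {p} k≤ (ts , ds , eq) pU≈0 x = begin
    p x                                         ≈⟨ eq x ⟩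
    value ts x                                  ≈⟨ value-pair (decode (x ∘ elem)) x ts (All.map (λ {(_ , w)} l → trans (word-monomial w x)
                                                     (reflexive (≡.sym (decode-encode (count w) (x ∘ elem) (λ i → ℕ.s≤s (ℕP.≤-trans (count-≤ w i)
                                                       (ℕP.≤-trans l (ℕP.^-monoʳ-≤ 2 k≤)))))))) ds) ⟩
    pair (decode (x ∘ elem)) (coefficients ts)  ≈⟨ pair-zero _ (z-power-independent (coefficients ts) at-z) ⟩
    0#                                          ∎
    where
    at-z : pair (z ^_) (coefficients ts) ≈ 0#
    at-z = trans (sym (value-pair (z ^_) U ts (All.universal (λ (_ , w) → word-U w) ts))) (trans (sym (eq U)) pU≈0)

  z≉0 : ¬ z ≈ 0#
  z≉0 z≈0 = 1≉0 (trans (sym fromℚ-1) (second (linear-zero ℚ.0ℚ ℚ.1ℚ fromℚ-0)))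
    where
    second : ∀ {a b} → pair (z ^_) (a ∷ b ∷ []) ≈ 0# → fromℚ b ≈ 0#
    second h = All.head (All.tail (z-power-independent (_ ∷ _ ∷ []) h))
    linear-zero : ∀ a b → fromℚ a ≈ 0# → pair (z ^_) (a ∷ b ∷ []) ≈ 0#
    linear-zero a b a≈0 = begin
      fromℚ a * 1# + (fromℚ b * (z * 1#) + 0#)   ≈⟨ +-cong (trans (*-congʳ a≈0) (zeroˡ _)) (+-congʳ (*-congˡ (*-congʳ z≈0))) ⟩
      0# + (fromℚ b * (0# * 1#) + 0#)            ≈⟨ solve 1 (λ a → con (0 , 0) :+ (a :* (con (0 , 0) :* con (1 , 0)) :+ con (0 , 0)) := con (0 , 0)) refl _ ⟩
      0#                                         ∎

  Uy≉0 : ¬ U 𝐲 ≈ 0#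
  Uy≉0 = ^-nonzero (B ℕ.^ toℕ (index 𝐲)) z≉0

-- Orders in y and the division property

-- U behaves as a generic point up to level `kmax`; nothing else about the Kronecker substitution
-- enters the division argument.
record GenericPoint (K : QField) (n d kmax : ℕ) : Set where
  open QField K
  open Polynomials K n d
  field
    U         : Point
    zero-at-U : ∀ {k p} → k ≤ kmax → P k p → p U ≈ 0# → ∀ x → p x ≈ 0#
    Uy≉0      : ¬ U 𝐲 ≈ 0#

module Order (K : QField) (n d kmax : ℕ) (G : GenericPoint K n d kmax) where
  open QField K hiding (zero)
  open KMat K using (sumFin)
  open RingSolver cring
  open FieldLinear K using (*-nonzero; *-zero-cancelˡ; ^-+; ^-nonzero)
  open Sums cring fromℚ
  open Polynomials K n d public
  open GenericPoint G public
  open import Relation.Binary.Reasoning.Setoid setoid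

  poly-y^ : ∀ o → Polynomial o (λ x → x 𝐲 ^ o)
  poly-y^ zero    = poly-1
  poly-y^ (suc o) = poly-* (poly-var 𝐲) (poly-y^ o)

  poly-sum : ∀ {m} c {f : Fin c → Point → Carrier} → (∀ i → Polynomial m (f i)) → Polynomial m (λ x → sumFin c (λ i → f i x))
  poly-sum zero    h = poly-0
  poly-sum (suc c) h = poly-+ (h zero) (poly-sum c (h ∘ suc))

  U₀ : Point
  U₀ = y≔0 U

  -- The order in y with a certificate: the cofactor survives at y = 0, tested at the one point U₀.
  -- `bound` controls the degree of the powers of y that `ord-sum` moves around.
  record Ord (k : ℕ) (p : Point → Carrier) (o : ℕ) : Set where
    field
      cofactor : Point → Carrier
      poly     : P k cofactor
      factor   : ∀ x → p x ≈ x 𝐲 ^ o * cofactor x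
      lead     : ¬ cofactor U₀ ≈ 0#
      bound    : o ≤ 2 ℕ.^ k

  ord-exists : ∀ {k p} → k ≤ kmax → P k p → ¬ p U ≈ 0# → ∃ (Ord k p)
  ord-exists {k} k≤ Pp pU≉0 = let o , O , _ = go _ ℕP.≤-refl Pp pU≉0 in o , O
    where
    go : ∀ m {p} → m ≤ 2 ℕ.^ k → Polynomial m p → ¬ p U ≈ 0# → ∃ λ o → Ord k p o × o ≤ m
    go zero {p} m≤ Pp pU≉0 = 0 , record
      { cofactor = p ; poly = poly-≤ m≤ Pp ; factor = λ x → sym (*-identityˡ _)
      ; lead = λ h → pU≉0 (trans (poly-degree0 Pp U U₀) h) ; bound = ℕ.z≤n } , ℕ.z≤n
    go (suc m) {p} m≤ Pp pU≉0 with p U₀ ≟ 0#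
    ... | no pU₀≉0 = 0 , record { cofactor = p ; poly = poly-≤ m≤ Pp ; factor = λ x → sym (*-identityˡ _) ; lead = pU₀≉0 ; bound = ℕ.z≤n } , ℕ.z≤n
    ... | yes pU₀≈0 with splitY Pp
    ...   | p₁ , Pp₁ , split = lift (go m (ℕP.≤-trans (ℕP.n≤1+n m) m≤) Pp₁ (λ p₁U≈0 → pU≉0 (trans (p≈ U) (trans (*-congˡ p₁U≈0) (zeroʳ _)))))
      where
      -- p with y set to 0 vanishes at U, hence identically, so the remainder of the division by y
      -- is zero.
      p≈ : ∀ x → p x ≈ x 𝐲 * p₁ x
      p≈ x = trans (split x) (trans (+-congʳ (zero-at-U k≤ (poly-y≔0 (poly-≤ m≤ Pp)) pU₀≈0 x)) (+-identityˡ _))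
      lift : (∃ λ o → Ord k p₁ o × o ≤ m) → ∃ λ o → Ord k p o × o ≤ suc m
      lift (o , O , o≤m) = suc o , record
        { cofactor = O.cofactor ; poly = O.poly ; lead = O.lead ; bound = ℕP.≤-trans (ℕ.s≤s o≤m) m≤
        ; factor = λ x → trans (p≈ x) (trans (*-congˡ (O.factor x)) (sym (*-assoc _ _ _))) } , ℕ.s≤s o≤m
        where module O = Ord O

  ord-suc : ∀ {k p o} → Ord k p o → Ord (suc k) p o
  ord-suc {k} O = record
    { cofactor = O.cofactor ; poly = P-suc {k} O.poly ; factor = O.factor ; lead = O.lead ; bound = ℕP.≤-trans O.bound (ℕP.m≤m+n _ _) }
    where module O = Ord O

  ord-* : ∀ {k p q a b} → Ord k p a → Ord k q b → Ord (suc k) (λ x → p x * q x) (a ℕ.+ b)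
  ord-* {k} {a = a} {b} O Q = record
    { cofactor = λ x → O.cofactor x * Q.cofactor x
    ; poly = P-* {k} O.poly Q.poly
    ; factor = λ x → trans (*-cong (O.factor x) (Q.factor x)) (trans
        (solve 4 (λ s t u v → s :* t :* (u :* v) := s :* u :* (t :* v)) refl _ _ _ _) (*-congʳ (sym (^-+ (x 𝐲) a b))))
    ; lead = *-nonzero O.lead Q.lead
    ; bound = ℕP.≤-trans (ℕP.+-mono-≤ O.bound Q.bound) (ℕP.≤-reflexive (≡.cong (2 ℕ.^ k ℕ.+_) (≡.sym (ℕP.+-identityʳ _)))) }
    where
    module O = Ord O
    module Q = Ord Q

  ord-resp : ∀ {k p q o} → (∀ x → p x ≈ q x) → Ord k p o → Ord k q o
  ord-resp h O = record { cofactor = O.cofactor ; poly = O.poly ; factor = λ x → trans (sym (h x)) (O.factor x) ; lead = O.lead ; bound = O.bound }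
    where module O = Ord O

  ord-y^ : ∀ {k} o → o ≤ 2 ℕ.^ k → Ord k (λ x → x 𝐲 ^ o) o
  ord-y^ o o≤ = record { cofactor = λ _ → 1# ; poly = poly-1 ; factor = λ x → sym (*-identityʳ _) ; lead = 1≉0 ; bound = o≤ }

  ord-nonzero : ∀ {k p o} → k ≤ kmax → Ord k p o → ¬ p U ≈ 0#
  ord-nonzero {o = o} k≤ O pU≈0 = O.lead (zero-at-U k≤ O.poly (*-zero-cancelˡ (^-nonzero o Uy≉0) (trans (sym (O.factor U)) pU≈0)) U₀)
    where module O = Ord O

  -- The factor y^o is cancelled at U and the remaining identity spread to U₀.
  ord-sum : ∀ {k} c {f : Fin c → Point → Carrier} i₀ {o} → suc k ≤ kmax → Ord k (f i₀) o →
            (∀ i → i ≢ i₀ → (∀ x → f i x ≈ 0#) ⊎ (∃ λ o′ → o < o′ × Ord k (f i) o′)) →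
            (∀ x → sumFin c (λ i → f i x) ≈ 0#) → ⊥
  ord-sum {k} c {f} i₀ {o} k< O₀ others total = Ord.lead O₀ (begin
      Ord.cofactor O₀ U₀           ≈⟨ g-i₀ ⟨
      g i₀ U₀                      ≈⟨ sum-single c i₀ (λ i i≢ → g-zero i i≢) ⟨
      sumFin c (λ i → g i U₀)      ≈⟨ zero-at-U k< (poly-sum c (λ i → proj₁ (proj₂ (pick i)))) sum-U U₀ ⟩
      0#                           ∎)
    where
    Reduced : Fin c → Set
    Reduced i = ∃ λ g → P (suc k) g × (∀ x → f i x ≈ x 𝐲 ^ o * g x)

    at-i₀ : Reduced i₀
    at-i₀ = Ord.cofactor O₀ , P-suc {k} (Ord.poly O₀) , Ord.factor O₀

    off : ∀ i → (∀ x → f i x ≈ 0#) ⊎ (∃ λ o′ → o < o′ × Ord k (f i) o′) →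
          ∃ λ g → P (suc k) g × (∀ x → f i x ≈ x 𝐲 ^ o * g x) × g U₀ ≈ 0#
    off i (inj₁ z) = (λ _ → 0#) , poly-0 , (λ x → trans (z x) (sym (zeroʳ _))) , refl
    off i (inj₂ (o′ , o<o′ , O)) = (λ x → x 𝐲 ^ suc e * O.cofactor x)
      , P-* {k} (poly-≤ (ℕP.≤-trans e≤ O.bound) (poly-y^ (suc e))) O.poly
      , (λ x → trans (O.factor x) (trans (*-congʳ (trans (reflexive (≡.cong (x 𝐲 ^_) (≡.sym o′≡))) (^-+ (x 𝐲) o (suc e)))) (*-assoc _ _ _)))
      , trans (*-congʳ (zeroˡ _)) (zeroˡ _)
      where
      module O = Ord O
      e = o′ ℕ.∸ suc o
      o′≡ : o ℕ.+ suc e ≡ o′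
      o′≡ = ≡.trans (ℕP.+-suc o e) (ℕP.m+[n∸m]≡n o<o′)
      e≤ : suc e ≤ o′
      e≤ = ≡.subst (suc e ≤_) o′≡ (ℕP.m≤n+m (suc e) o)

    pick : ∀ i → Reduced i
    pick i with i FinP.≟ i₀
    ... | yes ≡.refl = at-i₀
    ... | no i≢ = let g , Pg , fg , _ = off i (others i i≢) in g , Pg , fg

    g : Fin c → Point → Carrier
    g i = proj₁ (pick i)

    g-zero : ∀ i → i ≢ i₀ → g i U₀ ≈ 0#
    g-zero i i≢ with i FinP.≟ i₀
    ... | yes i≡ = contradiction i≡ i≢
    ... | no i≢′ = proj₂ (proj₂ (proj₂ (off i (others i i≢′))))

    g-i₀ : g i₀ U₀ ≈ Ord.cofactor O₀ U₀
    g-i₀ with i₀ FinP.≟ i₀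
    ... | yes ≡.refl = refl
    ... | no i≢ = contradiction ≡.refl i≢

    sum-U : sumFin c (λ i → g i U) ≈ 0#
    sum-U = *-zero-cancelˡ (^-nonzero o Uy≉0) (trans (sum-*ˡ c _ _)
      (trans (sum-cong c (λ i → sym (proj₂ (proj₂ (pick i)) U))) (total U)))

  ord-neg : ∀ {k p o} → Ord k p o → Ord k (λ x → - p x) o
  ord-neg {o = o} O = record
    { cofactor = λ x → - O.cofactor x ; poly = poly-neg O.poly ; bound = O.bound
    ; factor = λ x → trans (-‿cong (O.factor x)) (solve 2 (λ a b → :- (a :* b) := a :* :- b) refl _ _)
    ; lead = λ h → O.lead (trans (solve 1 (λ a → a := :- (:- a)) refl _) (trans (-‿cong h) (solve 1 (λ a → :- con (0 , 0) := con (0 , 0)) refl 0#))) }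
    where module O = Ord O

  private
    -- Otherwise p + (- p) = 0, with the first term read with order a and the second with order b,
    -- would have only one term of lowest order.
    ord-≮ : ∀ {k p a b} → suc k ≤ kmax → Ord k p a → Ord k p b → ¬ a < b
    ord-≮ {k} {p} {a} {b} k< O Q a<b = ord-sum 2 {f} zero k< O
      (λ { zero 0≢0 → contradiction ≡.refl 0≢0 ; (suc zero) _ → inj₂ (b , a<b , ord-neg Q) })
      (λ x → trans (+-congˡ (+-identityʳ _)) (-‿inverseʳ _))
      where
      f : Fin 2 → Point → Carrier
      f zero    = p
      f (suc _) = λ x → - p x

  ord-unique : ∀ {k p q a b} → suc k ≤ kmax → (∀ x → p x ≈ q x) → Ord k p a → Ord k q b → a ≡ b
  ord-unique {k} {p} {q} {a} {b} k< p≈q O Q with ℕP.<-cmp a b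
  ... | tri≈ _ a≡b _ = a≡b
  ... | tri< a<b _ _ = ⊥-elim (ord-≮ k< O (ord-resp (λ x → sym (p≈q x)) Q) a<b)
  ... | tri> _ _ b<a = ⊥-elim (ord-≮ k< Q (ord-resp p≈q O) b<a)

  module Shift (s s⁻ : Fin n × Fin d × Fin d → Fin n × Fin d × Fin d) (s⁻s : ∀ t → s⁻ (s t) ≡ t) where
    σ σ⁻ : Var n d → Var n d
    σ (inj₁ _) = 𝐲
    σ (inj₂ t) = inj₂ (s t)
    σ⁻ (inj₁ _) = 𝐲
    σ⁻ (inj₂ t) = inj₂ (s⁻ t)

    nonzero-∘ : ∀ {k p} → k ≤ kmax → P k p → ¬ p U ≈ 0# → ¬ p (U ∘ σ) ≈ 0#
    nonzero-∘ {k} {p} k≤ Pp pU≉0 h = pU≉0 (trans (poly-ext Pp undo) (zero-at-U k≤ (poly-∘ σ Pp) h (U ∘ σ⁻)))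
      where
      undo : ∀ v → U v ≈ U (σ⁻ (σ v))
      undo (inj₁ _) = refl
      undo (inj₂ t) = reflexive (≡.cong (U ∘ inj₂) (≡.sym (s⁻s t)))

    -- σ fixes y, so only the leading condition is at stake. If the renamed cofactor vanished at U₀,
    -- it would vanish at every point with y = 0, in particular at the one that σ carries back to
    -- U₀.
    ord-∘ : ∀ {k p o} → k ≤ kmax → Ord k p o → Ord k (λ x → p (x ∘ σ)) o
    ord-∘ {k} k≤ O = record
      { cofactor = λ x → O.cofactor (x ∘ σ) ; poly = poly-∘ σ O.poly ; factor = λ x → O.factor (x ∘ σ) ; bound = O.bound
      ; lead = λ h → O.lead (trans (poly-ext O.poly undo) (zero-at-U k≤ (poly-y≔0 (poly-∘ σ O.poly)) h (U ∘ σ⁻))) }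
      where
      module O = Ord O
      undo : ∀ v → U₀ v ≈ y≔0 (U ∘ σ⁻) (σ v)
      undo (inj₁ _) = refl
      undo (inj₂ t) = reflexive (≡.cong (U ∘ inj₂) (≡.sym (s⁻s t)))

-- Cyclic shift of indices and weights

prev : ∀ {d} → Fin (suc d) → Fin (suc d)
prev {d} zero    = fromℕ d
prev     (suc i) = inject₁ i

next : ∀ {d} → Fin (suc d) → Fin (suc d)
next j = fromView (view j)
  where
  fromView : ∀ {d} {j : Fin (suc d)} → View j → Fin (suc d)
  fromView ‵fromℕ       = zero
  fromView (‵inject₁ i) = suc i

next-prev : ∀ {d} (j : Fin (suc d)) → next (prev j) ≡ j
next-prev {d} zero rewrite view-fromℕ d = ≡.refl
next-prev (suc i) rewrite view-inject₁ i = ≡.refl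

prev-next : ∀ {d} (j : Fin (suc d)) → prev (next j) ≡ j
prev-next j with view j
... | ‵fromℕ     = ≡.refl
... | ‵inject₁ _ = ≡.refl

-- The wrap-around indicator of prev.
ε : ∀ {d} → Fin (suc d) → ℕ
ε zero    = 1
ε (suc _) = 0

-- Stands for - j, shifted by the matrix size to remain in ℕ.
opp : ∀ {d} → Fin (suc d) → ℕ
opp {d} j = suc d ℕ.∸ toℕ j

toℕ-prev : ∀ {d} (l : Fin (suc d)) → toℕ (prev l) ℕ.+ 1 ≡ toℕ l ℕ.+ suc d ℕ.* ε l
toℕ-prev {d} zero    = ≡.trans (≡.cong (ℕ._+ 1) (FinP.toℕ-fromℕ d)) (≡.trans (ℕP.+-comm d 1) (≡.sym (ℕP.*-identityʳ (suc d))))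
toℕ-prev {d} (suc i) = ≡.trans (≡.cong (ℕ._+ 1) (FinP.toℕ-inject₁ i))
  (≡.trans (ℕP.+-comm (toℕ i) 1) (≡.sym (≡.trans (≡.cong (suc (toℕ i) ℕ.+_) (ℕP.*-zeroʳ (suc d))) (ℕP.+-identityʳ _))))

toℕ+opp : ∀ {d} (j : Fin (suc d)) → toℕ j ℕ.+ opp j ≡ suc d
toℕ+opp j = ℕP.m+[n∸m]≡n (ℕP.<⇒≤ (FinP.toℕ<n j))

opp-prev : ∀ {d} (j : Fin (suc d)) → opp (prev j) ℕ.+ suc d ℕ.* ε j ≡ opp j ℕ.+ 1
opp-prev {d} j = ℕP.+-cancelˡ-≡ (toℕ (prev j) ℕ.+ toℕ j) _ _ (begin
  (p ℕ.+ t) ℕ.+ (o ℕ.+ e)   ≡⟨ +-*-Solver.solve 4 (λ p t o e → (p :+ t) :+ (o :+ e) := (p :+ o) :+ (t :+ e)) ≡.refl p t o e ⟩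
  (p ℕ.+ o) ℕ.+ (t ℕ.+ e)   ≡⟨ ≡.cong₂ ℕ._+_ (toℕ+opp (prev j)) (≡.sym (toℕ-prev j)) ⟩
  suc d ℕ.+ (p ℕ.+ 1)       ≡⟨ ≡.cong (ℕ._+ (p ℕ.+ 1)) (≡.sym (toℕ+opp j)) ⟩
  (t ℕ.+ opp j) ℕ.+ (p ℕ.+ 1) ≡⟨ +-*-Solver.solve 3 (λ t q p → (t :+ q) :+ (p :+ con 1) := (p :+ t) :+ (q :+ con 1)) ≡.refl t (opp j) p ⟩
  (p ℕ.+ t) ℕ.+ (opp j ℕ.+ 1) ∎)
  where
  open ≡.≡-Reasoning
  open +-*-Solver using (_:+_; _:=_; con)
  p = toℕ (prev j)
  t = toℕ j
  o = opp (prev j)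
  e = suc d ℕ.* ε j

-- The entry in position (j , l) of order o has order (d + 1) o + l - j in powers of the
-- twisted cyclic shift.
entryWeight : ∀ {d} (j l : Fin (suc d)) → ℕ → ℕ
entryWeight {d} j l o = suc d ℕ.* o ℕ.+ toℕ l ℕ.+ opp j

-- The corresponding weight (d + 1) o - l of a vector entry, again shifted by d + 1.
vectorWeight : ∀ {d} (l : Fin (suc d)) → ℕ → ℕ
vectorWeight {d} l o = suc d ℕ.* o ℕ.+ opp l

-- The weight is constant along cyclic diagonals: a wrap-around of an index changes it by d + 1, and
-- one order in y compensates this.
entryWeight-prev : ∀ {d} (j l : Fin (suc d)) o o′ → ε j ℕ.+ o′ ≡ o ℕ.+ ε l → entryWeight (prev j) (prev l) o ≡ entryWeight j l o′
entryWeight-prev {d} j l o o′ eq = ℕP.+-cancelʳ-≡ (1 ℕ.+ N ℕ.* ε j) _ _ (begin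
  (N ℕ.* o ℕ.+ toℕ (prev l) ℕ.+ opp (prev j)) ℕ.+ (1 ℕ.+ N ℕ.* ε j)
    ≡⟨ solve 4 (λ a b c e → (a :+ b :+ c) :+ (con 1 :+ e) := a :+ (b :+ con 1) :+ (c :+ e)) ≡.refl (N ℕ.* o) (toℕ (prev l)) (opp (prev j)) (N ℕ.* ε j) ⟩
  N ℕ.* o ℕ.+ (toℕ (prev l) ℕ.+ 1) ℕ.+ (opp (prev j) ℕ.+ N ℕ.* ε j)
    ≡⟨ ≡.cong₂ (λ a b → N ℕ.* o ℕ.+ a ℕ.+ b) (toℕ-prev l) (opp-prev j) ⟩
  N ℕ.* o ℕ.+ (toℕ l ℕ.+ N ℕ.* ε l) ℕ.+ (opp j ℕ.+ 1)
    ≡⟨ solve 5 (λ N o t e p → N :* o :+ (t :+ N :* e) :+ (p :+ con 1) := N :* (o :+ e) :+ t :+ p :+ con 1) ≡.refl N o (toℕ l) (ε l) (opp j) ⟩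
  N ℕ.* (o ℕ.+ ε l) ℕ.+ toℕ l ℕ.+ opp j ℕ.+ 1
    ≡⟨ ≡.cong (λ a → N ℕ.* a ℕ.+ toℕ l ℕ.+ opp j ℕ.+ 1) (≡.sym eq) ⟩
  N ℕ.* (ε j ℕ.+ o′) ℕ.+ toℕ l ℕ.+ opp j ℕ.+ 1
    ≡⟨ solve 5 (λ N o t e p → N :* (e :+ o) :+ t :+ p :+ con 1 := (N :* o :+ t :+ p) :+ (con 1 :+ N :* e)) ≡.refl N o′ (toℕ l) (ε j) (opp j) ⟩
  (N ℕ.* o′ ℕ.+ toℕ l ℕ.+ opp j) ℕ.+ (1 ℕ.+ N ℕ.* ε j) ∎)
  where
  open ≡.≡-Reasoning
  open +-*-Solver using (solve; _:+_; _:*_; _:=_; con)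
  N = suc d

-- The index l cancels, so within a row the total weight orders the products by their order a + b in
-- y.
total-weight : ∀ {d} (j l : Fin (suc d)) a b →
  entryWeight j l a ℕ.+ vectorWeight l b ≡ suc d ℕ.* (a ℕ.+ b) ℕ.+ (suc d ℕ.+ opp j)
total-weight {d} j l a b = ≡.trans
  (solve 6 (λ N a b t q p → (N :* a :+ t :+ p) :+ (N :* b :+ q) := N :* (a :+ b) :+ ((t :+ q) :+ p)) ≡.refl (suc d) a b (toℕ l) (opp l) (opp j))
  (≡.cong (λ t → suc d ℕ.* (a ℕ.+ b) ℕ.+ (t ℕ.+ opp j)) (toℕ+opp l))
  where open +-*-Solver using (solve; _:+_; _:*_; _:=_; con)

-- The weight is - l modulo d + 1, so two different entries of a vector never tie for the minimum.
vectorWeight-injective : ∀ {d} (l l′ : Fin (suc d)) a b → vectorWeight l a ≡ vectorWeight l′ b → l ≡ l′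
vectorWeight-injective {d} l l′ a b eq = FinP.toℕ-injective (≡.sym (begin
  toℕ l′                          ≡⟨ m<n⇒m%n≡m (FinP.toℕ<n l′) ⟨
  toℕ l′ % N                      ≡⟨ [m+kn]%n≡m%n (toℕ l′) (suc a) N ⟨
  (toℕ l′ ℕ.+ suc a ℕ.* N) % N    ≡⟨ ≡.cong (_% N) both ⟩
  (toℕ l ℕ.+ suc b ℕ.* N) % N     ≡⟨ [m+kn]%n≡m%n (toℕ l) (suc b) N ⟩
  toℕ l % N                       ≡⟨ m<n⇒m%n≡m (FinP.toℕ<n l) ⟩
  toℕ l                           ∎))
  where
  open ≡.≡-Reasoning
  open +-*-Solver using (solve; _:+_; _:*_; _:=_; con)
  N = suc d
  full : ∀ l c → suc c ℕ.* N ≡ toℕ l ℕ.+ vectorWeight l c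
  full l c = ≡.trans (≡.cong₂ ℕ._+_ (≡.sym (toℕ+opp l)) (ℕP.*-comm c N))
    (solve 3 (λ t p m → (t :+ p) :+ m := t :+ (m :+ p)) ≡.refl (toℕ l) (opp l) (N ℕ.* c))
  both : toℕ l′ ℕ.+ suc a ℕ.* N ≡ toℕ l ℕ.+ suc b ℕ.* N
  both = begin
    toℕ l′ ℕ.+ suc a ℕ.* N                      ≡⟨ ≡.cong (toℕ l′ ℕ.+_) (≡.trans (full l a) (≡.cong (toℕ l ℕ.+_) eq)) ⟩
    toℕ l′ ℕ.+ (toℕ l ℕ.+ vectorWeight l′ b)    ≡⟨ solve 3 (λ a b c → a :+ (b :+ c) := b :+ (a :+ c)) ≡.refl (toℕ l′) (toℕ l) (vectorWeight l′ b) ⟩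
    toℕ l ℕ.+ (toℕ l′ ℕ.+ vectorWeight l′ b)    ≡⟨ ≡.cong (toℕ l ℕ.+_) (≡.sym (full l′ b)) ⟩
    toℕ l ℕ.+ suc b ℕ.* N                       ∎

-- Both factors have at least minimal weight, and the vector factor attains it at l₀ only. A total
-- weight as small as that of l₀ would therefore force l = l₀.
weight-strict : ∀ {d} (j l l₀ : Fin (suc d)) a b a₀ b₀ {w₀ v₀} → l ≢ l₀ → entryWeight j l₀ a₀ ≡ w₀ → vectorWeight l₀ b₀ ≡ v₀ →
  w₀ ≤ entryWeight j l a → v₀ ≤ vectorWeight l b → a₀ ℕ.+ b₀ < a ℕ.+ b
weight-strict {d} j l l₀ a b a₀ b₀ {w₀} {v₀} l≢ w≡ v≡ w₀≤ v₀≤ = ℕP.≰⇒> λ le →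
  l≢ (vectorWeight-injective l l₀ b b₀ (≡.trans (ℕP.≤-antisym (upper le) v₀≤) (≡.sym v≡)))
  where
  open ℕP.≤-Reasoning
  upper : a ℕ.+ b ≤ a₀ ℕ.+ b₀ → vectorWeight l b ≤ v₀
  upper le = ℕP.+-cancelˡ-≤ w₀ (vectorWeight l b) v₀ (begin
    w₀ ℕ.+ vectorWeight l b                             ≤⟨ ℕP.+-monoˡ-≤ (vectorWeight l b) w₀≤ ⟩
    entryWeight j l a ℕ.+ vectorWeight l b              ≡⟨ total-weight j l a b ⟩
    suc d ℕ.* (a ℕ.+ b) ℕ.+ (suc d ℕ.+ opp j)           ≤⟨ ℕP.+-monoˡ-≤ (suc d ℕ.+ opp j) (ℕP.*-monoʳ-≤ (suc d) le) ⟩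
    suc d ℕ.* (a₀ ℕ.+ b₀) ℕ.+ (suc d ℕ.+ opp j)         ≡⟨ total-weight j l₀ a₀ b₀ ⟨
    entryWeight j l₀ a₀ ℕ.+ vectorWeight l₀ b₀          ≡⟨ ≡.cong₂ ℕ._+_ w≡ v≡ ⟩
    w₀ ℕ.+ v₀                                           ∎)

-- Weights of the indices of a finite family; nothing marks the absent ones.
minimum : ∀ {m} (w : Fin m → Maybe ℕ) i {a} → w i ≡ just a →
          ∃ λ i₀ → ∃ λ a₀ → w i₀ ≡ just a₀ × (∀ j b → w j ≡ just b → a₀ ≤ b)
minimum {m} w i {a} eq = ℕI.<-rec Goal search a i eq
  where
  Smaller : Maybe ℕ → ℕ → Set
  Smaller nothing  _ = ⊥
  Smaller (just b) a = b < a
  smaller? : ∀ x a → Dec (Smaller x a)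
  smaller? nothing  _ = no λ ()
  smaller? (just b) a = b ℕ.<? a
  extract : ∀ x a → Smaller x a → ∃ λ b → x ≡ just b × b < a
  extract (just b) a b<a = b , ≡.refl , b<a
  Goal : ℕ → Set
  Goal a = ∀ i → w i ≡ just a → ∃ λ i₀ → ∃ λ a₀ → w i₀ ≡ just a₀ × (∀ j b → w j ≡ just b → a₀ ≤ b)
  search : ∀ a → (∀ {b} → b < a → Goal b) → Goal a
  search a rec i eq with FinP.any? (λ j → smaller? (w j) a)
  ... | yes (j , sm) = let b , eq′ , b<a = extract (w j) a sm in rec b<a j eq′
  ... | no none = i , a , eq , λ j b eq′ → ℕP.≮⇒≥ (λ b<a → none (j , ≡.subst (λ x → Smaller x a) (≡.sym eq′) b<a))

module Division (K : QField) (n d kmax : ℕ) (G : GenericPoint K n (suc d) kmax) where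
  open QField K hiding (zero)
  open KMat K using (sumFin)
  open FieldLinear K using (*-nonzero; ^-nonzero)
  open Sums cring fromℚ
  open Order K n (suc d) kmax G public

  private
    shift shift⁻ : Fin n × Fin (suc d) × Fin (suc d) → Fin n × Fin (suc d) × Fin (suc d)
    shift  (i , j , l) = i , prev j , prev l
    shift⁻ (i , j , l) = i , next j , next l

    shift⁻-shift : ∀ t → shift⁻ (shift t) ≡ t
    shift⁻-shift (i , j , l) = ≡.cong₂ (λ a b → i , a , b) (next-prev j) (next-prev l)

  open Shift shift shift⁻ shift⁻-shift public

  -- `equivariant` is conjugation of A / q by the twisted shift with denominators cleared; q occurs
  -- at x and at `x ∘ σ` since the two fractions have different denominators.
  module Lemma {k} (k<<< : suc (suc (suc k)) ≤ kmax)
    {q : Point → Carrier} (Pq : P k q) (qU≉0 : ¬ q U ≈ 0#)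
    {A : Fin (suc d) → Fin (suc d) → Point → Carrier} (PA : ∀ j l → P k (A j l))
    (equivariant : ∀ j l x → q x * (x 𝐲 ^ ε j * A j l (x ∘ σ)) ≈ q (x ∘ σ) * (A (prev j) (prev l) x * x 𝐲 ^ ε l)) where

    private
      k<< : suc (suc k) ≤ kmax
      k<< = ℕP.≤-trans (ℕP.n≤1+n _) k<<<
      k< : suc k ≤ kmax
      k< = ℕP.≤-trans (ℕP.n≤1+n _) k<<
      k≤ : k ≤ kmax
      k≤ = ℕP.≤-trans (ℕP.n≤1+n _) k<

      ε≤ : ∀ j → ε {d} j ≤ 2 ℕ.^ k
      ε≤ zero    = ℕP.m^n>0 2 k
      ε≤ (suc _) = ℕ.z≤n

    Entry : Fin (suc d) → Fin (suc d) → ℕ → Set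
    Entry j l w = ∃ λ o → Ord k (A j l) o × entryWeight j l o ≡ w

    -- Comparing orders on both sides of `equivariant`: q and its shift have the same order, which
    -- cancels and leaves the relation required by `entryWeight-prev`.
    entry-next : ∀ {j l w} → Entry (prev j) (prev l) w → Entry j l w
    entry-next {j} {l} {w} (o , O , eq) = o′ , O′ , ≡.trans (≡.sym (entryWeight-prev j l o o′ same)) eq
      where
      rhs≉0 : ¬ q (U ∘ σ) * (A (prev j) (prev l) U * U 𝐲 ^ ε l) ≈ 0#
      rhs≉0 = *-nonzero (nonzero-∘ k≤ Pq qU≉0) (*-nonzero (ord-nonzero k≤ O) (^-nonzero (ε l) Uy≉0))
      AU≉0 : ¬ A j l U ≈ 0#
      AU≉0 h = rhs≉0 (trans (sym (equivariant j l U))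
        (trans (*-congˡ (trans (*-congˡ (zero-at-U k≤ (PA j l) h (U ∘ σ))) (zeroʳ _))) (zeroʳ _)))
      o′ : ℕ
      o′ = proj₁ (ord-exists k≤ (PA j l) AU≉0)
      O′ : Ord k (A j l) o′
      O′ = proj₂ (ord-exists k≤ (PA j l) AU≉0)
      c : ℕ
      c = proj₁ (ord-exists k≤ Pq qU≉0)
      Q : Ord k q c
      Q = proj₂ (ord-exists k≤ Pq qU≉0)
      same : ε j ℕ.+ o′ ≡ o ℕ.+ ε l
      same = ℕP.+-cancelˡ-≡ c _ _ (ord-unique k<<< (equivariant j l)
        (ord-* (ord-suc Q) (ord-* (ord-y^ (ε j) (ε≤ j)) (ord-∘ k≤ O′)))
        (ord-* (ord-suc (ord-∘ k≤ Q)) (ord-* O (ord-y^ (ε l) (ε≤ l)))))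

    entry-step : ∀ {j} l {w} → Entry j (prev l) w → ∃ λ j′ → Entry j′ l w
    entry-step {j} l {w} e = next j , entry-next (≡.subst (λ j → Entry j (prev l) w) (≡.sym (prev-next j)) e)

    to-column-zero : ∀ l {j w} → Entry j l w → ∃ λ j′ → Entry j′ zero w
    to-column-zero = >-weakInduction (λ l → ∀ {j w} → Entry j l w → ∃ λ j′ → Entry j′ zero w)
      (entry-step zero) (λ i rec e → rec (proj₂ (entry-step (suc i) e)))

    from-column-zero : ∀ l {j w} → Entry j zero w → ∃ λ j′ → Entry j′ l w
    from-column-zero = <-weakInduction (λ l → ∀ {j w} → Entry j zero w → ∃ λ j′ → Entry j′ l w)
      (λ e → _ , e) (λ i rec e → entry-step (suc i) (proj₂ (rec e)))

    -- A cyclic diagonal meets every column: it is followed forward around to column 0 and from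
    -- there on to l₀.
    to-column : ∀ l₀ {j l w} → Entry j l w → ∃ λ j′ → Entry j′ l₀ w
    to-column l₀ {l = l} e = from-column-zero l₀ (proj₂ (to-column-zero l e))

    weigh : ∀ {p} → P k p → (ℕ → ℕ) → Maybe ℕ
    weigh {p} Pp f with p U ≟ 0#
    ... | yes _   = nothing
    ... | no pU≉0 = just (f (proj₁ (ord-exists k≤ Pp pU≉0)))

    weigh-sound : ∀ {p} (Pp : P k p) f {w} → weigh Pp f ≡ just w → ∃ λ o → Ord k p o × f o ≡ w
    weigh-sound {p} Pp f eq with p U ≟ 0#
    weigh-sound {p} Pp f ≡.refl | no pU≉0 = let o , O = ord-exists k≤ Pp pU≉0 in o , O , ≡.refl

    weigh-complete : ∀ {p} (Pp : P k p) f {o} → Ord k p o → weigh Pp f ≡ just (f o)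
    weigh-complete {p} Pp f O with p U ≟ 0#
    ... | yes pU≈0 = contradiction pU≈0 (ord-nonzero k≤ O)
    ... | no pU≉0  = ≡.cong (just ∘ f) (ord-unique k< (λ _ → refl) (proj₂ (ord-exists k≤ Pp pU≉0)) O)

    private
      minimal-row : ∀ {ξ : Fin (suc d) → Point → Carrier} → (Pξ : ∀ l → P k (ξ l)) →
        (∀ j x → sumFin (suc d) (λ l → A j l x * ξ l x) ≈ 0#) → ∀ {l₀ j₀ v₀ w₀ a₀ b₀} →
        (∀ l v → weigh (Pξ l) (vectorWeight l) ≡ just v → v₀ ≤ v) → (∀ j w → weigh (PA j l₀) (entryWeight j l₀) ≡ just w → w₀ ≤ w) →
        Ord k (A j₀ l₀) a₀ → entryWeight j₀ l₀ a₀ ≡ w₀ → Ord k (ξ l₀) b₀ → vectorWeight l₀ b₀ ≡ v₀ → ⊥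
      minimal-row {ξ} Pξ rows {l₀} {j₀} {v₀} {w₀} {a₀} {b₀} v-min w-min A₀ w≡ B₀ v≡ =
        ord-sum (suc d) {λ l x → A j₀ l x * ξ l x} l₀ k<< (ord-* A₀ B₀) others (rows j₀)
        where
        w₀≤ : ∀ {l a} → Ord k (A j₀ l) a → w₀ ≤ entryWeight j₀ l a
        w₀≤ {l} {a} Oa = let j′ , o , O , eq = to-column l₀ {j₀} {l} {entryWeight j₀ l a} (a , Oa , ≡.refl) in
          w-min j′ _ (≡.trans (weigh-complete (PA j′ l₀) (entryWeight j′ l₀) O) (≡.cong just eq))
        strict : ∀ {l a b} → l ≢ l₀ → Ord k (A j₀ l) a → Ord k (ξ l) b → a₀ ℕ.+ b₀ < a ℕ.+ b
        strict {l} {a} {b} l≢ Oa Ob = weight-strict j₀ l l₀ a b a₀ b₀ l≢ w≡ v≡ (w₀≤ Oa)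
          (v-min l _ (weigh-complete (Pξ l) (vectorWeight l) Ob))
        others : ∀ l → l ≢ l₀ → (∀ x → A j₀ l x * ξ l x ≈ 0#) ⊎ (∃ λ o′ → a₀ ℕ.+ b₀ < o′ × Ord (suc k) (λ x → A j₀ l x * ξ l x) o′)
        others l l≢ = cases (A j₀ l U ≟ 0#) (ξ l U ≟ 0#)
          where
          cases : Dec (A j₀ l U ≈ 0#) → Dec (ξ l U ≈ 0#) →
                  (∀ x → A j₀ l x * ξ l x ≈ 0#) ⊎ (∃ λ o′ → a₀ ℕ.+ b₀ < o′ × Ord (suc k) (λ x → A j₀ l x * ξ l x) o′)
          cases (yes h) _       = inj₁ (λ x → trans (*-congʳ (zero-at-U k≤ (PA j₀ l) h x)) (zeroˡ _))
          cases (no _)  (yes h) = inj₁ (λ x → trans (*-congˡ (zero-at-U k≤ (Pξ l) h x)) (zeroʳ _))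
          cases (no h)  (no h′) = let a , Oa = ord-exists k≤ (PA j₀ l) h
                                      b , Ob = ord-exists k≤ (Pξ l) h′
                                  in inj₂ (a ℕ.+ b , strict l≢ Oa Ob , ord-* Oa Ob)

    -- l₀ has least weight in the vector, and j₀ least weight within column l₀. Every diagonal meets
    -- column l₀ without change of weight, so this is the least weight in the whole matrix. Hence
    -- row j₀ has exactly one product of lowest order, and its sum cannot vanish.
    no-kernel : ∀ {ξ : Fin (suc d) → Point → Carrier} → (∀ l → P k (ξ l)) → (∃ λ l → ¬ ξ l U ≈ 0#) →
                (∃ λ j → ∃ λ l → ¬ A j l U ≈ 0#) →
                (∀ j x → sumFin (suc d) (λ l → A j l x * ξ l x) ≈ 0#) → ⊥
    no-kernel {ξ} Pξ (l₁ , ξU≉0) (j₂ , l₂ , AU≉0) rows =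
      let l₀ , v₀ , v-eq , v-min = minimum (λ l → weigh (Pξ l) (vectorWeight l)) l₁
                                     (weigh-complete (Pξ l₁) (vectorWeight l₁) (proj₂ (ord-exists k≤ (Pξ l₁) ξU≉0)))
          j₁ , _ , O₁ , _        = to-column l₀ (_ , proj₂ (ord-exists k≤ (PA j₂ l₂) AU≉0) , ≡.refl)
          j₀ , w₀ , w-eq , w-min = minimum (λ j → weigh (PA j l₀) (entryWeight j l₀)) j₁ (weigh-complete (PA j₁ l₀) (entryWeight j₁ l₀) O₁)
          b₀ , B₀ , v≡           = weigh-sound (Pξ l₀) (vectorWeight l₀) v-eq
          a₀ , A₀ , w≡           = weigh-sound (PA j₀ l₀) (entryWeight j₀ l₀) w-eq
      in minimal-row Pξ rows v-min w-min A₀ w≡ B₀ v≡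

-- Generic matrices

wrap : ∀ {d} → Fin d → Fin d → ℕ
wrap j l = if toℕ l ℕ.<ᵇ toℕ j then 1 else 0

private
  if-yes : ∀ {a b} → a < b → (if a ℕ.<ᵇ b then 1 else 0) ≡ 1
  if-yes {a} {b} a<b with a ℕ.<ᵇ b | ℕP.<⇒<ᵇ a<b
  ... | true | _ = ≡.refl

  if-no : ∀ {a b} → ¬ a < b → (if a ℕ.<ᵇ b then 1 else 0) ≡ 0
  if-no {a} {b} a≮b with a ℕ.<ᵇ b | ℕP.<ᵇ⇒< a b
  ... | true  | h = contradiction (h tt) a≮b
  ... | false | _ = ≡.refl

wrap-prev : ∀ {d} (j l : Fin (suc d)) → wrap j l ℕ.+ ε j ≡ wrap (prev j) (prev l) ℕ.+ ε l
wrap-prev {d} zero zero = ≡.cong (ℕ._+ 1) (≡.sym (if-no {toℕ (fromℕ d)} {toℕ (fromℕ d)} (ℕP.<-irrefl ≡.refl)))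
wrap-prev {d} zero (suc l) = ≡.cong (ℕ._+ 0) (≡.sym (if-yes
  (≡.subst₂ _<_ (≡.sym (FinP.toℕ-inject₁ l)) (≡.sym (FinP.toℕ-fromℕ d)) (FinP.toℕ<n l))))
wrap-prev {d} (suc j) zero = ≡.cong (ℕ._+ 1) (≡.sym (if-no
  (λ lt → ℕP.<⇒≯ (FinP.toℕ<n j) (≡.subst₂ _<_ (FinP.toℕ-fromℕ d) (FinP.toℕ-inject₁ j) lt))))
wrap-prev {d} (suc j) (suc l) = ≡.cong₂ (λ a b → (if a ℕ.<ᵇ b then 1 else 0) ℕ.+ 0) (≡.sym (FinP.toℕ-inject₁ l)) (≡.sym (FinP.toℕ-inject₁ j))

-- All functions occurring for formulas of size s in N × N matrices have degree at most
-- 2 ^ degreeLevel N s.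
degreeLevel : ℕ → ℕ → ℕ
degreeLevel N zero    = 1
degreeLevel N (suc s) = suc (suc (elimLevel N (degreeLevel N s)))

module Fractions (K : QField) (n N kmax : ℕ) (G : GenericPoint K n N kmax) where
  open QField K hiding (zero)
  open KMat K
  open RingSolver cring
  open FieldLinear K
  open Sums cring fromℚ
  open Operators K
  open Order K n N kmax G
  open import Relation.Binary.Reasoning.Setoid setoid

  private
    module FunMat = MatrixEval Fun (λ c _ → fromℚ c)

  X : Point → Fin n → Mat N
  X x i j l = x (inj₂ (i , j , l)) * x 𝐲 ^ wrap j l

  sum-at : ∀ m (f : Fin m → Point → Carrier) x → FunMat.sumFin m f x ≈ sumFin m (λ i → f i x)
  sum-at zero    f x = refl
  sum-at (suc m) f x = +-congˡ (sum-at m (f ∘ suc) x)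

  -- Pivots are chosen nonzero at x₀. This is applied at v, where invertibility is known, and at U,
  -- where it is to be proved.
  filteredAt : Point → Filtered Fun
  filteredAt x₀ = record
    { Z = λ p → p x₀ ≈ 0# ; Z? = λ p → p x₀ ≟ 0# ; Z-resp = λ a≈b a≈0 → trans (sym (a≈b x₀)) a≈0 ; Z-0 = refl ; Z-1 = 1≉0
    ; Z-prime = *-nonzero
    ; P = P ; P-0 = poly-0 ; P-1 = poly-1 ; P-+ = poly-+ ; P-neg = poly-neg
    ; P-* = λ {k} → P-* {k} ; P-suc = λ {k} → P-suc {k} }

  P-≤ : ∀ {j k p} → j ≤ k → P j p → P k p
  P-≤ j≤k = poly-≤ (ℕP.^-monoʳ-≤ 2 j≤k)

  private module Elim x₀ = Elimination Fun (λ c _ → fromℚ c) (filteredAt x₀)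

  PolyMat : Set
  PolyMat = Fin N → Fin N → Point → Carrier

  PolyKernel : Point → ℕ → PolyMat → Set
  PolyKernel x₀ k A = ∃ λ (ξ : Fin N → Point → Carrier) →
    (∀ l → P k (ξ l)) × (∃ λ l → ¬ ξ l x₀ ≈ 0#) × (∀ j → sumFin N (λ l → A j l x₀ * ξ l x₀) ≈ 0#)

  PolyInverse : Point → ℕ → PolyMat → Set
  PolyInverse x₀ k A = ∃ λ (q : Point → Carrier) → ∃ λ (B : PolyMat) →
    P k q × ¬ q x₀ ≈ 0# × (∀ j l → P k (B j l)) × (∀ x j c → sumFin N (λ l → A j l x * B l c x) ≈ q x * idM j c)

  poly-scalarM : ∀ {k} a → Polynomial k (λ _ → a) → ∀ {m} (j c : Fin m) → Polynomial k (λ _ → scalarM a j c)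
  poly-scalarM a Pa j c with j Fin.≟ c
  ... | yes _ = Pa
  ... | no _  = poly-0

  eliminateAt : ∀ x₀ k (A : PolyMat) → (∀ j l → P k (A j l)) →
                PolyKernel x₀ (elimLevel N k) A ⊎ PolyInverse x₀ (elimLevel N k) A
  eliminateAt x₀ k A PA with Elim.eliminate x₀ k A PA
  ... | inj₁ (ξ , Pξ , nz , rows) = inj₁ (ξ , Pξ , nz , λ j → trans (sym (sum-at N (λ l x → A j l x * ξ l x) x₀)) (rows j))
  ... | inj₂ (q , Pq , nz , sol) = inj₂ (q , (λ l c → proj₁ (column c) l) , Pq , nz , (λ l c → proj₁ (proj₂ (column c)) l) ,
          λ x j c → trans (sym (sum-at N (λ l x → A j l x * proj₁ (column c) l x) x)) (proj₂ (proj₂ (column c)) j x))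
    where
    column : ∀ c → _
    column c = sol (λ j _ → idM j c) (λ j → poly-scalarM 1# poly-1 j c)

  scaled-inverse : ∀ {M : Mat N} {q q₀} {A B : Mat N} → ¬ q ≈ 0# → ¬ q₀ ≈ 0# → (∀ j l → q * M j l ≈ A j l) →
    (∀ j c → sumFin N (λ l → A j l * B l c) ≈ q₀ * idM j c) →
    ∃ λ M⁻ → (M *M M⁻) ≈M idM × (∀ j l → q₀ * M⁻ j l ≈ q * B j l)
  scaled-inverse {M} {q} {q₀} {A} {B} q≉0 q₀≉0 qM AB with inverse q₀ q₀≉0
  ... | i , q₀i = (λ l c → i * (q * B l c)) , right , λ j l →
        trans (sym (*-assoc _ _ _)) (trans (*-congʳ q₀i) (*-identityˡ _))
    where
    right : ∀ j c → sumFin N (λ l → M j l * (i * (q * B l c))) ≈ idM j c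
    right j c = begin
      sumFin N (λ l → M j l * (i * (q * B l c)))   ≈⟨ sum-cong N (λ l → trans
                                                        (solve 4 (λ m i q b → m :* (i :* (q :* b)) := i :* (q :* m :* b)) refl _ _ _ _) (*-congˡ (*-congʳ (qM j l)))) ⟩
      sumFin N (λ l → i * (A j l * B l c))         ≈⟨ sum-*ˡ N i _ ⟨
      i * sumFin N (λ l → A j l * B l c)           ≈⟨ *-congˡ (AB j c) ⟩
      i * (q₀ * idM j c)                           ≈⟨ solve 3 (λ i q e → i :* (q :* e) := q :* i :* e) refl _ _ _ ⟩
      q₀ * i * idM j c                             ≈⟨ trans (*-congʳ q₀i) (*-identityˡ _) ⟩
      idM j c                                      ∎

  private
    level : ℕ → ℕ
    level = degreeLevel N

  level-suc : ∀ s → suc (suc (level s)) ≤ level (suc s)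
  level-suc s = ℕ.s≤s (ℕ.s≤s (elimLevel-≥ N (level s)))

  1≤level : ∀ s → 1 ≤ level s
  1≤level zero    = ℕP.≤-refl
  1≤level (suc s) = ℕ.s≤s ℕ.z≤n

  module AtPoint (v : Fin n → Mat N) where
    xᵥ : Point
    -- With y = 1 the extra factor below the diagonal disappears and the generic matrices specialise
    -- to v.
    xᵥ (inj₁ _)           = 1#
    xᵥ (inj₂ (i , j , l)) = v i j l

    -- g as a quotient A / q of polynomial functions of the generic matrices, with q ≠ 0 at v.
    record Fraction (k : ℕ) (g : Formula n) (M : Mat N) : Set where
      field
        den    : Point → Carrier
        num    : PolyMat
        P-den  : P k den
        P-num  : ∀ j l → P k (num j l)
        den≉0  : ¬ den xᵥ ≈ 0#
        at-v   : ∀ j l → num j l xᵥ ≈ den xᵥ * M j l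
        eval   : ∀ x → ¬ den x ≈ 0# → ∃ λ M′ → Eval (X x) g M′ × (∀ j l → den x * M′ j l ≈ num j l x)

    raise : ∀ {j k g M} → j ≤ k → Fraction j g M → Fraction k g M
    raise j≤k F = record
      { den = den ; num = num ; P-den = P-≤ j≤k P-den ; P-num = λ j l → P-≤ j≤k (P-num j l)
      ; den≉0 = den≉0 ; at-v = at-v ; eval = eval }
      where open Fraction F

    fraction-con : ∀ c → Fraction 1 (con c) (scalarM (fromℚ c))
    fraction-con c = record
      { den = λ _ → 1# ; num = λ j l _ → scalarM (fromℚ c) j l ; P-den = poly-1
      ; P-num = poly-scalarM (fromℚ c) (poly-con c) ; den≉0 = 1≉0 ; at-v = λ _ _ → sym (*-identityˡ _)
      ; eval = λ x _ → _ , e-con c , λ _ _ → *-identityˡ _ }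

    1^≈1 : ∀ m → 1# ^ m ≈ 1#
    1^≈1 zero    = refl
    1^≈1 (suc m) = trans (*-identityˡ _) (1^≈1 m)

    fraction-var : ∀ i → Fraction 1 (var i) (v i)
    fraction-var i = record
      { den = λ _ → 1# ; num = λ j l x → X x i j l ; P-den = poly-1
      ; P-num = λ j l → poly-* (poly-var _) (poly-≤ (wrap≤1 j l) (poly-y^ (wrap j l)))
      ; den≉0 = 1≉0 ; at-v = λ j l → trans (*-congˡ (1^≈1 (wrap j l))) (*-comm _ _)
      ; eval = λ x _ → _ , e-var i , λ _ _ → *-identityˡ _ }
      where
      wrap≤1 : ∀ j l → wrap {N} j l ≤ 1
      wrap≤1 j l with toℕ l ℕ.<ᵇ toℕ j
      ... | true  = ℕP.≤-refl
      ... | false = ℕ.z≤n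

    *-nonzeroˡ : ∀ {a b} → ¬ a * b ≈ 0# → ¬ a ≈ 0#
    *-nonzeroˡ h a≈0 = h (trans (*-congʳ a≈0) (zeroˡ _))

    *-nonzeroʳ : ∀ {a b} → ¬ a * b ≈ 0# → ¬ b ≈ 0#
    *-nonzeroʳ h b≈0 = h (trans (*-congˡ b≈0) (zeroʳ _))

    fraction-add : ∀ {k f g A B} → Fraction k f A → Fraction k g B → Fraction (suc k) (f ⊕ g) (A +M B)
    fraction-add {k} F G = record
      { den = λ x → F.den x * G.den x ; num = λ j l x → F.num j l x * G.den x + F.den x * G.num j l x
      ; P-den = P-* {k} F.P-den G.P-den ; P-num = λ j l → poly-+ (P-* {k} (F.P-num j l) G.P-den) (P-* {k} F.P-den (G.P-num j l))
      ; den≉0 = *-nonzero F.den≉0 G.den≉0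
      ; at-v = λ j l → trans (+-cong (*-congʳ (F.at-v j l)) (*-congˡ (G.at-v j l))) (sym (common _ _ _ _))
      ; eval = λ x h → let M , E , eq = F.eval x (*-nonzeroˡ h) ; M′ , E′ , eq′ = G.eval x (*-nonzeroʳ h) in
          _ , e-add E E′ , λ j l → trans (common _ _ _ _) (+-cong (*-congʳ (eq j l)) (*-congˡ (eq′ j l))) }
      where
      module F = Fraction F
      module G = Fraction G
      common : ∀ p q a b → p * q * (a + b) ≈ p * a * q + p * (q * b)
      common = solve 4 (λ p q a b → p :* q :* (a :+ b) := p :* a :* q :+ p :* (q :* b)) refl

    fraction-mul : ∀ {k f g A B} → Fraction k f A → Fraction k g B → Fraction (suc k) (f ⊗ g) (A *M B)
    fraction-mul {k} F G = record
      { den = λ x → F.den x * G.den x ; num = λ j l x → sumFin N (λ m → F.num j m x * G.num m l x)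
      ; P-den = P-* {k} F.P-den G.P-den ; P-num = λ j l → poly-sum N (λ m → P-* {k} (F.P-num j m) (G.P-num m l))
      ; den≉0 = *-nonzero F.den≉0 G.den≉0
      ; at-v = λ j l → trans (sum-cong N (λ m → *-cong (F.at-v j m) (G.at-v m l))) (sym (common _ _ _ _))
      ; eval = λ x h → let M , E , eq = F.eval x (*-nonzeroˡ h) ; M′ , E′ , eq′ = G.eval x (*-nonzeroʳ h) in
          _ , e-mul E E′ , λ j l → trans (common _ _ _ _) (sum-cong N (λ m → *-cong (eq j m) (eq′ m l))) }
      where
      module F = Fraction F
      module G = Fraction G
      common : ∀ p q (a b : Fin N → Carrier) → p * q * sumFin N (λ m → a m * b m) ≈ sumFin N (λ m → p * a m * (q * b m))
      common p q a b = trans (sum-*ˡ N (p * q) _)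
        (sum-cong N (λ m → solve 4 (λ p q a b → p :* q :* (a :* b) := p :* a :* (q :* b)) refl p q (a m) (b m)))

    fraction-inv : ∀ {k f A B} → Fraction k f A → (A *M B) ≈M idM → (B *M A) ≈M idM →
                   Fraction (suc (suc (elimLevel N k))) (inv f) B
    fraction-inv {k} {f} {A} {B} F AB BA = build (eliminateAt xᵥ k F.num F.P-num)
      where
      module F = Fraction F
      L = elimLevel N k
      P-den′ : P L F.den
      P-den′ = P-≤ (elimLevel-≥ N k) F.P-den
      build : PolyKernel xᵥ L F.num ⊎ PolyInverse xᵥ L F.num → Fraction (suc (suc L)) (inv f) B
      build (inj₁ (ξ , _ , nz , rows)) = contradiction
        ((λ l → ξ l xᵥ) , nz , λ j → *-zero-cancelˡ F.den≉0 (trans (sum-*ˡ N (F.den xᵥ) _)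
          (trans (sum-cong N (λ l → trans (sym (*-assoc _ _ _)) (*-congʳ (sym (F.at-v j l))))) (rows j))))
        (¬singular-right {A = B} {A} BA)
      build (inj₂ (q , C , Pq , q≉0 , PC , FC)) = record
        -- The inverse of num / den is den · C / q. The fraction is expanded by den, so that a
        -- nonzero new denominator guarantees that the subformula can be evaluated too.
        { den = λ x → q x * F.den x ; num = λ j l x → F.den x * (F.den x * C j l x)
        ; P-den = P-suc {suc L} (P-* {L} Pq P-den′) ; P-num = λ j l → P-* {suc L} (P-suc {L} P-den′) (P-* {L} P-den′ (PC j l))
        ; den≉0 = *-nonzero q≉0 F.den≉0
        ; at-v = at-v
        ; eval = eval }
        where
        at-v : ∀ j l → F.den xᵥ * (F.den xᵥ * C j l xᵥ) ≈ q xᵥ * F.den xᵥ * B j l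
        at-v j l with scaled-inverse {A} {F.den xᵥ} {q xᵥ} {λ j l → F.num j l xᵥ} {λ j l → C j l xᵥ} F.den≉0 q≉0 (λ j l → sym (F.at-v j l)) (FC xᵥ)
        ... | A⁻ , AA⁻ , qA⁻ = trans (*-congˡ (trans (sym (qA⁻ j l)) (*-congˡ (A⁻≈B j l))))
                (solve 3 (λ d q b → d :* (q :* b) := q :* d :* b) refl _ _ _)
          where
          A⁻≈B : A⁻ ≈M B
          A⁻≈B = ≈M-fromAct (λ ξ i → begin
            A⁻ i · ξ                                ≈⟨ idM-act BA _ i ⟨
            (B *M A) i · (λ m → A⁻ m · ξ)           ≈⟨ *M-· B A _ i ⟩
            B i · (λ m → A m · (λ m → A⁻ m · ξ))    ≈⟨ ·-cong {f = B i} (λ _ → refl) (λ m → *M-· A A⁻ ξ m) ⟨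
            B i · (λ m → (A *M A⁻) m · ξ)           ≈⟨ ·-cong {f = B i} (λ _ → refl) (λ m → idM-act AA⁻ ξ m) ⟩
            B i · ξ                                 ∎)
        eval : ∀ x → ¬ q x * F.den x ≈ 0# → ∃ λ M′ → Eval (X x) (inv f) M′ × (∀ j l → q x * F.den x * M′ j l ≈ F.den x * (F.den x * C j l x))
        eval x h with F.eval x (*-nonzeroʳ h)
        ... | M , E , eq with scaled-inverse {M} {F.den x} {q x} {λ j l → F.num j l x} {λ j l → C j l x} (*-nonzeroʳ h) (*-nonzeroˡ h) eq (FC x)
        ...   | M⁻ , MM⁻ , qM⁻ = M⁻ , e-inv E MM⁻ (rightInverse⇒leftInverse {A = M} {M⁻} MM⁻) , λ j l →
                  trans (solve 3 (λ q d m → q :* d :* m := d :* (q :* m)) refl _ _ _) (*-congˡ (qM⁻ j l))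

    fraction : ∀ s {g M} → size g ≤ s → Eval v g M → Fraction (level s) g M
    fraction s       le (e-con c) = raise (1≤level s) (fraction-con c)
    fraction s       le (e-var i) = raise (1≤level s) (fraction-var i)
    fraction (suc s) (ℕ.s≤s le) (e-add {f} {g} E F) = raise (ℕP.≤-trans (ℕP.n≤1+n _) (level-suc s))
      (fraction-add (fraction s (ℕP.≤-trans (ℕP.m≤m+n _ _) le) E) (fraction s (ℕP.≤-trans (ℕP.m≤n+m _ (size f)) le) F))
    fraction (suc s) (ℕ.s≤s le) (e-mul {f} {g} E F) = raise (ℕP.≤-trans (ℕP.n≤1+n _) (level-suc s))
      (fraction-mul (fraction s (ℕP.≤-trans (ℕP.m≤m+n _ _) le) E) (fraction s (ℕP.≤-trans (ℕP.m≤n+m _ (size f)) le) F))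
    fraction (suc s) (ℕ.s≤s le) (e-inv E AB BA) = fraction-inv (fraction s le E) AB BA

module Generic (K : QField) (n d kmax : ℕ) (G : GenericPoint K n (suc d) kmax) where
  open QField K hiding (zero)
  open KMat K
  open RingSolver cring
  open FieldLinear K
  open Sums cring fromℚ
  open Operators K
  open Division K n d kmax G
  open Fractions K n (suc d) kmax G public
  open import Relation.Binary.Reasoning.Setoid setoid

  private
    N : ℕ
    N = suc d
    level : ℕ → ℕ
    level = degreeLevel N

  sum-prev : ∀ m (f : Fin (suc m) → Carrier) → sumFin (suc m) f ≈ sumFin (suc m) (λ l → f (prev l))
  sum-prev zero    f = refl
  sum-prev (suc m) f = trans (+-congˡ (sum-prev m (f ∘ suc)))
    (solve 3 (λ a b c → a :+ (b :+ c) := b :+ (a :+ c)) refl _ _ _)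

  prev-injective : ∀ {a b : Fin N} → prev a ≡ prev b → a ≡ b
  prev-injective {a} {b} eq = ≡.trans (≡.sym (next-prev a)) (≡.trans (≡.cong next eq) (next-prev b))

  -- Shifting all indices conjugates the generic matrices by the twisted cyclic shift, and hence
  -- also the values of every formula.
  shift-conjugates : ∀ {r x M Mσ} → ¬ x 𝐲 ≈ 0# → Eval (X x) r M → Eval (X (x ∘ σ)) r Mσ →
                     ∀ j l → x 𝐲 ^ ε j * Mσ j l ≈ M (prev j) (prev l) * x 𝐲 ^ ε l
  shift-conjugates {r} {x} {M} {Mσ} y≉0 E Eσ j l = begin
    Y j * Mσ j l                                   ≈⟨ *-congˡ (*-identityʳ _) ⟨
    Y j * (Mσ j l * 1#)                            ≈⟨ *-congˡ (*-congˡ (YY⁻ l)) ⟨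
    Y j * (Mσ j l * (Y l * Y⁻ l))                  ≈⟨ solve 4 (λ a m b c → a :* (m :* (b :* c)) := a :* (m :* c) :* b) refl _ _ _ _ ⟩
    Y j * (Mσ j l * Y⁻ l) * Y l                    ≈⟨ *-congʳ (*-congˡ (trans (sym lhs) (trans mid rhs))) ⟩
    Y j * (Y⁻ j * M (prev j) (prev l)) * Y l       ≈⟨ *-congʳ (trans (sym (*-assoc _ _ _)) (trans (*-congʳ (YY⁻ j)) (*-identityˡ _))) ⟩
    M (prev j) (prev l) * Y l                      ∎
    where
    Y : Fin N → Carrier
    Y j = x 𝐲 ^ ε j
    Y⁻ : Fin N → Carrier
    Y⁻ zero    = proj₁ (inverse (x 𝐲) y≉0)
    Y⁻ (suc _) = 1#
    YY⁻ : ∀ j → Y j * Y⁻ j ≈ 1#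
    YY⁻ zero    = trans (*-congʳ (*-identityʳ _)) (proj₂ (inverse (x 𝐲) y≉0))
    YY⁻ (suc _) = *-identityˡ _
    π : Lin (Fin N) (Fin N)
    π = record
      { fn = λ ξ j → Y⁻ j * ξ (prev j) ; cong = λ h j → *-congˡ (h _)
      ; lin = λ a ξ η j → solve 4 (λ y a u v → y :* (a :* u :+ v) := a :* (y :* u) :+ y :* v) refl _ _ _ _ }
    entries : ∀ i j l → X (x ∘ σ) i j l * Y j ≈ X x i (prev j) (prev l) * Y l
    entries i j l = begin
      t * x 𝐲 ^ wrap j l * Y j                       ≈⟨ trans (*-assoc _ _ _) (*-congˡ (sym (^-+ (x 𝐲) (wrap j l) (ε j)))) ⟩
      t * x 𝐲 ^ (wrap j l ℕ.+ ε j)                   ≈⟨ reflexive (≡.cong (λ e → t * x 𝐲 ^ e) (wrap-prev j l)) ⟩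
      t * x 𝐲 ^ (wrap (prev j) (prev l) ℕ.+ ε l)     ≈⟨ trans (*-congˡ (^-+ (x 𝐲) (wrap (prev j) (prev l)) (ε l))) (sym (*-assoc _ _ _)) ⟩
      t * x 𝐲 ^ wrap (prev j) (prev l) * Y l         ∎
      where t = x (inj₂ (i , prev j , prev l))
    entries⁻ : ∀ i j l → X (x ∘ σ) i j l * Y⁻ l ≈ Y⁻ j * X x i (prev j) (prev l)
    entries⁻ i j l = begin
      S * Y⁻ l                       ≈⟨ *-congʳ (trans (*-congˡ (YY⁻ j)) (*-identityʳ _)) ⟨
      S * (Y j * Y⁻ j) * Y⁻ l        ≈⟨ solve 4 (λ s a b c → s :* (a :* b) :* c := b :* (s :* a) :* c) refl _ _ _ _ ⟩
      Y⁻ j * (S * Y j) * Y⁻ l        ≈⟨ *-congʳ (*-congˡ (entries i j l)) ⟩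
      Y⁻ j * (R * Y l) * Y⁻ l        ≈⟨ solve 4 (λ b r a c → b :* (r :* a) :* c := b :* (r :* (a :* c))) refl _ _ _ _ ⟩
      Y⁻ j * (R * (Y l * Y⁻ l))      ≈⟨ *-congˡ (trans (*-congˡ (YY⁻ l)) (*-identityʳ _)) ⟩
      Y⁻ j * R                       ∎
      where
      S = X (x ∘ σ) i j l
      R = X x i (prev j) (prev l)
    commutes : ∀ i ξ → fn (act (X (x ∘ σ) i)) (fn π ξ) ≋ fn π (fn (act (X x i)) ξ)
    commutes i ξ j = begin
      sumFin N (λ l → X (x ∘ σ) i j l * (Y⁻ l * ξ (prev l)))               ≈⟨ sum-cong N (λ l → trans (sym (*-assoc _ _ _)) (trans (*-congʳ (entries⁻ i j l)) (*-assoc _ _ (ξ (prev l))))) ⟩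
      sumFin N (λ l → Y⁻ j * (X x i (prev j) (prev l) * ξ (prev l)))       ≈⟨ sum-*ˡ N (Y⁻ j) (λ l → X x i (prev j) (prev l) * ξ (prev l)) ⟨
      Y⁻ j * sumFin N (λ l → X x i (prev j) (prev l) * ξ (prev l))         ≈⟨ *-congˡ (sum-prev d (λ l → X x i (prev j) l * ξ l)) ⟨
      Y⁻ j * sumFin N (λ l → X x i (prev j) l * ξ l)                       ∎
    -- Chosen so that π e is a multiple of the unit vector at l; applying both sides of the
    -- intertwining relation to e isolates a single entry.
    e : Vc (Fin N)
    e m = idM m (prev l)
    mid : Mσ j · fn π e ≈ Y⁻ j * (M (prev j) · e)
    mid = trans (sym (fromEval-act Eσ (fn π e) j)) (trans (intertwine (fromEval Eσ) (fromEval E) π commutes e j)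
      (*-congˡ (fromEval-act E e (prev j))))
    lhs : Mσ j · fn π e ≈ Mσ j l * Y⁻ l
    lhs = trans (sum-single N l (λ m m≢l → trans (*-congˡ (trans (*-congˡ (scalarM-off 1# (m≢l ∘ prev-injective))) (zeroʳ (Y⁻ m)))) (zeroʳ (Mσ j m))))
      (*-congˡ (trans (*-congˡ (scalarM-diag 1# (prev l))) (*-identityʳ _)))
    rhs : Y⁻ j * (M (prev j) · e) ≈ Y⁻ j * M (prev j) (prev l)
    rhs = *-congˡ (trans (·-scalarM 1# (prev l) (M (prev j))) (*-identityʳ _))

  -- A nonzero value at some v keeps denominator and numerator nonzero at U. A kernel vector at U
  -- comes from polynomial functions, so its equations hold identically and contradict `no-kernel`;
  -- otherwise elimination at U delivers the inverse.
  generic-invertible : ∀ s → suc (suc (suc (suc (elimLevel N (level s))))) ≤ kmax → ∀ {r} → size r ≤ s →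
    ∀ (v : Fin n → Mat N) {M} → Eval v r M → (∃ λ j → ∃ λ l → ¬ M j l ≈ 0#) → DefinedInvertibleAt r (X U)
  generic-invertible s big {r} size≤ v {M} E (j₁ , l₁ , M≉0) = finish (eliminateAt U k num P-num)
    where
    open AtPoint v
    k = level s
    L = elimLevel N k
    k≤L : k ≤ L
    k≤L = elimLevel-≥ N k
    L+3≤ : suc (suc (suc L)) ≤ kmax
    L+3≤ = ℕP.≤-trans (ℕP.n≤1+n _) big
    L+1≤ : suc L ≤ kmax
    L+1≤ = ℕP.≤-trans (ℕP.≤-trans (ℕP.n≤1+n _) (ℕP.n≤1+n _)) L+3≤
    L≤ : L ≤ kmax
    L≤ = ℕP.≤-trans (ℕP.n≤1+n _) L+1≤
    k≤ : k ≤ kmax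
    k≤ = ℕP.≤-trans k≤L L≤
    open Fraction (fraction s size≤ E)
    denU≉0 : ¬ den U ≈ 0#
    denU≉0 h = den≉0 (zero-at-U k≤ P-den h xᵥ)
    denUσ≉0 : ¬ den (U ∘ σ) ≈ 0#
    denUσ≉0 = nonzero-∘ k≤ P-den denU≉0
    numU≉0 : ¬ num j₁ l₁ U ≈ 0#
    numU≉0 h = *-nonzero den≉0 M≉0 (trans (sym (at-v j₁ l₁)) (zero-at-U k≤ (P-num j₁ l₁) h xᵥ))
    MU : Mat N
    MU = proj₁ (eval U denU≉0)
    EU : Eval (X U) r MU
    EU = proj₁ (proj₂ (eval U denU≉0))
    MU≈ : ∀ j l → den U * MU j l ≈ num j l U
    MU≈ = proj₂ (proj₂ (eval U denU≉0))
    equivariant : ∀ j l x → den x * (x 𝐲 ^ ε j * num j l (x ∘ σ)) ≈ den (x ∘ σ) * (num (prev j) (prev l) x * x 𝐲 ^ ε l)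
    equivariant j l x = begin
      lhs x                     ≈⟨ solve 2 (λ a b → a := (a :- b) :+ b) refl _ _ ⟩
      (lhs x - rhs x) + rhs x   ≈⟨ +-congʳ (zero-at-U L+3≤ (poly-+ P-lhs (poly-neg P-rhs)) atU x) ⟩
      0# + rhs x                ≈⟨ +-identityˡ _ ⟩
      rhs x                     ∎
      where
      lhs rhs : Point → Carrier
      lhs x = den x * (x 𝐲 ^ ε j * num j l (x ∘ σ))
      rhs x = den (x ∘ σ) * (num (prev j) (prev l) x * x 𝐲 ^ ε l)
      ε≤ : ∀ (j : Fin N) → ε j ≤ 2 ℕ.^ L
      ε≤ zero    = ℕP.m^n>0 2 L
      ε≤ (suc _) = ℕ.z≤n
      P-ε : ∀ (j : Fin N) → P L (λ x → x 𝐲 ^ ε j)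
      P-ε j = poly-≤ (ε≤ j) (poly-y^ (ε j))
      up : ∀ {p} → P (suc (suc L)) p → P (suc (suc (suc L))) p
      up = P-suc {suc (suc L)}
      P-lhs : P (suc (suc (suc L))) lhs
      P-lhs = up (P-* {suc L} (P-suc {L} (P-≤ k≤L P-den)) (P-* {L} (P-ε j) (P-≤ k≤L (poly-∘ σ (P-num j l)))))
      P-rhs : P (suc (suc (suc L))) rhs
      P-rhs = up (P-* {suc L} (P-suc {L} (P-≤ k≤L (poly-∘ σ P-den))) (P-* {L} (P-≤ k≤L (P-num (prev j) (prev l))) (P-ε l)))
      atU : lhs U - rhs U ≈ 0#
      atU = let Mσ , Eσ , Mσ≈ = eval (U ∘ σ) denUσ≉0 in begin
        lhs U - rhs U
          ≈⟨ +-cong (*-congˡ (*-congˡ (sym (Mσ≈ j l)))) (-‿cong (*-congˡ (*-congʳ (sym (MU≈ (prev j) (prev l)))))) ⟩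
        den U * (U 𝐲 ^ ε j * (den (U ∘ σ) * Mσ j l)) - den (U ∘ σ) * (den U * MU (prev j) (prev l) * U 𝐲 ^ ε l)
          ≈⟨ solve 6 (λ p q a m m′ b → p :* (a :* (q :* m)) :- q :* (p :* m′ :* b) := p :* q :* (a :* m :- m′ :* b)) refl
               (den U) (den (U ∘ σ)) (U 𝐲 ^ ε j) (Mσ j l) (MU (prev j) (prev l)) (U 𝐲 ^ ε l) ⟩
        den U * den (U ∘ σ) * (U 𝐲 ^ ε j * Mσ j l - MU (prev j) (prev l) * U 𝐲 ^ ε l)
          ≈⟨ *-congˡ (trans (+-congʳ (shift-conjugates {r} {U} Uy≉0 EU Eσ j l)) (-‿inverseʳ _)) ⟩
        den U * den (U ∘ σ) * 0#
          ≈⟨ zeroʳ _ ⟩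
        0# ∎
    finish : PolyKernel U L num ⊎ PolyInverse U L num → DefinedInvertibleAt r (X U)
    finish (inj₁ (ξ , Pξ , nz , rows)) = ⊥-elim (Lemma.no-kernel L+3≤ (P-≤ k≤L P-den) denU≉0 (λ j l → P-≤ k≤L (P-num j l)) equivariant Pξ nz
      (j₁ , l₁ , numU≉0)
      (λ j → zero-at-U L+1≤ (poly-sum N (λ l → P-* {L} (P-≤ k≤L (P-num j l)) (Pξ l))) (rows j)))
    finish (inj₂ (q , B , _ , q≉0 , _ , AB)) =
      let M⁻ , MM⁻ , _ = scaled-inverse {MU} {den U} {q U} {λ j l → num j l U} {λ j l → B j l U} denU≉0 q≉0 MU≈ (AB U)
      in MU , EU , M⁻ , MM⁻ , rightInverse⇒leftInverse {A = MU} {M⁻} MM⁻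

-- The hitting set

open import Data.Nat using (_*_; _+_; _^_)

module HittingPoint (K : QField) {ℓ} (Kz : IsℚωzField K ℓ) (n s : ℕ) where
  open QField K hiding (zero; _*_; _+_; _^_)
  private module F = QField K
  open KMat K
  open Operators K
  open FieldLinear K
  open Sums cring fromℚ
  open import Relation.Binary.Reasoning.Setoid setoid

  -- The 4 covers the products formed after the last elimination, as `generic-invertible` requires.
  kmax : ℕ → ℕ
  kmax d = 4 + elimLevel (suc d) (degreeLevel (suc d) s)

  kronecker : ∀ d → GenericPoint K n (suc d) (kmax d)
  kronecker d = record { U = U ; zero-at-U = λ {k} → zero-at-U {k} ; Uy≉0 = Uy≉0 }
    where open Kronecker K Kz n (suc d) (kmax d)

  point : ∀ d → Fin n → Mat (suc d)
  point d = Generic.X K n d (kmax d) (kronecker d) (GenericPoint.U (kronecker d))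

  point-invertible : ∀ d {r} → size r ≤ s → ∀ (v : Fin n → Mat (suc d)) {M} → Eval v r M →
                     (∃ λ j → ∃ λ l → ¬ M j l ≈ 0#) → DefinedInvertibleAt r (point d)
  point-invertible d = Generic.generic-invertible K n d (kmax d) (kronecker d) s ℕP.≤-refl

  -- Contraposition: if the point failed, r would vanish at all tuples of its size, hence at v. That
  -- size, `suc (m + b * suc m)`, reduces to `suc b * suc m`, the size of a bidiagonal tuple with b
  -- + 1 blocks.
  invertible-at-point : ∀ {m b} (u₀ : Fin n → Mat (suc m)) {r M₀} → size r ≤ s → Eval u₀ r M₀ → leaves r * suc m < suc b →
    ∀ {e} (v : Fin n → Mat e) {M} → Eval v r M → ¬ M ≈M zeroM → DefinedInvertibleAt r (point (m + b * suc m))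
  invertible-at-point {m} {b} u₀ {r} size≤ E₀ lt v E M≉0 =
    decidable-stable (definedInvertible? (point (m + b * suc m)) r) (λ undef →
      M≉0 (vanishing-propagates K u₀ E₀ (suc b) lt (λ v′ {M′} E′ j l →
        decidable-stable (M′ j l ≟ 0#) (λ nz → undef (point-invertible (m + b * suc m) size≤ v′ E′ (j , l , nz)))) v E))

  -- One less than the dimensions reached from base dimension 1 and from base dimension d₀ + 1. The
  -- number of blocks exceeds by one the bound (s + 1) m on the number of states, as a formula of
  -- size s has at most s + 1 leaves.
  d₀ d₁ : ℕ
  d₀ = suc s * 1 * 1
  d₁ = d₀ + suc s * suc d₀ * suc d₀

  eval-height0 : ∀ {d} (u : Fin n → Mat d) f → invHeight f ≤ 0 → ∃ λ M → Eval u f M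
  eval-height0 u (con q) h = _ , e-con q
  eval-height0 u (var i) h = _ , e-var i
  eval-height0 u (f ⊕ g) h = _ , e-add (proj₂ (eval-height0 u f (ℕP.m⊔n≤o⇒m≤o _ _ h))) (proj₂ (eval-height0 u g (ℕP.m⊔n≤o⇒n≤o (invHeight f) _ h)))
  eval-height0 u (f ⊗ g) h = _ , e-mul (proj₂ (eval-height0 u f (ℕP.m⊔n≤o⇒m≤o _ _ h))) (proj₂ (eval-height0 u g (ℕP.m⊔n≤o⇒n≤o (invHeight f) _ h)))

  few-leaves : ∀ (r : Formula n) m → size r ≤ s → leaves r * m < suc (suc s * m)
  few-leaves r m size≤ = ℕ.s≤s (ℕP.*-monoˡ-≤ m (ℕP.≤-trans (leaves≤ r) (ℕ.s≤s size≤)))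

  eval-height1 : ∀ {e} (v : Fin n → Mat (suc e)) {r M} → size r ≤ s → invHeight r ≤ 1 → Eval v r M → ∃ λ M₀ → Eval (point d₀) r M₀
  eval-height1 v size≤ h (e-con q) = _ , e-con q
  eval-height1 v size≤ h (e-var i) = _ , e-var i
  eval-height1 v size≤ h (e-add {f} {g} E F) =
    _ , e-add (proj₂ (eval-height1 v (ℕP.≤-trans (ℕP.m≤m+n _ _) (ℕP.<⇒≤ size≤)) (ℕP.m⊔n≤o⇒m≤o _ _ h) E))
              (proj₂ (eval-height1 v (ℕP.≤-trans (ℕP.m≤n+m _ (size f)) (ℕP.<⇒≤ size≤)) (ℕP.m⊔n≤o⇒n≤o (invHeight f) _ h) F))
  eval-height1 v size≤ h (e-mul {f} {g} E F) =
    _ , e-mul (proj₂ (eval-height1 v (ℕP.≤-trans (ℕP.m≤m+n _ _) (ℕP.<⇒≤ size≤)) (ℕP.m⊔n≤o⇒m≤o _ _ h) E))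
              (proj₂ (eval-height1 v (ℕP.≤-trans (ℕP.m≤n+m _ (size f)) (ℕP.<⇒≤ size≤)) (ℕP.m⊔n≤o⇒n≤o (invHeight f) _ h) F))
  eval-height1 {e} v size≤ h (e-inv {f} {A} {B} E AB BA) = invert
      (invertible-at-point u₀ (ℕP.<⇒≤ size≤) (proj₂ (eval-height0 u₀ f (ℕP.≤-pred h))) (few-leaves f 1 (ℕP.<⇒≤ size≤)) v E A≉0)
    where
    u₀ : Fin n → Mat 1
    u₀ _ = zeroM
    A≉0 : ¬ A ≈M zeroM
    -- The diagonal entry used here exists because the dimension is positive; in dimension 0 the
    -- zero matrix is invertible.
    A≉0 A≈0 = 1≉0 (trans (sym (scalarM-diag {suc e} 1# zero)) (trans (sym (AB zero zero)) (sum-0 (suc e) (λ k → trans (*-congʳ (A≈0 zero k)) (zeroˡ (B k zero))))))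
    invert : DefinedInvertibleAt f (point d₀) → ∃ λ M₀ → Eval (point d₀) (inv f) M₀
    invert (_ , E₀ , M⁻ , MM⁻ , M⁻M) = M⁻ , e-inv E₀ MM⁻ M⁻M

  -- Rational tuples inside K

  fromℚ-injective : ∀ q → fromℚ q ≈ 0# → q ≡ ℚ.0ℚ
  fromℚ-injective q h = decidable-stable (q ℚP.≟ ℚ.0ℚ) λ q≢0 →
    let instance q-nonZero = ℚ.≢-nonZero q≢0 in
    1≉0 (begin
      1#                               ≈⟨ fromℚ-1 ⟨
      fromℚ ℚ.1ℚ                       ≡⟨ ≡.cong fromℚ (≡.sym (ℚP.*-inverseʳ q)) ⟩
      fromℚ (q ℚ.* ℚ.1/ q)             ≈⟨ fromℚ-* q (ℚ.1/ q) ⟩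
      fromℚ q F.* fromℚ (ℚ.1/ q)       ≈⟨ *-congʳ h ⟩
      0# F.* fromℚ (ℚ.1/ q)            ≈⟨ zeroˡ _ ⟩
      0#                               ∎)

  fromℚ-sum : ∀ d (f : Fin d → ℚ) → fromℚ (ℚMat.sumFin d f) ≈ sumFin d (fromℚ ∘ f)
  fromℚ-sum zero    f = fromℚ-0
  fromℚ-sum (suc d) f = trans (fromℚ-+ _ _) (+-congˡ (fromℚ-sum d (f ∘ suc)))

  fromℚ-scalarM : ∀ {d} q (i j : Fin d) → scalarM (fromℚ q) i j ≈ fromℚ (ℚMat.scalarM q i j)
  fromℚ-scalarM q i j with i Fin.≟ j
  ... | yes _ = refl
  ... | no _  = sym fromℚ-0

  fromℚ-*M : ∀ {d} {A B : ℚMat.Mat d} {A′ B′ : Mat d} → (∀ i j → A′ i j ≈ fromℚ (A i j)) → (∀ i j → B′ i j ≈ fromℚ (B i j)) →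
             ∀ i j → (A′ *M B′) i j ≈ fromℚ ((A ℚMat.*M B) i j)
  fromℚ-*M {d} hA hB i j = trans (sum-cong d (λ k → trans (*-cong (hA i k) (hB k j)) (sym (fromℚ-* _ _)))) (sym (fromℚ-sum d _))

  fromℚ-id : ∀ {d} {A : ℚMat.Mat d} {A′ : Mat d} → (∀ i j → A′ i j ≈ fromℚ (A i j)) → A ℚMat.≈M ℚMat.idM → A′ ≈M idM
  fromℚ-id {A = A} h A≈1 i j = begin
    _                               ≈⟨ h i j ⟩
    fromℚ (A i j)                   ≡⟨ ≡.cong fromℚ (A≈1 i j) ⟩
    fromℚ (ℚMat.idM i j)            ≈⟨ fromℚ-scalarM ℚ.1ℚ i j ⟨
    scalarM (fromℚ ℚ.1ℚ) i j        ≈⟨ one i j ⟩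
    idM i j                         ∎
    where
    one : ∀ {d} (i j : Fin d) → scalarM (fromℚ ℚ.1ℚ) i j ≈ idM i j
    one i j with i Fin.≟ j
    ... | yes _ = fromℚ-1
    ... | no _  = refl

  -- Being zero in the free skew field is tested over ℚ while the hitting point lives over K; this
  -- carries a nonzero rational value across.
  fromℚ-Eval : ∀ {d} {v : Fin n → ℚMat.Mat d} {r M} → ℚMat.Eval v r M →
               ∃ λ M′ → Eval (λ i j l → fromℚ (v i j l)) r M′ × (∀ j l → M′ j l ≈ fromℚ (M j l))
  fromℚ-Eval (ℚMat.e-con q) = _ , e-con q , fromℚ-scalarM q
  fromℚ-Eval (ℚMat.e-var i) = _ , e-var i , λ _ _ → refl
  fromℚ-Eval (ℚMat.e-add E F) = let _ , E′ , h = fromℚ-Eval E ; _ , F′ , h′ = fromℚ-Eval F in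
    _ , e-add E′ F′ , λ j l → trans (+-cong (h j l) (h′ j l)) (sym (fromℚ-+ _ _))
  fromℚ-Eval (ℚMat.e-mul {A = A} {B} E F) = let _ , E′ , h = fromℚ-Eval E ; _ , F′ , h′ = fromℚ-Eval F in
    _ , e-mul E′ F′ , fromℚ-*M {A = A} {B} h h′
  fromℚ-Eval (ℚMat.e-inv {A = A} {B} E AB BA) = let _ , E′ , h = fromℚ-Eval E in
    (λ j l → fromℚ (B j l)) ,
    e-inv E′ (fromℚ-id (fromℚ-*M {A = A} {B} h (λ _ _ → refl)) AB) (fromℚ-id (fromℚ-*M {A = B} {A} (λ _ _ → refl) h) BA) ,
    λ _ _ → refl

  hits : ∀ r → size r ≤ s → invHeight r ≤ 1 → ¬ IsZeroFSF r → DefinedInvertibleAt r (point d₁)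
  hits r size≤ height≤ nonzero = decidable-stable (definedInvertible? (point d₁) r) (λ undef → nonzero (zero-everywhere undef))
    where
    zero-everywhere : ¬ DefinedInvertibleAt r (point d₁) → IsZeroFSF r
    -- In dimension 0 there is no entry to check.
    zero-everywhere undef zero    v M E ()
    zero-everywhere undef (suc e) v M E j l = fromℚ-injective (M j l) (decidable-stable (fromℚ (M j l) ≟ 0#) λ nz →
      let M′ , E′ , M′≈ = fromℚ-Eval E
          M₀ , E₀ = eval-height1 _ size≤ height≤ E′
      in undef (invertible-at-point (point d₀) size≤ E₀ (few-leaves r (suc d₀) size≤) _ E′ (λ M′≈0 → nz (trans (sym (M′≈ j l)) (M′≈0 j l)))))

-- Bounds and assembly

dimension : ℕ → ℕ
dimension s = suc (suc s * 1 * 1 + suc s * suc (suc s * 1 * 1) * suc (suc s * 1 * 1))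

-- With x = n s the bound is (x² + 2x · 3x) · 3x = 21 x³, the origin of the constant 21. It also
-- serves as exponent, since one constant has to fill both places.
dimension-bound : ∀ n s → 1 ≤ n → 1 ≤ s → dimension s ≤ 21 * (n * s) ^ 21
dimension-bound n s 1≤n 1≤s = begin
  dimension s                                     ≡⟨ solve 1 (λ s → con 1 :+ (t s :* con 1 :* con 1 :+ t s :* (con 1 :+ t s :* con 1 :* con 1) :* (con 1 :+ t s :* con 1 :* con 1)) :=
                                                       (con 1 :+ (s :+ con 1) :* (s :+ con 2)) :* (s :+ con 2)) ≡.refl s ⟩
  (1 + (s + 1) * (s + 2)) * (s + 2)               ≤⟨ ℕP.*-mono-≤ (ℕP.+-mono-≤ 1≤xx (ℕP.*-mono-≤ (ℕP.+-mono-≤ s≤x 1≤x) s+2≤)) s+2≤ ⟩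
  (x * x + (x + x) * (x + 2 * x)) * (x + 2 * x)   ≡⟨ solve 1 (λ x → (x :* x :+ (x :+ x) :* (x :+ con 2 :* x)) :* (x :+ con 2 :* x) := con 21 :* (x :* (x :* (x :* con 1)))) ≡.refl x ⟩
  21 * x ^ 3                                      ≤⟨ ℕP.*-monoʳ-≤ 21 (ℕP.^-monoʳ-≤ x {{ℕ.>-nonZero 1≤x}} {3} {21} (ℕP.m≤m+n 3 18)) ⟩
  21 * x ^ 21                                     ∎
  where
  open ℕP.≤-Reasoning
  open +-*-Solver
  t : ∀ {n} → Polynomial n → Polynomial n
  t s = con 1 :+ s
  x = n * s
  1≤x : 1 ≤ x
  1≤x = ℕP.*-mono-≤ 1≤n 1≤s
  s≤x : s ≤ x
  s≤x = ≡.subst (_≤ x) (ℕP.*-identityˡ s) (ℕP.*-monoˡ-≤ s 1≤n)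
  1≤xx : 1 ≤ x * x
  1≤xx = ℕP.*-mono-≤ 1≤x 1≤x
  s+2≤ : s + 2 ≤ x + 2 * x
  s+2≤ = ℕP.+-mono-≤ s≤x (ℕP.*-monoʳ-≤ 2 1≤x)

positive : ∀ n s e → 1 ≤ n → 1 ≤ s → 1 ≤ 21 * (n * s) ^ e
positive n s e 1≤n 1≤s = ℕP.*-mono-≤ (ℕ.s≤s {n = 20} ℕ.z≤n) (ℕP.m^n>0 (n * s) {{ℕ.>-nonZero (ℕP.*-mono-≤ 1≤n 1≤s)}} e)

theorem5p3 : ∃ λ (C : ℕ) → ∀ (n s : ℕ) → 1 ≤ n → 1 ≤ s →
    ∃ λ (ℓ : ℕ) → ∃ λ (d′ : ℕ) →
    1 ≤ ℓ × ℓ ≤ C * (n * s) ^ C × 1 ≤ d′ × d′ ≤ C * (n * s) ^ C ×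
    (∀ (K : QField) → IsℚωzField K ℓ →
    ∃ λ (H : List (Fin n → KMat.Mat K d′)) →
    length H ≤ C * (n * s) ^ (C * (⌊log₂ (n * s) ⌋ + 1)) ×
    (∀ (r : Formula n) → size r ≤ s → invHeight r ≤ 1 → ¬ IsZeroFSF r →
    ∃ λ u → u ∈ H × KMat.DefinedInvertibleAt K r u))
theorem5p3 = 21 , λ n s 1≤n 1≤s →
  -- With ℓ = 1 one has ω = 1, so K is ℚ(z), and powers of z supply the generic entries.
  1 , dimension s , ℕP.≤-refl , positive n s 21 1≤n 1≤s , ℕ.s≤s ℕ.z≤n , dimension-bound n s 1≤n 1≤s , λ K Kz →
    let open HittingPoint K Kz n s in
    point d₁ ∷ [] , positive n s (21 * (⌊log₂ (n * s) ⌋ + 1)) 1≤n 1≤s ,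
    λ r size≤ height≤ nonzero → point d₁ , here ≡.refl , hits r size≤ height≤ nonzero
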